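{- For binary trees $T$ with $n$ leaves, the query complexity in the comparison-query model of inversion minimization on $T$ is at least $\log_2(n!)-O(\log n)$ (where the implied constant is universal, independent of $T$ and $n$).
   Context: A ranking of a set $X$ of $n$ items is a bijection $\rho:X\to\{1,\dots,n\}$. Given two rankings $\sigma,\rho$ of $X$, an inversion of $\sigma$ with respect to $\rho$ is a pair $x_1,x_2\in X$ with $\rho(x_1)<\rho(x_2)$ but $\sigma(x_1)>\sigma(x_2)$; their number is $\mathrm{Inv}_\rho(\sigma)$. An ordering of a rooted tree $T$ is a choice, at every internal node, of a left-to-right order of its children; it induces a left-to-right ranking $\sigma$ of the leaf set $X$. $\mathrm{MInv}(T,\rho)$ is the minimum of $\mathrm{Inv}_\rho(\sigma)$ over all orderings of $T$. Inversion minimization on $T$ is the problem: given a ranking $\rho$ of the leaves, output $\mathrm{MInv}(T,\rho)$. In the comparison-query model, an algorithm accesses $\rho$ only through queries "is $\rho(x_1)<\rho(x_2)$?"; query complexity is the minimum over correct deterministic algorithms of the worst-case number of queries. A binary tree is a rooted tree in which every node has at most two children. -}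

module Defs where

open import Data.Nat using (ℕ; zero; suc; _+_; _≤_)
open import Data.Bool using (Bool; true; false)
open import Data.Fin using (Fin; _<?_)
open import Data.Fin.Permutation using (Permutation′; _⟨$⟩ʳ_)
open import Data.List using (List; []; _∷_; [_]; _++_; length; filter)
open import Data.Product using (Σ; ∃; _×_; _,_)
open import Relation.Nullary using (yes; no)

data BTree (A : Set) : Set where
  leaf : A → BTree A
  un   : BTree A → BTree A
  bin  : BTree A → BTree A → BTree A

leaves : {A : Set} → BTree A → List A
leaves (leaf a)  = [ a ]
leaves (un t)    = leaves t
leaves (bin l r) = leaves l ++ leaves r

-- An ordering of the tree: at each node with two children, a choice of
-- left-to-right order of the children (false = as given, true = swapped).
-- Leaves and unary nodes admit exactly one order.
data Ordering {A : Set} : BTree A → Set where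
  oleaf : (a : A) → Ordering (leaf a)
  oun   : {t : BTree A} → Ordering t → Ordering (un t)
  obin  : {l r : BTree A} → Bool → Ordering l → Ordering r → Ordering (bin l r)

-- The left-to-right sequence of leaves induced by an ordering
-- (this sequence determines the induced ranking σ: σ(x) = position of x).
induced : {A : Set} {t : BTree A} → Ordering t → List A
induced (oleaf a)          = [ a ]
induced (oun o)            = induced o
induced (obin false ol or) = induced ol ++ induced or
induced (obin true  ol or) = induced or ++ induced ol

Ranking : ℕ → Set
Ranking n = Permutation′ n

-- Inv_ρ(σ) where σ is given by its left-to-right leaf sequence:
-- number of pairs (x earlier than y in the sequence) with ρ(y) < ρ(x).
Inv : {n : ℕ} → Ranking n → List (Fin n) → ℕ
Inv ρ []       = 0
Inv ρ (x ∷ xs) = length (filter (λ y → (ρ ⟨$⟩ʳ y) <? (ρ ⟨$⟩ʳ x)) xs) + Inv ρ xs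

IsMInv : {n : ℕ} → BTree (Fin n) → Ranking n → ℕ → Set
IsMInv T ρ m = (Σ (Ordering T) λ o → Inv ρ (induced o) ≡ m)
             × ((o : Ordering T) → m ≤ Inv ρ (induced o))
  where open import Relation.Binary.PropositionalEquality using (_≡_)

-- Deterministic comparison-query algorithms = decision trees.
-- (ask x y t f) asks "is ρ(x) < ρ(y)?" and continues with t if yes, f if no.
data DTree (n : ℕ) : Set where
  answer : ℕ → DTree n
  ask    : Fin n → Fin n → DTree n → DTree n → DTree n

eval : {n : ℕ} → DTree n → Ranking n → ℕ
eval (answer k)    ρ = k
eval (ask x y t f) ρ with (ρ ⟨$⟩ʳ x) <? (ρ ⟨$⟩ʳ y)
... | yes _ = eval t ρ
... | no  _ = eval f ρ

queries : {n : ℕ} → DTree n → Ranking n → ℕ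
queries (answer k)    ρ = 0
queries (ask x y t f) ρ with (ρ ⟨$⟩ʳ x) <? (ρ ⟨$⟩ʳ y)
... | yes _ = suc (queries t ρ)
... | no  _ = suc (queries f ρ)

{-# OPTIONS --safe #-}
module Submission where

-- MInv(T, ρ) is a sum over the nodes v of T of min(a, b), where a + b is the number of pairs of
-- leaves on different sides of v and a is the number of cross-inversions of ρ at v. Exchanging two
-- items of consecutive ranks changes a by one at their lowest common ancestor and nothing else, so it
-- changes MInv unless |a - b| = 1 there; call the pair bad in that case. A correct algorithm compares
-- every consecutive pair that is not bad. Hence ρ is determined by the answers of the algorithm and
-- by the items not compared with their predecessor: walking along ρ, an item that is compared with
-- its predecessor is the only possible continuation. So at most 2^d (n + 1)^(k + 1) rankings have at
-- most k bad pairs.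
--
-- On average a ranking has O(1) bad pairs. The orders in which the leaves of the two sides of the
-- nodes are shuffled are independent. At a node with sides of sizes m ≤ M, a shuffle has
-- at most 2m consecutive pairs from different sides, each consecutive in ρ with probability
-- (m + M) / n, and a given number of inversions has probability O(1 / (M √m)): it is
-- the sum of a random m-element subset of [0, m + M), whose law is smoothed to scale M by removing one
-- element and then spread over √m multiples of M by the free choices between i and i + (m + M) / 2.
-- The resulting sum of √m / n over all nodes is bounded.

open import Defs
open import Algebra.Properties.CommutativeSemigroup using (x∙yz≈y∙xz)
open import Data.Bool using (Bool; true; false; if_then_else_; T; T?; not; _xor_; _∨_)
open import Data.Empty using (⊥; ⊥-elim)
open import Data.Fin using (Fin; toℕ; fromℕ<; _<?_; combine; cast) renaming (_≟_ to _≟ᶠ_)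
open import Data.Fin.Permutation using (_⟨$⟩ʳ_; _⟨$⟩ˡ_; transpose; _∘ₚ_; inverseˡ; permutation)
open import Data.Fin.Properties using (toℕ-injective; toℕ<n; injective⇒≤; toℕ-fromℕ<; fromℕ<-injective; combine-injective; toℕ-cast)
open import Data.List using (List; []; _∷_; [_]; _++_; length; map; concatMap; filter; filterᵇ; allFin; lookup; downFrom)
open import Data.List.Membership.Propositional using (_∈_; _∉_; find)
open import Data.List.Membership.Propositional.Properties using (∈-++⁻; ∈-++⁺ˡ; ∈-++⁺ʳ; ∈-map⁻; ∈-concatMap⁻; ∈-filter⁻; ∈-lookup; ∈-allFin)
import Data.List.Membership.DecPropositional as DecMembership
open import Data.List.Properties using (length-++; length-map; length-downFrom; length-tabulate; filter-accept; filter-reject; ∷-injective; ∷-injectiveˡ; ∷-injectiveʳ)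
import Data.List.Relation.Binary.Permutation.Propositional as ↭
open ↭ using (_↭_)
open import Data.List.Relation.Binary.Permutation.Propositional.Properties using (shift; ∈-resp-↭; ↭-length; filter-↭; ++-comm) renaming (++⁺ to ↭-++⁺)
import Data.List.Relation.Binary.Permutation.Setoid.Properties as Permutationₛ
open import Data.List.Relation.Unary.All as All using (All; []; _∷_)
import Data.List.Relation.Unary.All.Properties as All
open import Data.List.Relation.Unary.AllPairs using (AllPairs; []; _∷_)
import Data.List.Relation.Unary.AllPairs.Properties as AllPairs
open import Data.List.Relation.Unary.Any using (here; there)
open import Data.List.Relation.Unary.Unique.Propositional using (Unique)
import Data.List.Relation.Unary.Unique.Propositional.Properties as Unique
open import Data.Nat using (ℕ; zero; suc; pred; _+_; _*_; _∸_; _^_; _/_; _%_; _⊓_; _⊔_; _!; _≤_; _<_; _≡ᵇ_; z≤n; s≤s; NonZero; >-nonZero)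
open import Data.Nat.Combinatorics using (_C_; nCk+nC[k+1]≡[n+1]C[k+1]; nCk≡nC[n∸k]; k>n⇒nCk≡0; nCn≡1)
open import Data.Nat.DivMod using (m≡m%n+[m/n]*n; m%n<n; m/n*n≤m; /-monoˡ-≤; n/n≡1; [m+kn]%n≡m%n; m<n⇒m%n≡m)
open import Data.Nat.Properties hiding (_<?_)
open import Data.Nat.Tactic.RingSolver using (solve-∀)
open import Data.Product using (Σ; ∃-syntax; _×_; _,_; proj₁; proj₂)
open import Data.Product.Properties using (≡-dec)
open import Data.Sum using (_⊎_; inj₁; inj₂)
open import Function using (_∘_; const)
open import Relation.Binary.Definitions using (tri<; tri≈; tri>)
open import Relation.Binary.PropositionalEquality using (_≡_; _≢_; refl; sym; trans; cong; cong₂; subst; subst₂; setoid; module ≡-Reasoning)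
open import Relation.Nullary using (Dec; does; yes; no; ¬_)
open import Relation.Nullary.Decidable using (dec-true; dec-false)

-- Binomial coefficients

-- A node can carry bad pairs only if the number of pairs across it is odd. Then both sides are odd
-- and their sum n is even, so [0, n) splits into the pairs {i, i + n / 2} without remainder; this
-- parity is why no other case of the subset-sum estimate is needed. Square roots never occur.
-- Binomial bounds are stated for squares, and √(2m) is replaced by (4/3)^i with 2^i ≤ 2m, which is
-- no larger because 16/9 ≤ 2 and still grows like a positive power of m. Probabilities become
-- totals over all rankings, with factorials in place of denominators. The sum over the nodes must
-- be bounded for every shape of tree, from a path-like to a balanced one. The induction therefore
-- proves a slightly better bound, with a saving of (3/4)^j for trees of at most 2^j leaves. At a
-- node the larger side is used with the exponent j of the whole tree and the smaller side with an
-- exponent i < j fitted to its own size; the difference of the two savings, weighted by the smaller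
-- side, pays for the pairs across the node. The logarithmic claim is proved in exponential form, as
-- a bound of n! by a power of two times a power of n + 1.

pascal : ∀ n k → suc n C suc k ≡ n C suc k + n C k
pascal n k = trans (sym (nCk+nC[k+1]≡[n+1]C[k+1] n k)) (+-comm (n C k) (n C suc k))

C-factorial : ∀ i j → ((i + j) C i) * (i ! * j !) ≡ (i + j) !
C-factorial zero    j = trans (*-identityˡ (1 * j !)) (*-identityˡ (j !))
C-factorial (suc i) zero rewrite +-identityʳ i | nCn≡1 (suc i) = trans (*-identityˡ _) (*-identityʳ _)
C-factorial (suc i) (suc j) = begin
  (suc (i + suc j) C suc i) * (suc i ! * suc j !)
    ≡⟨ cong (_* (suc i ! * suc j !)) (pascal (i + suc j) i) ⟩
  ((i + suc j) C suc i + (i + suc j) C i) * (suc i ! * suc j !)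
    ≡⟨ regroup ((i + suc j) C suc i) ((i + suc j) C i) (suc i) (i !) (suc j) (j !) ⟩
  suc j * (((i + suc j) C suc i) * (suc i ! * j !)) + suc i * (((i + suc j) C i) * (i ! * suc j !))
    ≡⟨ cong₂ (λ x y → suc j * x + suc i * y)
         (trans (cong (λ n → (n C suc i) * (suc i ! * j !)) (+-suc i j))
           (trans (C-factorial (suc i) j) (cong _! (sym (+-suc i j)))))
         (C-factorial i (suc j)) ⟩
  suc j * (i + suc j) ! + suc i * (i + suc j) !
    ≡⟨ collect i j ((i + suc j) !) ⟩
  suc (i + suc j) * (i + suc j) ! ∎
  where
  open ≡-Reasoning
  regroup : ∀ a b p x q y → (a + b) * ((p * x) * (q * y)) ≡ q * (a * ((p * x) * y)) + p * (b * (x * (q * y)))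
  regroup = solve-∀
  collect : ∀ i j x → suc j * x + suc i * x ≡ suc (i + suc j) * x
  collect = solve-∀

C-shift : ∀ i j → suc i * ((suc i + j) C suc i) ≡ suc j * ((i + suc j) C i)
C-shift i j = *-cancelʳ-≡ _ _ (i ! * j !) {{i !* j !≢0}} (begin
  suc i * ((suc i + j) C suc i) * (i ! * j !)   ≡⟨ left ((suc i + j) C suc i) (suc i) (i !) (j !) ⟩
  ((suc i + j) C suc i) * (suc i ! * j !)       ≡⟨ C-factorial (suc i) j ⟩
  (suc i + j) !                                 ≡⟨ cong _! (sym (+-suc i j)) ⟩
  (i + suc j) !                                 ≡⟨ sym (C-factorial i (suc j)) ⟩
  ((i + suc j) C i) * (i ! * suc j !)           ≡⟨ right ((i + suc j) C i) (suc j) (i !) (j !) ⟩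
  suc j * ((i + suc j) C i) * (i ! * j !)       ∎)
  where
  open ≡-Reasoning
  left : ∀ c p x y → p * c * (x * y) ≡ c * ((p * x) * y)
  left = solve-∀
  right : ∀ c q x y → c * (x * (q * y)) ≡ q * c * (x * y)
  right = solve-∀

C-absorb : ∀ i j → suc i * ((suc i + j) C suc i) ≡ suc (i + j) * ((i + j) C i)
C-absorb i j = *-cancelʳ-≡ _ _ (i ! * j !) {{i !* j !≢0}} (begin
  suc i * ((suc i + j) C suc i) * (i ! * j !)   ≡⟨ left ((suc i + j) C suc i) (suc i) (i !) (j !) ⟩
  ((suc i + j) C suc i) * (suc i ! * j !)       ≡⟨ C-factorial (suc i) j ⟩
  suc (i + j) * (i + j) !                       ≡⟨ cong (suc (i + j) *_) (sym (C-factorial i j)) ⟩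
  suc (i + j) * (((i + j) C i) * (i ! * j !))   ≡⟨ sym (*-assoc (suc (i + j)) ((i + j) C i) (i ! * j !)) ⟩
  suc (i + j) * ((i + j) C i) * (i ! * j !)     ∎)
  where
  open ≡-Reasoning
  left : ∀ c p x y → p * c * (x * y) ≡ c * ((p * x) * y)
  left = solve-∀

central-even-step : ∀ n → suc n * ((suc n + suc n) C suc n) ≡ (2 * suc (n + n)) * ((n + n) C n)
central-even-step n = *-cancelˡ-≡ _ _ (suc n) (begin
  suc n * (suc n * ((suc n + suc n) C suc n))     ≡⟨ cong (suc n *_) (C-absorb n (suc n)) ⟩
  suc n * (suc (n + suc n) * ((n + suc n) C n))   ≡⟨ left (suc n) (suc (n + suc n)) _ ⟩
  suc (n + suc n) * (suc n * ((n + suc n) C n))   ≡⟨ cong (suc (n + suc n) *_) (sym (C-shift n n)) ⟩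
  suc (n + suc n) * (suc n * ((suc n + n) C suc n)) ≡⟨ cong (suc (n + suc n) *_) (C-absorb n n) ⟩
  suc (n + suc n) * (suc (n + n) * ((n + n) C n)) ≡⟨ right n ((n + n) C n) ⟩
  suc n * ((2 * suc (n + n)) * ((n + n) C n))     ∎)
  where
  open ≡-Reasoning
  left : ∀ a b c → a * (b * c) ≡ b * (a * c)
  left = solve-∀
  right : ∀ n c → suc (n + suc n) * (suc (n + n) * c) ≡ suc n * ((2 * suc (n + n)) * c)
  right = solve-∀

-- Squaring keeps the bound 4^n / √(2n + 1) on the central coefficient within the naturals. By the
-- ratio in `central-even-step`, the induction step reduces to (2n + 3)(2n + 1) ≤ (2n + 2)².
central-even : ∀ n → suc (n + n) * (((n + n) C n) * ((n + n) C n)) ≤ 16 ^ n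
central-even zero    = ≤-refl
central-even (suc n) = *-cancelˡ-≤ (suc n * suc n) (begin
  suc n * suc n * (suc (suc n + suc n) * (b′ * b′))
    ≡⟨ left (suc n) (suc (suc n + suc n)) b′ ⟩
  suc (suc n + suc n) * ((suc n * b′) * (suc n * b′))
    ≡⟨ cong (λ x → suc (suc n + suc n) * (x * x)) (central-even-step n) ⟩
  suc (suc n + suc n) * ((2 * suc (n + n)) * b * ((2 * suc (n + n)) * b))
    ≡⟨ middle (suc (suc n + suc n)) (suc (n + n)) b ⟩
  4 * (suc (suc n + suc n) * suc (n + n)) * (suc (n + n) * (b * b))
    ≤⟨ *-mono-≤ {4 * (suc (suc n + suc n) * suc (n + n))} (*-monoʳ-≤ 4 (≤-trans (m≤m+n (suc (suc n + suc n) * suc (n + n)) 1) (≤-reflexive (square n)))) (central-even n) ⟩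
  4 * (4 * (suc n * suc n)) * 16 ^ n
    ≡⟨ right (suc n) (16 ^ n) ⟩
  suc n * suc n * (16 * 16 ^ n) ∎)
  where
  open ≤-Reasoning
  b = (n + n) C n
  b′ = (suc n + suc n) C suc n
  left : ∀ p q b → p * p * (q * (b * b)) ≡ q * ((p * b) * (p * b))
  left = solve-∀
  middle : ∀ p q b → p * (2 * q * b * (2 * q * b)) ≡ 4 * (p * q) * (q * (b * b))
  middle = solve-∀
  square : ∀ n → suc (suc n + suc n) * suc (n + n) + 1 ≡ 4 * (suc n * suc n)
  square = solve-∀
  right : ∀ p x → 4 * (4 * (p * p)) * x ≡ p * p * (16 * x)
  right = solve-∀

-- The central coefficient of the next row is twice this one, so the even bound at `suc n`
-- transfers.
central-odd : ∀ n → suc (n + suc n) * (((n + suc n) C n) * ((n + suc n) C n)) ≤ 4 * 16 ^ n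
central-odd n = *-cancelˡ-≤ 4 (begin
  4 * (suc (n + suc n) * (c * c))             ≡⟨ left (suc (n + suc n)) c ⟩
  suc (n + suc n) * ((2 * c) * (2 * c))       ≡⟨ cong (λ x → suc (n + suc n) * (x * x)) (sym double) ⟩
  suc (n + suc n) * (b′ * b′)                 ≤⟨ *-monoˡ-≤ (b′ * b′) (n≤1+n (suc (n + suc n))) ⟩
  suc (suc n + suc n) * (b′ * b′)             ≤⟨ central-even (suc n) ⟩
  16 * 16 ^ n                                 ≡⟨ *-assoc 4 4 (16 ^ n) ⟩
  4 * (4 * 16 ^ n)                            ∎)
  where
  open ≤-Reasoning
  c = (n + suc n) C n
  b′ = (suc n + suc n) C suc n
  left : ∀ p c → 4 * (p * (c * c)) ≡ p * ((2 * c) * (2 * c))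
  left = solve-∀
  double : b′ ≡ 2 * c
  double = *-cancelˡ-≡ _ _ (suc n) (trans (C-absorb n (suc n)) (arith n c))
    where
    arith : ∀ n c → suc (n + suc n) * c ≡ suc n * (2 * c)
    arith = solve-∀

-- Moving i and j towards each other increases the coefficient.
C-square-bound : ∀ i d → let u = i + (i + d) in suc u * ((u C i) * (u C i)) ≤ 4 ^ u
C-square-bound i zero rewrite +-identityʳ i = ≤-trans (central-even i) (≤-reflexive (power i))
  where
  power : ∀ n → 16 ^ n ≡ 4 ^ (n + n)
  power n = trans (^-*-assoc 4 2 n) (cong (4 ^_) (cong (n +_) (+-identityʳ n)))
C-square-bound i (suc zero) rewrite +-comm i 1 = ≤-trans (central-odd i) (≤-reflexive (power i))
  where
  power : ∀ n → 4 * 16 ^ n ≡ 4 ^ (n + suc n)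
  power n rewrite +-suc n n = cong (4 *_) (trans (^-*-assoc 4 2 n) (cong (4 ^_) (cong (n +_) (+-identityʳ n))))
C-square-bound i (suc (suc d)) = begin
  suc (i + k) * (c * c)   ≤⟨ *-monoʳ-≤ (suc (i + k)) (*-mono-≤ step step) ⟩
  suc (i + k) * (c′ * c′) ≡⟨ cong (λ x → suc x * ((x C suc i) * (x C suc i))) (shift-sum i d) ⟩
  suc u * ((u C suc i) * (u C suc i)) ≤⟨ C-square-bound (suc i) d ⟩
  4 ^ u                   ≡⟨ cong (4 ^_) (sym (shift-sum i d)) ⟩
  4 ^ (i + k)             ∎
  where
  open ≤-Reasoning
  k = i + suc (suc d)
  u = suc i + (suc i + d)
  c = (i + k) C i
  c′ = (i + k) C suc i
  shift-sum : ∀ i d → i + (i + suc (suc d)) ≡ suc i + (suc i + d)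
  shift-sum = solve-∀
  step : c ≤ c′
  step = *-cancelˡ-≤ (suc i) (begin
    suc i * c
      ≤⟨ *-monoˡ-≤ c (≤-trans (m≤m+n (suc i) (suc d)) (≤-reflexive (sym (+-suc i (suc d))))) ⟩
    k * c
      ≡⟨ cong (λ x → x * ((i + x) C i)) (+-suc i (suc d)) ⟩
    suc (i + suc d) * ((i + suc (i + suc d)) C i)
      ≡⟨ sym (C-shift i (i + suc d)) ⟩
    suc i * ((suc i + (i + suc d)) C suc i)
      ≡⟨ cong (λ x → suc i * (x C suc i)) (arith i d) ⟩
    suc i * c′ ∎)
    where
    arith : ∀ i d → suc i + (i + suc d) ≡ i + (i + suc (suc d))
    arith = solve-∀

binomial-square : ∀ u j → suc u * ((u C j) * (u C j)) ≤ 4 ^ u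
binomial-square u j with ≤-<-connex j u
... | inj₂ u<j rewrite k>n⇒nCk≡0 u<j | *-zeroʳ u = z≤n
... | inj₁ j≤u with ≤-total j (u ∸ j)
... | inj₁ j≤k = subst (λ x → suc x * ((x C j) * (x C j)) ≤ 4 ^ x) eq (C-square-bound j (u ∸ j ∸ j))
  where
  eq : j + (j + (u ∸ j ∸ j)) ≡ u
  eq = trans (cong (j +_) (m+[n∸m]≡n j≤k)) (m+[n∸m]≡n j≤u)
... | inj₂ k≤j rewrite nCk≡nC[n∸k] j≤u =
  subst (λ x → suc x * ((x C (u ∸ j)) * (x C (u ∸ j))) ≤ 4 ^ x) eq (C-square-bound (u ∸ j) (j ∸ (u ∸ j)))
  where
  eq : (u ∸ j) + ((u ∸ j) + (j ∸ (u ∸ j))) ≡ u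
  eq = trans (cong ((u ∸ j) +_) (m+[n∸m]≡n k≤j)) (m∸n+n≡m j≤u)

-- Finite sums

Σ< : ℕ → (ℕ → ℕ) → ℕ
Σ< zero    a = 0
Σ< (suc n) a = Σ< n a + a n

Σ<-cong : ∀ n {a b} → (∀ i → a i ≡ b i) → Σ< n a ≡ Σ< n b
Σ<-cong zero    e = refl
Σ<-cong (suc n) e = cong₂ _+_ (Σ<-cong n e) (e n)

Σ<-head : ∀ n a → Σ< (suc n) a ≡ a 0 + Σ< n (a ∘ suc)
Σ<-head zero    a = +-comm 0 (a 0)
Σ<-head (suc n) a = trans (cong (_+ a (suc n)) (Σ<-head n a)) (+-assoc (a 0) _ _)

Σ<-+ : ∀ n a b → Σ< n (λ i → a i + b i) ≡ Σ< n a + Σ< n b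
Σ<-+ zero    a b = refl
Σ<-+ (suc n) a b rewrite Σ<-+ n a b = interchange (Σ< n a) (Σ< n b) (a n) (b n)
  where
  interchange : ∀ w x y z → w + x + (y + z) ≡ w + y + (x + z)
  interchange = solve-∀

Σ<-split : ∀ m n a → Σ< (m + n) a ≡ Σ< m a + Σ< n (λ i → a (m + i))
Σ<-split m zero    a rewrite +-identityʳ m = sym (+-identityʳ _)
Σ<-split m (suc n) a rewrite +-suc m n | Σ<-split m n a = +-assoc (Σ< m a) _ _

Σ<-weighted : ∀ n (a b : ℕ → ℕ) c → (∀ i → a i ≤ c) → Σ< n (λ i → a i * b i) ≤ c * Σ< n b
Σ<-weighted zero    a b c a≤c = z≤n
Σ<-weighted (suc n) a b c a≤c = begin
  Σ< n (λ i → a i * b i) + a n * b n ≤⟨ +-mono-≤ (Σ<-weighted n a b c a≤c) (*-monoˡ-≤ (b n) (a≤c n)) ⟩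
  c * Σ< n b + c * b n               ≡⟨ sym (*-distribˡ-+ c (Σ< n b) (b n)) ⟩
  c * (Σ< n b + b n)                 ∎
  where open ≤-Reasoning

δ : ℕ → ℕ → ℕ
δ k x = if x ≡ᵇ k then 1 else 0

-- Subset sums

-- Number of m-element subsets A of a list of values, weighted by f (sum of A).
subsets : List ℕ → ℕ → (ℕ → ℕ) → ℕ
subsets vs       zero    f = f 0
subsets []       (suc m) f = 0
subsets (v ∷ vs) (suc m) f = subsets vs (suc m) f + subsets vs m (f ∘ (v +_))

subsets-mono : ∀ vs m {f g} → (∀ x → f x ≤ g x) → subsets vs m f ≤ subsets vs m g
subsets-mono vs       zero    h = h 0
subsets-mono []       (suc m) h = z≤n
subsets-mono (v ∷ vs) (suc m) h = +-mono-≤ (subsets-mono vs (suc m) h) (subsets-mono vs m (h ∘ (v +_)))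

subsets-cong : ∀ vs m {f g} → (∀ x → f x ≡ g x) → subsets vs m f ≡ subsets vs m g
subsets-cong vs       zero    h = h 0
subsets-cong []       (suc m) h = refl
subsets-cong (v ∷ vs) (suc m) h = cong₂ _+_ (subsets-cong vs (suc m) h) (subsets-cong vs m (h ∘ (v +_)))

subsets-+ : ∀ vs m f g → subsets vs m (λ x → f x + g x) ≡ subsets vs m f + subsets vs m g
subsets-+ vs       zero    f g = refl
subsets-+ []       (suc m) f g = refl
subsets-+ (v ∷ vs) (suc m) f g
  rewrite subsets-+ vs (suc m) f g | subsets-+ vs m (f ∘ (v +_)) (g ∘ (v +_)) =
  interchange (subsets vs (suc m) f) (subsets vs (suc m) g) _ _
  where
  interchange : ∀ w x y z → w + x + (y + z) ≡ w + y + (x + z)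
  interchange = solve-∀

subsets-↭ : ∀ {vs ws} → vs ↭ ws → ∀ m f → subsets vs m f ≡ subsets ws m f
subsets-↭ ↭.refl         m       f = refl
subsets-↭ (↭.trans p q)  m       f = trans (subsets-↭ p m f) (subsets-↭ q m f)
subsets-↭ (↭.prep v p)   zero    f = refl
subsets-↭ (↭.prep v p)   (suc m) f = cong₂ _+_ (subsets-↭ p (suc m) f) (subsets-↭ p m _)
subsets-↭ (↭.swap v w p) zero    f = refl
subsets-↭ (↭.swap v w p) (suc zero) f
  rewrite subsets-↭ p 1 f = commute _ (f (w + 0)) (f (v + 0))
  where
  commute : ∀ x y z → x + y + z ≡ x + z + y
  commute = solve-∀
subsets-↭ {_} {_ ∷ _ ∷ vs} (↭.swap v w p) (suc (suc m)) f
  rewrite subsets-↭ p (suc (suc m)) f | subsets-↭ p (suc m) (f ∘ (w +_)) | subsets-↭ p (suc m) (f ∘ (v +_))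
        | subsets-↭ p m (f ∘ (v +_) ∘ (w +_))
        | subsets-cong vs m {f ∘ (v +_) ∘ (w +_)} {f ∘ (w +_) ∘ (v +_)} (λ x → cong f (x∙yz≈y∙xz +-commutativeSemigroup v w x)) =
  interchange (subsets vs (suc (suc m)) f) _ _ _
  where
  interchange : ∀ a b c d → a + b + (c + d) ≡ a + c + (b + d)
  interchange = solve-∀

window : ℕ → (ℕ → ℕ) → ℕ → ℕ
window s f x = Σ< s (λ i → f (x + i))

-- Remove one element from a subset: the sum of the rest lies in a window of length s,
-- and the removed element is recovered from the two sums.
subsets-remove : ∀ s m f →
  suc m * subsets (downFrom s) (suc m) f ≤ subsets (downFrom s) m (window s f)
subsets-remove zero    m f rewrite *-zeroʳ m = z≤n
subsets-remove (suc s) zero f = begin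
  1 * (subsets (downFrom s) 1 f + f (s + 0)) ≡⟨ split (subsets (downFrom s) 1 f) (f (s + 0)) ⟩
  1 * subsets (downFrom s) 1 f + f (s + 0)   ≤⟨ +-mono-≤ (subsets-remove s 0 f) (≤-reflexive (cong f (+-identityʳ s))) ⟩
  window s f 0 + f s                         ∎
  where
  open ≤-Reasoning
  split : ∀ a b → 1 * (a + b) ≡ 1 * a + b
  split = solve-∀
subsets-remove (suc s) (suc m) f = begin
  suc (suc m) * (a + b)
    ≡⟨ split (suc m) a b ⟩
  suc (suc m) * a + (suc m * b + b)
    ≤⟨ +-mono-≤ (subsets-remove s (suc m) f) (+-monoˡ-≤ b (subsets-remove s m (f ∘ (s +_)))) ⟩
  c + (d + b)
    ≤⟨ +-monoʳ-≤ c (+-monoˡ-≤ b (subsets-mono (downFrom s) m widen)) ⟩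
  c + (e + b)
    ≡⟨ swap-last c e b ⟩
  c + b + e
    ≡⟨ cong (λ z → c + z + e) (subsets-cong (downFrom s) (suc m) (λ x → cong f (+-comm s x))) ⟩
  c + subsets (downFrom s) (suc m) (λ x → f (x + s)) + e
    ≡⟨ cong (_+ e) (sym (subsets-+ (downFrom s) (suc m) (window s f) (λ x → f (x + s)))) ⟩
  subsets (downFrom s) (suc m) (window (suc s) f) + e ∎
  where
  open ≤-Reasoning
  a = subsets (downFrom s) (suc (suc m)) f
  b = subsets (downFrom s) (suc m) (f ∘ (s +_))
  c = subsets (downFrom s) (suc m) (window s f)
  d = subsets (downFrom s) m (window s (f ∘ (s +_)))
  e = subsets (downFrom s) m (window (suc s) f ∘ (s +_))
  split : ∀ m a b → suc m * (a + b) ≡ suc m * a + (m * b + b)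
  split = solve-∀
  swap-last : ∀ x y z → x + (y + z) ≡ x + z + y
  swap-last = solve-∀
  widen : ∀ x → window s (f ∘ (s +_)) x ≤ window (suc s) f (s + x)
  widen x = ≤-trans (≤-reflexive (Σ<-cong s (λ i → cong f (sym (+-assoc s x i))))) (m≤m+n _ _)

-- downFrom (h + H) regrouped into the pairs {i, i + H}.

pairs : ℕ → ℕ → List ℕ
pairs zero    H = []
pairs (suc h) H = h ∷ (h + H) ∷ pairs h H

downFrom-pairs : ∀ h → downFrom (h + h) ↭ pairs h h
downFrom-pairs h = ↭.↭-trans (↭.↭-reflexive (upper h)) (interleave h)
  where
  upper : ∀ k → downFrom (k + h) ≡ map (_+ h) (downFrom k) ++ downFrom h
  upper zero    = refl
  upper (suc k) = cong (k + h ∷_) (upper k)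
  interleave : ∀ k → map (_+ h) (downFrom k) ++ downFrom k ↭ pairs k h
  interleave zero    = ↭.refl
  interleave (suc k) = ↭.↭-trans (shift k (map (_+ h) (downFrom (suc k))) (downFrom k))
    (↭.prep k (↭.prep (k + h) (interleave k)))

-- Sum over the ways to meet h pairs in 0, 1 or 2 elements, m elements in total,
-- of the weight w at the number of pairs met exactly once.
profiles : ℕ → ℕ → (ℕ → ℕ) → ℕ
profiles zero    zero          w = w 0
profiles zero    (suc m)       w = 0
profiles (suc h) zero          w = profiles h 0 w
profiles (suc h) (suc zero)    w = profiles h 1 w + profiles h 0 (w ∘ suc)
profiles (suc h) (suc (suc m)) w = profiles h (suc (suc m)) w + profiles h (suc m) (w ∘ suc) + profiles h m w

profiles-mono : ∀ h m {w z} → (∀ u → w u ≤ z u) → profiles h m w ≤ profiles h m z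
profiles-mono zero    zero          le = le 0
profiles-mono zero    (suc m)       le = z≤n
profiles-mono (suc h) zero          le = profiles-mono h 0 le
profiles-mono (suc h) (suc zero)    le = +-mono-≤ (profiles-mono h 1 le) (profiles-mono h 0 (le ∘ suc))
profiles-mono (suc h) (suc (suc m)) le =
  +-mono-≤ (+-mono-≤ (profiles-mono h (suc (suc m)) le) (profiles-mono h (suc m) (le ∘ suc))) (profiles-mono h m le)

profiles-cong : ∀ h m {w z} → (∀ u → w u ≡ z u) → profiles h m w ≡ profiles h m z
profiles-cong h m e = ≤-antisym (profiles-mono h m (≤-reflexive ∘ e)) (profiles-mono h m (≤-reflexive ∘ sym ∘ e))

profiles-linear : ∀ h m a b w z →
  profiles h m (λ u → a * w u + b * z u) ≡ a * profiles h m w + b * profiles h m z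
profiles-linear zero    zero    a b w z = refl
profiles-linear zero    (suc m) a b w z rewrite *-zeroʳ a | *-zeroʳ b = refl
profiles-linear (suc h) zero    a b w z = profiles-linear h 0 a b w z
profiles-linear (suc h) (suc zero) a b w z
  rewrite profiles-linear h 1 a b w z | profiles-linear h 0 a b (w ∘ suc) (z ∘ suc) =
  regroup a b (profiles h 1 w) (profiles h 1 z) _ _
  where
  regroup : ∀ a b p q r s → a * p + b * q + (a * r + b * s) ≡ a * (p + r) + b * (q + s)
  regroup = solve-∀
profiles-linear (suc h) (suc (suc m)) a b w z
  rewrite profiles-linear h (suc (suc m)) a b w z | profiles-linear h (suc m) a b (w ∘ suc) (z ∘ suc)
        | profiles-linear h m a b w z =
  regroup a b (profiles h (suc (suc m)) w) (profiles h (suc (suc m)) z) (profiles h (suc m) (w ∘ suc)) _ _ _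
  where
  regroup : ∀ a b p q r s t v → a * p + b * q + (a * r + b * s) + (a * t + b * v) ≡ a * (p + r + t) + b * (q + s + v)
  regroup = solve-∀

-- A pair met exactly once can be met in two ways, so with the weight 2^u the profiles count all
-- m-element subsets of 2h items. The factor `c` takes up the 2 that `w ∘ suc` produces in the
-- induction.
profiles-2^ : ∀ h m c → profiles h m (λ u → c * 2 ^ u) ≡ c * ((h + h) C m)
profiles-2^ zero    zero    c = refl
profiles-2^ zero    (suc m) c = sym (*-zeroʳ c)
profiles-2^ (suc h) zero    c = profiles-2^ h 0 c
profiles-2^ (suc h) (suc zero) c = begin
  profiles h 1 (λ u → c * 2 ^ u) + profiles h 0 (λ u → c * (2 * 2 ^ u))
    ≡⟨ cong₂ _+_ (profiles-2^ h 1 c) (trans (profiles-cong h 0 (λ u → sym (*-assoc c 2 (2 ^ u)))) (profiles-2^ h 0 (c * 2))) ⟩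
  c * ((h + h) C 1) + c * 2 * 1
    ≡⟨ arith c ((h + h) C 1) ⟩
  c * ((h + h) C 1 + 1 + 1)
    ≡⟨ cong (c *_) (sym (trans (cong (_C 1) (+-suc (suc h) h)) (trans (pascal (suc (h + h)) 0) (cong (_+ 1) (pascal (h + h) 0))))) ⟩
  c * ((suc h + suc h) C 1) ∎
  where
  open ≡-Reasoning
  arith : ∀ c x → c * x + c * 2 * 1 ≡ c * (x + 1 + 1)
  arith = solve-∀
profiles-2^ (suc h) (suc (suc m)) c = begin
  profiles h (suc (suc m)) (λ u → c * 2 ^ u) + profiles h (suc m) (λ u → c * (2 * 2 ^ u)) + profiles h m (λ u → c * 2 ^ u)
    ≡⟨ cong₂ _+_ (cong₂ _+_ (profiles-2^ h (suc (suc m)) c)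
         (trans (profiles-cong h (suc m) (λ u → sym (*-assoc c 2 (2 ^ u)))) (profiles-2^ h (suc m) (c * 2))))
         (profiles-2^ h m c) ⟩
  c * (n C suc (suc m)) + c * 2 * (n C suc m) + c * (n C m)
    ≡⟨ arith c (n C suc (suc m)) (n C suc m) (n C m) ⟩
  c * (n C suc (suc m) + n C suc m + (n C suc m + n C m))
    ≡⟨ cong (c *_) (sym (trans (cong (_C suc (suc m)) (+-suc (suc h) h))
         (trans (pascal (suc n) (suc m)) (cong₂ _+_ (pascal n (suc m)) (pascal n m))))) ⟩
  c * ((suc h + suc h) C suc (suc m)) ∎
  where
  open ≡-Reasoning
  n = h + h
  arith : ∀ c x y z → c * x + c * 2 * y + c * z ≡ c * (x + y + (y + z))
  arith = solve-∀

-- (h + 1) · h! / (d! u! e!) = (u + 1) · (h + 1)! / (d! (u + 1)! e!), d + u + e = h.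
profiles-absorb : ∀ h m z y → (∀ u → suc u * z u ≤ y (suc u)) →
  suc h * profiles h m z ≤ profiles (suc h) (suc m) y
profiles-absorb zero zero z y z≤y = z≤y 0
profiles-absorb zero (suc m) z y z≤y = z≤n
profiles-absorb (suc h) zero z y z≤y = begin
  suc (suc h) * profiles h 0 z ≡⟨ +-comm (profiles h 0 z) _ ⟩
  suc h * profiles h 0 z + profiles h 0 z
    ≤⟨ +-mono-≤ (profiles-absorb h 0 z y z≤y) (profiles-mono h 0 (λ u → ≤-trans (m≤m+n (z u) (u * z u)) (z≤y u))) ⟩
  profiles (suc h) 1 y + profiles h 0 (y ∘ suc) ∎
  where open ≤-Reasoning
profiles-absorb (suc h) (suc m) z y z≤y = begin
  suc (suc h) * P                       ≡⟨ +-comm P _ ⟩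
  suc h * P + P                         ≤⟨ +-monoˡ-≤ P (inner m) ⟩
  profiles (suc h) (suc (suc m)) y + profiles (suc h) (suc m) y′ + rest m + P
                                        ≡⟨ regroup (profiles (suc h) (suc (suc m)) y) (profiles (suc h) (suc m) y′) (rest m) P ⟩
  profiles (suc h) (suc (suc m)) y + (1 * profiles (suc h) (suc m) y′ + 1 * P) + rest m
    ≡⟨ cong (λ x → profiles (suc h) (suc (suc m)) y + x + rest m) (sym (profiles-linear (suc h) (suc m) 1 1 y′ z)) ⟩
  profiles (suc h) (suc (suc m)) y + profiles (suc h) (suc m) (λ u → 1 * y′ u + 1 * z u) + rest m
    ≤⟨ +-monoˡ-≤ (rest m) (+-monoʳ-≤ _ (profiles-mono (suc h) (suc m)
         (λ u → ≤-trans (≤-reflexive (y′+z u (z u))) (z≤y u)))) ⟩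
  profiles (suc h) (suc (suc m)) y + profiles (suc h) (suc m) (y ∘ suc) + rest m
    ≤⟨ +-monoʳ-≤ (profiles (suc h) (suc (suc m)) y + profiles (suc h) (suc m) (y ∘ suc)) (final m) ⟩
  profiles (suc (suc h)) (suc (suc m)) y ∎
  where
  open ≤-Reasoning
  P = profiles (suc h) (suc m) z
  -- The coefficient `suc u` is split as u + 1: the part u serves the induction hypothesis for
  -- `z ∘ suc`, and the part 1 pays for the extra copy of `P` that comes from raising h.
  y′ = λ u → u * z u
  rest : ℕ → ℕ
  rest zero    = 0
  rest (suc m) = profiles (suc h) (suc m) y
  final : ∀ m → rest m ≤ profiles (suc h) m y
  final zero    = z≤n
  final (suc m) = ≤-refl
  regroup : ∀ a b c p → a + b + c + p ≡ a + (1 * b + 1 * p) + c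
  regroup = solve-∀
  y′+z : ∀ u x → 1 * (u * x) + 1 * x ≡ suc u * x
  y′+z = solve-∀
  inner : ∀ m → suc h * profiles (suc h) (suc m) z ≤
                profiles (suc h) (suc (suc m)) y + profiles (suc h) (suc m) y′ + rest m
  inner zero = begin
    suc h * (profiles h 1 z + profiles h 0 (z ∘ suc))
      ≡⟨ *-distribˡ-+ (suc h) (profiles h 1 z) _ ⟩
    suc h * profiles h 1 z + suc h * profiles h 0 (z ∘ suc)
      ≤⟨ +-mono-≤ (profiles-absorb h 1 z y z≤y) (profiles-absorb h 0 (z ∘ suc) y′ (λ u → ≤-refl)) ⟩
    profiles (suc h) 2 y + profiles (suc h) 1 y′
      ≡⟨ sym (+-identityʳ _) ⟩
    profiles (suc h) 2 y + profiles (suc h) 1 y′ + 0 ∎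
  inner (suc m) = begin
    suc h * (profiles h (suc (suc m)) z + profiles h (suc m) (z ∘ suc) + profiles h m z)
      ≡⟨ distrib (suc h) (profiles h (suc (suc m)) z) _ _ ⟩
    suc h * profiles h (suc (suc m)) z + suc h * profiles h (suc m) (z ∘ suc) + suc h * profiles h m z
      ≤⟨ +-mono-≤ (+-mono-≤ (profiles-absorb h (suc (suc m)) z y z≤y)
                            (profiles-absorb h (suc m) (z ∘ suc) y′ (λ u → ≤-refl)))
                  (profiles-absorb h m z y z≤y) ⟩
    profiles (suc h) (suc (suc (suc m))) y + profiles (suc h) (suc (suc m)) y′ + profiles (suc h) (suc m) y ∎
    where
    distrib : ∀ a b c d → a * (b + c + d) ≡ a * b + a * c + a * d
    distrib = solve-∀

-- Free choices within pairs

Δ : ℕ → (ℕ → ℕ) → ℕ → ℕ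
Δ H f x = f x + f (x + H)

-- The u-th power of the operator 1 + E, where E is the shift by `H`. Each pair {i, i + H} met
-- exactly once contributes one factor.
Δ^ : ℕ → ℕ → (ℕ → ℕ) → ℕ → ℕ
Δ^ zero    H f = f
Δ^ (suc u) H f = Δ^ u H (Δ H f)

Δ^-cong : ∀ u H {f g} → (∀ x → f x ≡ g x) → ∀ x → Δ^ u H f x ≡ Δ^ u H g x
Δ^-cong zero    H e x = e x
Δ^-cong (suc u) H e x = Δ^-cong u H (λ y → cong₂ _+_ (e y) (e (y + H))) x

Δ^-shift : ∀ u H a f x → Δ^ u H (f ∘ (a +_)) x ≡ Δ^ u H f (a + x)
Δ^-shift zero    H a f x = refl
Δ^-shift (suc u) H a f x = trans
  (Δ^-cong u H (λ y → cong (λ z → f (a + y) + f z) (sym (+-assoc a y H))) x)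
  (Δ^-shift u H a (Δ H f) x)

-- Fix which pairs are met in 0, 1 or 2 elements. The free choices in the u pairs met once then add
-- up to one value of `Δ^ u H f`, at a base point given by all the other data. Since `w u` bounds
-- this value at every base point, only the profile is left to sum over.
subsets-pairs : ∀ h H m f w → (∀ u x → Δ^ u H f x ≤ w u) → subsets (pairs h H) m f ≤ profiles h m w
subsets-pairs zero    H zero    f w le = le 0 0
subsets-pairs zero    H (suc m) f w le = z≤n
subsets-pairs (suc h) H zero    f w le = subsets-pairs h H zero f w le
subsets-pairs (suc h) H (suc m) f w le = go m
  where
  open ≤-Reasoning
  -- The two ways of meeting the first pair exactly once combine to a single `Δ H`.
  met : ∀ m → subsets (pairs h H) m (f ∘ ((h + H) +_)) + subsets (pairs h H) m (f ∘ (h +_)) ≤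
              profiles h m (w ∘ suc)
  met m = begin
    subsets (pairs h H) m (f ∘ ((h + H) +_)) + subsets (pairs h H) m (f ∘ (h +_))
      ≡⟨ trans (+-comm (subsets (pairs h H) m (f ∘ ((h + H) +_))) _) (sym (subsets-+ (pairs h H) m _ _)) ⟩
    subsets (pairs h H) m (λ x → f (h + x) + f (h + H + x))
      ≡⟨ subsets-cong (pairs h H) m (λ x → cong (λ y → f (h + x) + f y) (rotate h H x)) ⟩
    subsets (pairs h H) m (Δ H f ∘ (h +_))
      ≤⟨ subsets-pairs h H m _ _ (λ u x → ≤-trans (≤-reflexive (Δ^-shift u H h (Δ H f) x)) (le (suc u) (h + x))) ⟩
    profiles h m (w ∘ suc) ∎
    where
    rotate : ∀ h H x → h + H + x ≡ h + x + H
    rotate = solve-∀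
  go : ∀ m → subsets (pairs (suc h) H) (suc m) f ≤ profiles (suc h) (suc m) w
  go zero = begin
    subsets (pairs h H) 1 f + subsets (pairs h H) 0 (f ∘ ((h + H) +_)) + subsets (pairs h H) 0 (f ∘ (h +_))
      ≡⟨ +-assoc (subsets (pairs h H) 1 f) _ _ ⟩
    subsets (pairs h H) 1 f + (subsets (pairs h H) 0 (f ∘ ((h + H) +_)) + subsets (pairs h H) 0 (f ∘ (h +_)))
      ≤⟨ +-mono-≤ (subsets-pairs h H 1 f w le) (met 0) ⟩
    profiles h 1 w + profiles h 0 (w ∘ suc) ∎
  go (suc m) = begin
    a + b + (c + d)
      ≡⟨ regroup a b c d ⟩
    a + (b + c) + d
      ≤⟨ +-mono-≤ (+-mono-≤ (subsets-pairs h H (suc (suc m)) f w le) (met (suc m)))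
           (subsets-pairs h H m _ w (λ u x → ≤-trans
             (≤-reflexive (trans (Δ^-shift u H (h + H) (f ∘ (h +_)) x) (Δ^-shift u H h f (h + H + x)))) (le u _))) ⟩
    profiles (suc h) (suc (suc m)) w ∎
    where
    a = subsets (pairs h H) (suc (suc m)) f
    b = subsets (pairs h H) (suc m) (f ∘ ((h + H) +_))
    c = subsets (pairs h H) (suc m) (f ∘ (h +_))
    d = subsets (pairs h H) m (f ∘ (h +_) ∘ ((h + H) +_))
    regroup : ∀ a b c d → a + b + (c + d) ≡ a + (b + c) + d
    regroup = solve-∀

-- The binomial theorem for (1 + E)^u.
Δ^-expand : ∀ u H f x → Δ^ u H f x ≡ Σ< (suc u) (λ j → (u C j) * f (x + j * H))
Δ^-expand zero    H f x = sym (trans (*-identityˡ _) (cong f (+-identityʳ x)))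
Δ^-expand (suc u) H f x = begin
  Δ^ u H (Δ H f) x
    ≡⟨ Δ^-expand u H (Δ H f) x ⟩
  Σ< (suc u) (λ j → (u C j) * (a j + f (x + j * H + H)))
    ≡⟨ Σ<-cong (suc u) (λ j → trans (cong (λ y → (u C j) * (a j + f y)) (next x (j * H) H)) (*-distribˡ-+ (u C j) (a j) (a (suc j)))) ⟩
  Σ< (suc u) (λ j → (u C j) * a j + (u C j) * a (suc j))
    ≡⟨ Σ<-+ (suc u) (λ j → (u C j) * a j) (λ j → (u C j) * a (suc j)) ⟩
  Σ< (suc u) (λ j → (u C j) * a j) + S
    ≡⟨ cong (_+ S) (trans (sym (+-identityʳ _)) (cong (λ c → Σ< (suc u) (λ j → (u C j) * a j) + c * a (suc u)) (sym (k>n⇒nCk≡0 (n<1+n u))))) ⟩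
  Σ< (suc (suc u)) (λ j → (u C j) * a j) + S
    ≡⟨ cong (_+ S) (Σ<-head (suc u) (λ j → (u C j) * a j)) ⟩
  (u C 0) * a 0 + Σ< (suc u) (λ j → (u C suc j) * a (suc j)) + S
    ≡⟨ +-assoc ((u C 0) * a 0) _ _ ⟩
  (u C 0) * a 0 + (Σ< (suc u) (λ j → (u C suc j) * a (suc j)) + S)
    ≡⟨ cong ((u C 0) * a 0 +_) (sym (Σ<-+ (suc u) _ _)) ⟩
  (suc u C 0) * a 0 + Σ< (suc u) (λ j → (u C suc j) * a (suc j) + (u C j) * a (suc j))
    ≡⟨ cong ((suc u C 0) * a 0 +_) (Σ<-cong (suc u) (λ j →
         trans (sym (*-distribʳ-+ (a (suc j)) (u C suc j) (u C j))) (cong (_* a (suc j)) (sym (pascal u j))))) ⟩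
  (suc u C 0) * a 0 + Σ< (suc u) (λ j → (suc u C suc j) * a (suc j))
    ≡⟨ sym (Σ<-head (suc u) (λ j → (suc u C j) * a j)) ⟩
  Σ< (suc (suc u)) (λ j → (suc u C j) * a j) ∎
  where
  open ≡-Reasoning
  a = λ j → f (x + j * H)
  S = Σ< (suc u) (λ j → (u C j) * a (suc j))
  next : ∀ x y H → x + y + H ≡ x + (H + y)
  next = solve-∀

-- The points of a window are distinct, so at most one of them hits `k`.
window-δ≤1 : ∀ s k x → window s (δ k) x ≤ 1
window-δ≤1 zero    k x = z≤n
window-δ≤1 (suc s) k x with (x + s) ≡ᵇ k in eq
... | false rewrite +-identityʳ (window s (δ k) x) = window-δ≤1 s k x
... | true  = ≤-reflexive (cong (_+ 1) (none s ≤-refl))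
  where
  hit : x + s ≡ k
  hit = ≡ᵇ⇒≡ _ _ (subst T (sym eq) _)
  none : ∀ t → t ≤ s → window t (δ k) x ≡ 0
  none zero    t≤s = refl
  none (suc t) t<s with (x + t) ≡ᵇ k in eq′
  ... | false = trans (+-identityʳ _) (none t (<⇒≤ t<s))
  ... | true  = ⊥-elim (<-irrefl (trans (≡ᵇ⇒≡ _ _ (subst T (sym eq′) _)) (sym hit)) (+-monoʳ-< x t<s))

window-windows : ∀ J H f x → Σ< J (λ j → window H f (x + j * H)) ≡ window (J * H) f x
window-windows zero    H f x = refl
window-windows (suc J) H f x = trans
  (cong₂ _+_ (window-windows J H f x) (Σ<-cong H (λ i → cong f (+-assoc x (J * H) i))))
  (trans (sym (Σ<-split (J * H) H (λ i → f (x + i)))) (cong (λ s → window s f x) (+-comm (J * H) H)))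

-- The windows of length `H` at x + j H are disjoint and tile one long window, so `k` lies in at
-- most one of them and a single binomial coefficient survives. This is where smoothing to scale `H`
-- and spreading over multiples of `H` combine.
Δ^-window-δ : ∀ u H k x c → (∀ j → u C j ≤ c) → Δ^ u H (window H (δ k)) x ≤ c
Δ^-window-δ u H k x c C≤c = begin
  Δ^ u H (window H (δ k)) x                                     ≡⟨ Δ^-expand u H _ x ⟩
  Σ< (suc u) (λ j → (u C j) * window H (δ k) (x + j * H))       ≤⟨ Σ<-weighted (suc u) (u C_) _ c C≤c ⟩
  c * Σ< (suc u) (λ j → window H (δ k) (x + j * H))             ≡⟨ cong (c *_) (window-windows (suc u) H (δ k) x) ⟩
  c * window (suc u * H) (δ k) x                                ≤⟨ *-monoʳ-≤ c (window-δ≤1 (suc u * H) k x) ⟩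
  c * 1                                                         ≡⟨ *-identityʳ c ⟩
  c                                                             ∎
  where open ≤-Reasoning

-- The number of subsets with a given sum

square-cancel-≤ : ∀ {x y} → x * x ≤ y * y → x ≤ y
square-cancel-≤ {x} {y} le with ≤-<-connex x y
... | inj₁ x≤y = x≤y
... | inj₂ y<x = ⊥-elim (<-irrefl refl (≤-trans (*-mono-< y<x y<x) le))

-- A running maximum, so that the largest coefficient of row n is `maxC n n` without a decision on
-- which index is the middle one.
maxC : ℕ → ℕ → ℕ
maxC n zero    = n C 0
maxC n (suc j) = maxC n j ⊔ (n C suc j)

C≤maxC′ : ∀ n j {k} → k ≤ j → n C k ≤ maxC n j
C≤maxC′ n zero    z≤n = ≤-refl
C≤maxC′ n (suc j) {k} k≤1+j with m≤n⇒m<n∨m≡n k≤1+j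
... | inj₁ (s≤s k≤j) = ≤-trans (C≤maxC′ n j k≤j) (m≤m⊔n (maxC n j) (n C suc j))
... | inj₂ refl      = m≤n⊔m (maxC n j) (n C suc j)

C≤maxC : ∀ n k → n C k ≤ maxC n n
C≤maxC n k with ≤-<-connex k n
... | inj₁ k≤n = C≤maxC′ n n k≤n
... | inj₂ n<k rewrite k>n⇒nCk≡0 n<k = z≤n

maxC-square : ∀ n j → suc n * (maxC n j * maxC n j) ≤ 4 ^ n
maxC-square n zero    = binomial-square n 0
maxC-square n (suc j) with ⊔-sel (maxC n j) (n C suc j)
... | inj₁ eq rewrite eq = maxC-square n j
... | inj₂ eq rewrite eq = binomial-square n (suc j)

4^≡2^*2^ : ∀ u → 4 ^ u ≡ 2 ^ u * 2 ^ u
4^≡2^*2^ zero    = refl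
4^≡2^*2^ (suc u) rewrite 4^≡2^*2^ u = arith (2 ^ u)
  where
  arith : ∀ x → 4 * (x * x) ≡ 2 * x * (2 * x)
  arith = solve-∀

-- Because u + 1 ≤ 2^u the quotient is at least 1, so the remainder is smaller than the multiple of
-- `suc u` below 2^u, and rounding down costs at most a factor of 2.
2^≤2*floor : ∀ u → 2 ^ u ≤ 2 * (suc u * (2 ^ u / suc u))
2^≤2*floor u = begin
  2 ^ u                     ≡⟨ m≡m%n+[m/n]*n (2 ^ u) (suc u) ⟩
  2 ^ u % suc u + q * suc u ≤⟨ +-monoˡ-≤ (q * suc u) (≤-trans (<⇒≤ (m%n<n (2 ^ u) (suc u))) (m≤n*m (suc u) q {{>-nonZero 1≤q}})) ⟩
  q * suc u + q * suc u     ≡⟨ arith q (suc u) ⟩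
  2 * (suc u * q)           ∎
  where
  open ≤-Reasoning
  q = 2 ^ u / suc u
  u<2^u : ∀ u → suc u ≤ 2 ^ u
  u<2^u zero    = ≤-refl
  u<2^u (suc u) = ≤-trans (+-mono-≤ (m^n>0 2 u) (u<2^u u)) (≤-reflexive (cong (2 ^ u +_) (sym (+-identityʳ (2 ^ u)))))
  1≤q : 1 ≤ q
  1≤q = subst (_≤ q) (n/n≡1 (suc u)) (/-monoˡ-≤ (suc u) (u<2^u u))
  arith : ∀ q s → q * s + q * s ≡ 2 * (s * q)
  arith = solve-∀

-- With g = a / b, w u ≤ O(2^u / √(u + 1)) and z u ≈ 2^u / (u + 1):  g · w ≤ O(2^u + g² z),
-- by comparing g² with u + 1.
trade-off : ∀ a b u w z → suc u * (w * w) ≤ 4 * 4 ^ u → 2 ^ u ≤ 2 * (suc u * z) →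
  a * b * w ≤ 2 * (b * b) * 2 ^ u + 4 * (a * a) * z
trade-off a b u w z w≤ z≥ with ≤-total (a * a) (suc u * (b * b))
... | inj₁ le = ≤-trans (begin
  a * b * w              ≡⟨ rearrange a b w ⟩
  b * (a * w)            ≤⟨ *-monoʳ-≤ b (square-cancel-≤ (begin
    (a * w) * (a * w)                ≡⟨ sq a w ⟩
    (a * a) * (w * w)                ≤⟨ *-monoˡ-≤ (w * w) le ⟩
    suc u * (b * b) * (w * w)        ≡⟨ move (suc u) (b * b) (w * w) ⟩
    b * b * (suc u * (w * w))        ≤⟨ *-monoʳ-≤ (b * b) w≤ ⟩
    b * b * (4 * 4 ^ u)              ≡⟨ cong (λ x → b * b * (4 * x)) (4^≡2^*2^ u) ⟩
    b * b * (4 * (2 ^ u * 2 ^ u))    ≡⟨ sq′ b (2 ^ u) ⟩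
    2 * b * 2 ^ u * (2 * b * 2 ^ u)  ∎)) ⟩
  b * (2 * b * 2 ^ u)    ≡⟨ final b (2 ^ u) ⟩
  2 * (b * b) * 2 ^ u    ∎) (m≤m+n _ _)
  where
  open ≤-Reasoning
  rearrange : ∀ a b w → a * b * w ≡ b * (a * w)
  rearrange = solve-∀
  sq : ∀ a w → (a * w) * (a * w) ≡ (a * a) * (w * w)
  sq = solve-∀
  sq′ : ∀ b x → b * b * (4 * (x * x)) ≡ 2 * b * x * (2 * b * x)
  sq′ = solve-∀
  move : ∀ u b w → u * b * w ≡ b * (u * w)
  move = solve-∀
  final : ∀ b x → b * (2 * b * x) ≡ 2 * (b * b) * x
  final = solve-∀
... | inj₂ ge = ≤-trans (begin
  a * b * w              ≡⟨ *-assoc a b w ⟩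
  a * (b * w)            ≤⟨ *-monoʳ-≤ a (*-cancelˡ-≤ (suc u) (begin
    suc u * (b * w)                  ≤⟨ square-cancel-≤ (begin
      suc u * (b * w) * (suc u * (b * w))    ≡⟨ sq (suc u) b w ⟩
      suc u * (b * b) * (suc u * (w * w))    ≤⟨ *-mono-≤ ge w≤ ⟩
      a * a * (4 * 4 ^ u)                    ≡⟨ cong (λ x → a * a * (4 * x)) (4^≡2^*2^ u) ⟩
      a * a * (4 * (2 ^ u * 2 ^ u))          ≡⟨ sq′ a (2 ^ u) ⟩
      2 * a * 2 ^ u * (2 * a * 2 ^ u)        ∎) ⟩
    2 * a * 2 ^ u                    ≤⟨ *-monoʳ-≤ (2 * a) z≥ ⟩
    2 * a * (2 * (suc u * z))        ≡⟨ pull (suc u) a z ⟩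
    suc u * (4 * a * z)              ∎)) ⟩
  a * (4 * a * z)        ≡⟨ final a z ⟩
  4 * (a * a) * z        ∎) (m≤n+m _ _)
  where
  open ≤-Reasoning
  sq : ∀ u b w → u * (b * w) * (u * (b * w)) ≡ u * (b * b) * (u * (w * w))
  sq = solve-∀
  sq′ : ∀ b x → b * b * (4 * (x * x)) ≡ 2 * b * x * (2 * b * x)
  sq′ = solve-∀
  pull : ∀ u a z → 2 * a * (2 * (u * z)) ≡ u * (4 * a * z)
  pull = solve-∀
  final : ∀ a z → a * (4 * a * z) ≡ 4 * (a * a) * z
  final = solve-∀

-- The ratio of the two coefficients is (i + j + 1) / (j + 1).
C-double : ∀ i j → i ≤ suc j → (i + suc j) C i ≤ 2 * ((i + j) C i)
C-double i j i≤1+j = *-cancelˡ-≤ (suc j) (begin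
  suc j * ((i + suc j) C i)     ≡⟨ sym (C-shift i j) ⟩
  suc i * ((suc i + j) C suc i) ≡⟨ C-absorb i j ⟩
  suc (i + j) * ((i + j) C i)   ≤⟨ *-monoˡ-≤ ((i + j) C i) (≤-trans (≤-reflexive (sym (+-suc i j))) (+-monoˡ-≤ (suc j) i≤1+j)) ⟩
  (suc j + suc j) * ((i + j) C i) ≡⟨ arith (suc j) ((i + j) C i) ⟩
  suc j * (2 * ((i + j) C i))   ∎)
  where
  open ≤-Reasoning
  arith : ∀ j x → (j + j) * x ≡ j * (2 * x)
  arith = solve-∀

-- The fraction a / b stands for a number up to √(2 (m + 1)), so the share of the subsets with sum
-- `k` is O(1 / (n √m)). One removed element gives a window, the pairs bound it by `w u`, and
-- `trade-off` replaces `w u` by the two weights 2^u and 2^u / (u + 1), whose profile sums are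
-- known. The factor n + 2 = 2 (h + 1) is what `profiles-absorb` offers.
subset-sum-bound : ∀ m M h a b k → let n = suc m + M in
  suc m ≤ M → n ≡ h + h → a * a ≤ 2 * suc m * (b * b) → .{{NonZero b}} →
  suc (suc n) * a * subsets (downFrom n) (suc m) (δ k) ≤ 36 * b * (n C suc m)
subset-sum-bound m M h a b k m≤M n≡2h a²≤ = *-cancelˡ-≤ (suc m * b) {{m*n≢0 (suc m) b}} (begin
  suc m * b * (suc (suc n) * a * N)
    ≡⟨ regroup (suc m) b (suc (suc n)) a N ⟩
  suc (suc n) * (a * b * (suc m * N))
    ≤⟨ *-monoʳ-≤ (suc (suc n)) (*-monoʳ-≤ (a * b) (≤-trans (subsets-remove n m (δ k)) paired)) ⟩
  suc (suc n) * (a * b * profiles h m w)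
    ≡⟨ cong (suc (suc n) *_) (trans (sym (+-identityʳ _)) (sym (profiles-linear h m (a * b) 0 w w))) ⟩
  suc (suc n) * profiles h m (λ u → a * b * w u + 0)
    ≤⟨ *-monoʳ-≤ (suc (suc n)) (profiles-mono h m (λ u → ≤-trans (≤-reflexive (+-identityʳ _))
         (trade-off a b u (w u) (z u)
           (≤-trans (*-monoˡ-≤ (w u * w u) (n≤1+n (suc u))) (maxC-square (suc u) (suc u))) (2^≤2*floor u)))) ⟩
  suc (suc n) * profiles h m (λ u → 2 * (b * b) * 2 ^ u + 4 * (a * a) * z u)
    ≡⟨ cong (suc (suc n) *_) (trans (profiles-linear h m (2 * (b * b)) (4 * (a * a)) (2 ^_) z)
         (cong (λ x → 2 * (b * b) * x + 4 * (a * a) * profiles h m z)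
           (trans (profiles-cong h m (λ u → sym (*-identityˡ (2 ^ u)))) (trans (profiles-2^ h m 1) (*-identityˡ _))))) ⟩
  suc (suc n) * (2 * (b * b) * ((h + h) C m) + 4 * (a * a) * profiles h m z)
    ≡⟨ distrib (suc (suc n)) (b * b) (a * a) ((h + h) C m) (profiles h m z) ⟩
  2 * (b * b) * (suc (suc n) * ((h + h) C m)) + 4 * (a * a) * (suc (suc n) * profiles h m z)
    ≤⟨ +-mono-≤ (*-monoʳ-≤ (2 * (b * b)) first) (*-monoʳ-≤ (4 * (a * a)) second) ⟩
  2 * (b * b) * (2 * (suc m * c)) + 4 * (a * a) * (4 * c)
    ≤⟨ +-monoʳ-≤ (2 * (b * b) * (2 * (suc m * c))) (*-monoˡ-≤ (4 * c) (*-monoʳ-≤ 4 a²≤)) ⟩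
  2 * (b * b) * (2 * (suc m * c)) + 4 * (2 * suc m * (b * b)) * (4 * c)
    ≡⟨ collect (suc m) b c ⟩
  suc m * b * (36 * b * c) ∎)
  where
  open ≤-Reasoning
  n = suc m + M
  N = subsets (downFrom n) (suc m) (δ k)
  c = n C suc m
  w z : ℕ → ℕ
  w u = maxC (suc u) (suc u)
  z u = 2 ^ u / suc u
  -- Absorption turns the weight `z` on h pairs into `y` on h + 1 pairs, and 2 `y u` ≤ 2^u; so the
  -- result is compared with the subsets of a set of n + 2 elements, two applications of `C-double`
  -- away from n.
  y : ℕ → ℕ
  y zero    = 0
  y (suc u) = suc u * z u
  regroup : ∀ m b s a N → m * b * (s * a * N) ≡ s * (a * b * (m * N))
  regroup = solve-∀
  distrib : ∀ s b a p q → s * (2 * b * p + 4 * a * q) ≡ 2 * b * (s * p) + 4 * a * (s * q)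
  distrib = solve-∀
  -- The constant is 36 = 2 · 2 + 4 · 2 · 4.
  collect : ∀ m b c → 2 * (b * b) * (2 * (m * c)) + 4 * (2 * m * (b * b)) * (4 * c) ≡ m * b * (36 * b * c)
  collect = solve-∀
  paired : subsets (downFrom n) m (window n (δ k)) ≤ profiles h m w
  paired = begin
    subsets (downFrom n) m (window n (δ k))
      ≡⟨ cong (λ s → subsets (downFrom s) m (window s (δ k))) n≡2h ⟩
    subsets (downFrom (h + h)) m (window (h + h) (δ k))
      ≡⟨ subsets-↭ (downFrom-pairs h) m _ ⟩
    subsets (pairs h h) m (window (h + h) (δ k))
      ≤⟨ subsets-pairs h h m _ w (λ u x → ≤-trans (≤-reflexive (Δ^-cong u h halves x))
           (Δ^-window-δ (suc u) h k x (w u) (C≤maxC (suc u)))) ⟩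
    profiles h m w ∎
    where
    -- A window of length h + h is itself one `Δ h`, so the removed element adds a free choice.
    -- Hence `w u` is taken from row u + 1.
    halves : ∀ x → window (h + h) (δ k) x ≡ Δ h (window h (δ k)) x
    halves x = trans (Σ<-split h h (λ i → δ k (x + i)))
      (cong (window h (δ k) x +_) (Σ<-cong h (λ i → cong (δ k) (sym (+-assoc x h i)))))
  first : suc (suc n) * ((h + h) C m) ≤ 2 * (suc m * c)
  first = begin
    suc (suc n) * ((h + h) C m)        ≤⟨ *-monoˡ-≤ ((h + h) C m) (s≤s (s≤s (+-monoˡ-≤ M m≤M))) ⟩
    suc (suc (M + M)) * ((h + h) C m)  ≡⟨ cong (λ s → suc (suc (M + M)) * (s C m)) (trans (sym n≡2h) (sym (+-suc m M))) ⟩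
    suc (suc (M + M)) * ((m + suc M) C m) ≡⟨ arith M ((m + suc M) C m) ⟩
    2 * (suc M * ((m + suc M) C m))    ≡⟨ cong (2 *_) (sym (C-shift m M)) ⟩
    2 * (suc m * c)                    ∎
    where
    arith : ∀ M x → suc (suc (M + M)) * x ≡ 2 * (suc M * x)
    arith = solve-∀
  second : suc (suc n) * profiles h m z ≤ 4 * c
  second = begin
    suc (suc n) * profiles h m z             ≡⟨ cong (λ s → suc (suc s) * profiles h m z) n≡2h ⟩
    suc (suc (h + h)) * profiles h m z       ≡⟨ arith h (profiles h m z) ⟩
    2 * (suc h * profiles h m z)             ≤⟨ *-monoʳ-≤ 2 (profiles-absorb h m z y (λ u → ≤-refl)) ⟩
    2 * profiles (suc h) (suc m) y           ≡⟨ trans (sym (+-identityʳ _)) (sym (profiles-linear (suc h) (suc m) 2 0 y y)) ⟩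
    profiles (suc h) (suc m) (λ u → 2 * y u + 0) ≤⟨ profiles-mono (suc h) (suc m) (λ u → ≤-trans (≤-reflexive (+-identityʳ _)) (≤-trans (2y≤ u) (≤-reflexive (sym (*-identityˡ (2 ^ u)))))) ⟩
    profiles (suc h) (suc m) (λ u → 1 * 2 ^ u) ≡⟨ trans (profiles-2^ (suc h) (suc m) 1) (*-identityˡ _) ⟩
    (suc h + suc h) C suc m                  ≡⟨ cong (_C suc m) size ⟩
    (suc m + suc (suc M)) C suc m            ≤⟨ C-double (suc m) (suc M) (≤-trans m≤M (≤-trans (n≤1+n M) (n≤1+n _))) ⟩
    2 * ((suc m + suc M) C suc m)            ≤⟨ *-monoʳ-≤ 2 (C-double (suc m) M (≤-trans m≤M (n≤1+n M))) ⟩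
    2 * (2 * c)                              ≡⟨ sym (*-assoc 2 2 c) ⟩
    4 * c                                    ∎
    where
    arith : ∀ h x → suc (suc (h + h)) * x ≡ 2 * (suc h * x)
    arith = solve-∀
    size : suc h + suc h ≡ suc m + suc (suc M)
    size = trans (cong suc (+-suc h h)) (trans (cong (suc ∘ suc) (sym n≡2h)) (add2 m M))
      where
      add2 : ∀ m M → suc (suc (suc m + M)) ≡ suc m + suc (suc M)
      add2 = solve-∀
    2y≤ : ∀ u → 2 * y u ≤ 2 ^ u
    2y≤ zero    = z≤n
    2y≤ (suc u) = *-monoʳ-≤ 2 (≤-trans (≤-reflexive (*-comm (suc u) (z u))) (m/n*n≤m (2 ^ u) (suc u)))

-- Words and their inversions

-- Sum of f (inversions) over the words with l letters L and r letters R, an inversion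
-- being an R before an L; the recursion is on the first letter.
words : ℕ → ℕ → (ℕ → ℕ) → ℕ
words zero    r       f = f 0
words (suc l) zero    f = f 0
words (suc l) (suc r) f = words l (suc r) f + words (suc l) r (f ∘ (suc l +_))

words-mono : ∀ l r {f g} → (∀ x → f x ≤ g x) → words l r f ≤ words l r g
words-mono zero    r       le = le 0
words-mono (suc l) zero    le = le 0
words-mono (suc l) (suc r) le = +-mono-≤ (words-mono l (suc r) le) (words-mono (suc l) r (le ∘ (suc l +_)))

words-cong : ∀ l r {f g} → (∀ x → f x ≡ g x) → words l r f ≡ words l r g
words-cong l r e = ≤-antisym (words-mono l r (≤-reflexive ∘ e)) (words-mono l r (≤-reflexive ∘ sym ∘ e))

words-+ : ∀ l r f g → words l r (λ x → f x + g x) ≡ words l r f + words l r g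
words-+ zero    r       f g = refl
words-+ (suc l) zero    f g = refl
words-+ (suc l) (suc r) f g rewrite words-+ l (suc r) f g | words-+ (suc l) r (f ∘ (suc l +_)) (g ∘ (suc l +_)) =
  interchange (words l (suc r) f) (words l (suc r) g) _ _
  where
  interchange : ∀ w x y z → w + x + (y + z) ≡ w + y + (x + z)
  interchange = solve-∀

words-0 : ∀ l r → words l r (λ _ → 0) ≡ 0
words-0 zero    r       = refl
words-0 (suc l) zero    = refl
words-0 (suc l) (suc r) = cong₂ _+_ (words-0 l (suc r)) (words-0 (suc l) r)

words-last : ∀ l r f → words (suc l) (suc r) f ≡ words (suc l) r f + words l (suc r) (f ∘ (suc r +_))
words-last zero    zero    f = refl
words-last zero    (suc r) f rewrite words-last zero r (f ∘ suc) = sym (+-assoc (f 0) _ _)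
words-last (suc l) zero    f rewrite words-last l zero f = +-assoc (f 0) _ _
words-last (suc l) (suc r) f = begin
  words (suc l) (suc (suc r)) f + words (suc (suc l)) (suc r) (f ∘ (suc (suc l) +_))
    ≡⟨ cong₂ _+_ (words-last l (suc r) f) (words-last (suc l) r (f ∘ (suc (suc l) +_))) ⟩
  words (suc l) (suc r) f + words l (suc (suc r)) (f ∘ (suc (suc r) +_)) +
  (words (suc (suc l)) r (f ∘ (suc (suc l) +_)) + words (suc l) (suc r) (f ∘ (suc (suc l) +_) ∘ (suc r +_)))
    ≡⟨ interchange (words (suc l) (suc r) f) _ _ _ ⟩
  words (suc l) (suc r) f + words (suc (suc l)) r (f ∘ (suc (suc l) +_)) +
  (words l (suc (suc r)) (f ∘ (suc (suc r) +_)) + words (suc l) (suc r) (f ∘ (suc (suc l) +_) ∘ (suc r +_)))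
    ≡⟨ cong (λ x → words (suc l) (suc r) f + words (suc (suc l)) r (f ∘ (suc (suc l) +_)) +
                   (words l (suc (suc r)) (f ∘ (suc (suc r) +_)) + x))
         (words-cong (suc l) (suc r) (λ x → cong f (exchange l r x))) ⟩
  words (suc (suc l)) (suc r) f + words (suc l) (suc (suc r)) (f ∘ (suc (suc r) +_)) ∎
  where
  open ≡-Reasoning
  exchange : ∀ l r x → suc (suc l) + (suc r + x) ≡ suc (suc r) + (suc l + x)
  exchange = solve-∀
  interchange : ∀ w x y z → w + x + (y + z) ≡ w + y + (x + z)
  interchange = solve-∀

-- Reading a word backwards with the two letters exchanged preserves its inversions, and
-- `words-last` is what the recursion on the first letter becomes.
words-sym : ∀ l r f → words l r f ≡ words r l f
words-sym zero    zero    f = refl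
words-sym zero    (suc r) f = refl
words-sym (suc l) zero    f = refl
words-sym (suc l) (suc r) f = begin
  words l (suc r) f + words (suc l) r (f ∘ (suc l +_))
    ≡⟨ cong₂ _+_ (words-sym l (suc r) f) (words-sym (suc l) r (f ∘ (suc l +_))) ⟩
  words (suc r) l f + words r (suc l) (f ∘ (suc l +_))
    ≡⟨ sym (words-last r l f) ⟩
  words (suc r) (suc l) f ∎
  where open ≡-Reasoning

subsets-short : ∀ vs m f → length vs < m → subsets vs m f ≡ 0
subsets-short []       (suc m) f _         = refl
subsets-short (v ∷ vs) (suc m) f (s≤s lt) rewrite
  subsets-short vs (suc m) f (≤-trans lt (n≤1+n m)) = subsets-short vs m _ lt

-- An R followed by i further letters has i minus (number of R's after it) L's after it.
subsets-words : ∀ l r f → subsets (downFrom (l + r)) r f ≡ words l r (λ x → f (x + Σ< r (λ i → i)))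
subsets-words zero zero f = refl
subsets-words (suc l) zero f = refl
subsets-words zero (suc r) f
  rewrite subsets-short (downFrom r) (suc r) f (s≤s (≤-reflexive (length-downFrom r)))
        | subsets-words zero r (f ∘ (r +_)) = cong f (+-comm r _)
subsets-words (suc l) (suc r) f = cong₂ _+_ (subsets-words l (suc r) f) (begin
  subsets (downFrom (l + suc r)) r (f ∘ ((l + suc r) +_))
    ≡⟨ cong (λ s → subsets (downFrom s) r (f ∘ (s +_))) (+-suc l r) ⟩
  subsets (downFrom (suc l + r)) r (f ∘ ((suc l + r) +_))
    ≡⟨ subsets-words (suc l) r _ ⟩
  words (suc l) r (λ x → f (suc l + r + (x + t)))
    ≡⟨ words-cong (suc l) r (λ x → cong f (arith (suc l) r x t)) ⟩
  words (suc l) r (λ x → f (suc l + x + (t + r))) ∎)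
  where
  open ≡-Reasoning
  t = Σ< r (λ i → i)
  arith : ∀ l r x t → l + r + (x + t) ≡ l + x + (t + r)
  arith = solve-∀

δ-≤ : ∀ {j k x y} → (x ≡ j → y ≡ k) → δ j x ≤ δ k y
δ-≤ {j} {k} {x} {y} h with x ≡ᵇ j in eq | y ≡ᵇ k in eq′
... | false | _     = z≤n
... | true  | true  = ≤-refl
... | true  | false with () ← subst T eq′ (≡⇒≡ᵇ y k (h (≡ᵇ⇒≡ x j (subst T (sym eq) _))))

-- Indicator of |2x - p| = 1.
central : ℕ → ℕ → ℕ
central p x = δ p (suc (x + x)) + δ (suc p) (x + x)

parity : ∀ n → ∃[ k ] (n ≡ k + k ⊎ n ≡ suc (k + k))
parity zero    = 0 , inj₁ refl
parity (suc n) with parity n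
... | k , inj₁ eq = k , inj₂ (cong suc eq)
... | k , inj₂ eq = suc k , inj₁ (trans (cong suc eq) (cong suc (sym (+-suc k k))))

odd≢even : ∀ a b → suc (a + a) ≡ b + b → ∀ {A : Set} → A
odd≢even a (suc b) eq = odd≢even b a (sym (trans (suc-injective eq) (+-suc b b)))

double-injective : ∀ a b → a + a ≡ b + b → a ≡ b
double-injective zero    zero    eq = refl
double-injective (suc a) (suc b) eq = cong suc (double-injective a b
  (suc-injective (trans (sym (+-suc a a)) (trans (suc-injective eq) (+-suc b b)))))

central-even≡0 : ∀ k x → central (k + k) x ≡ 0
central-even≡0 k x = n≤0⇒n≡0 (+-mono-≤ (δ-≤ {k = 1} {y = 0} (λ eq → odd≢even x k eq))
                                       (δ-≤ {k = 1} {y = 0} (λ eq → odd≢even k x (sym eq))))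

central-odd-≤ : ∀ k x → central (suc (k + k)) x ≤ δ k x + δ (suc k) x
central-odd-≤ k x = +-mono-≤ (δ-≤ (λ eq → double-injective x k (suc-injective eq)))
  (δ-≤ (λ eq → double-injective x (suc k) (trans eq (cong suc (sym (+-suc k k))))))

-- This provides the half length h for the pairs {i, i + h}.
odd-product : ∀ m n k → m * n ≡ suc (k + k) → ∃[ h ] (m + n ≡ h + h)
odd-product m n k eq with parity m | parity n
... | a , inj₁ refl | b , _         = odd≢even k (a * n) (trans (sym eq) (*-distribʳ-+ n a a))
... | a , inj₂ refl | b , inj₁ refl = odd≢even k (m * b) (trans (sym eq) (*-distribˡ-+ m b b))
... | a , inj₂ refl | b , inj₂ refl = suc (a + b) , arith a b
  where
  arith : ∀ a b → suc (a + a) + suc (b + b) ≡ suc (a + b) + suc (a + b)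
  arith = solve-∀

-- The positions of the R's form a subset whose sum exceeds the number of inversions by the constant
-- `t`. The factor 1 / n in the subset bound is what lowers n! to (n - 1)!.
words-point : ∀ m M h a b k → let n = suc m + M in
  suc m ≤ M → n ≡ h + h → a * a ≤ 2 * suc m * (b * b) → .{{NonZero b}} →
  a * words M (suc m) (δ k) * (suc m ! * M !) ≤ 36 * b * (m + M) !
words-point m M h a b k m≤M n≡2h a²≤ = *-cancelˡ-≤ n (begin
  n * (a * W * F)
    ≤⟨ *-monoˡ-≤ (a * W * F) (≤-trans (n≤1+n n) (n≤1+n (suc n))) ⟩
  suc (suc n) * (a * W * F)
    ≤⟨ *-monoʳ-≤ (suc (suc n)) (*-monoˡ-≤ F (*-monoʳ-≤ a W≤)) ⟩
  suc (suc n) * (a * subsets (downFrom n) (suc m) (δ (k + t)) * F)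
    ≡⟨ regroup (suc (suc n)) a _ F ⟩
  suc (suc n) * a * subsets (downFrom n) (suc m) (δ (k + t)) * F
    ≤⟨ *-monoˡ-≤ F (subset-sum-bound m M h a b (k + t) m≤M n≡2h a²≤) ⟩
  36 * b * (n C suc m) * F
    ≡⟨ trans (*-assoc (36 * b) (n C suc m) F) (cong (36 * b *_) (C-factorial (suc m) M)) ⟩
  36 * b * n !
    ≡⟨ x∙yz≈y∙xz′ (36 * b) n ((m + M) !) ⟩
  n * (36 * b * (m + M) !) ∎)
  where
  open ≤-Reasoning
  n = suc m + M
  t = Σ< (suc m) (λ i → i)
  W = words M (suc m) (δ k)
  F = suc m ! * M !
  W≤ : W ≤ subsets (downFrom n) (suc m) (δ (k + t))
  W≤ = begin
    W ≤⟨ words-mono M (suc m) (λ x → δ-≤ {x = x} (cong (_+ t))) ⟩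
    words M (suc m) (λ x → δ (k + t) (x + t)) ≡⟨ sym (subsets-words M (suc m) (δ (k + t))) ⟩
    subsets (downFrom (M + suc m)) (suc m) (δ (k + t)) ≡⟨ cong (λ s → subsets (downFrom s) (suc m) (δ (k + t))) (+-comm M (suc m)) ⟩
    subsets (downFrom n) (suc m) (δ (k + t)) ∎
  regroup : ∀ s a w f → s * (a * w * f) ≡ s * a * w * f
  regroup = solve-∀
  x∙yz≈y∙xz′ : ∀ x y z → x * (y * z) ≡ y * (x * z)
  x∙yz≈y∙xz′ = solve-∀

-- For an even product no number of inversions is central. For an odd product 2k + 1 only k and k +
-- 1 are, and each costs 36; the fraction a / b of `words-point` is (4/3)^i.
words-central : ∀ m M i → suc m ≤ M → 2 ^ i ≤ 2 * suc m →
  4 ^ i * words M (suc m) (central (suc m * M)) * (suc m ! * M !) ≤ 72 * 3 ^ i * (m + M) !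
words-central m M i m≤M 2^i≤ with parity (suc m * M)
... | k , inj₁ eq rewrite eq | ≤-antisym (≤-trans (words-mono M (suc m) (≤-reflexive ∘ central-even≡0 k)) (≤-reflexive (words-0 M (suc m)))) z≤n
    | *-zeroʳ (4 ^ i) = z≤n
... | k , inj₂ eq with odd-product (suc m) M k eq
... | h , n≡2h rewrite eq = begin
  4 ^ i * words M (suc m) (central (suc (k + k))) * F
    ≤⟨ *-monoˡ-≤ F (*-monoʳ-≤ (4 ^ i) (≤-trans (words-mono M (suc m) (central-odd-≤ k)) (≤-reflexive (words-+ M (suc m) (δ k) (δ (suc k)))))) ⟩
  4 ^ i * (words M (suc m) (δ k) + words M (suc m) (δ (suc k))) * F
    ≡⟨ distrib (4 ^ i) (words M (suc m) (δ k)) _ F ⟩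
  4 ^ i * words M (suc m) (δ k) * F + 4 ^ i * words M (suc m) (δ (suc k)) * F
    ≤⟨ +-mono-≤ (bound k) (bound (suc k)) ⟩
  36 * 3 ^ i * (m + M) ! + 36 * 3 ^ i * (m + M) !
    ≡⟨ arith (3 ^ i) ((m + M) !) ⟩
  72 * 3 ^ i * (m + M) ! ∎
  where
  open ≤-Reasoning
  F = suc m ! * M !
  distrib : ∀ a x y f → a * (x + y) * f ≡ a * x * f + a * y * f
  distrib = solve-∀
  arith : ∀ b f → 36 * b * f + 36 * b * f ≡ 72 * b * f
  arith = solve-∀
  -- (16/9)^i ≤ 2^i
  ratio : ∀ i → 4 ^ i * 4 ^ i ≤ 2 ^ i * (3 ^ i * 3 ^ i)
  ratio zero    = ≤-refl
  ratio (suc i) = begin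
    4 * 4 ^ i * (4 * 4 ^ i)                ≡⟨ left (4 ^ i) ⟩
    16 * (4 ^ i * 4 ^ i)                   ≤⟨ *-mono-≤ (m≤m+n 16 2) (ratio i) ⟩
    18 * (2 ^ i * (3 ^ i * 3 ^ i))         ≡⟨ right (2 ^ i) (3 ^ i) ⟩
    2 * 2 ^ i * (3 * 3 ^ i * (3 * 3 ^ i))  ∎
    where
    left : ∀ x → 4 * x * (4 * x) ≡ 16 * (x * x)
    left = solve-∀
    right : ∀ x y → 18 * (x * (y * y)) ≡ 2 * x * (3 * y * (3 * y))
    right = solve-∀
  bound : ∀ k → 4 ^ i * words M (suc m) (δ k) * F ≤ 36 * 3 ^ i * (m + M) !
  bound k = words-point m M h (4 ^ i) (3 ^ i) k m≤M n≡2h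
    (≤-trans (ratio i) (*-monoˡ-≤ (3 ^ i * 3 ^ i) 2^i≤)) {{m^n≢0 3 i}}

-- Shuffles

private variable
  A B : Set
  n : ℕ

total : (A → ℕ) → List A → ℕ
total f []       = 0
total f (x ∷ xs) = f x + total f xs

total-++ : ∀ (f : A → ℕ) xs ys → total f (xs ++ ys) ≡ total f xs + total f ys
total-++ f []       ys = refl
total-++ f (x ∷ xs) ys = trans (cong (f x +_) (total-++ f xs ys)) (sym (+-assoc (f x) _ _))

total-map : ∀ (f : B → ℕ) (g : A → B) xs → total f (map g xs) ≡ total (f ∘ g) xs
total-map f g []       = refl
total-map f g (x ∷ xs) = cong (f (g x) +_) (total-map f g xs)

total-concatMap : ∀ (f : B → ℕ) (g : A → List B) xs → total f (concatMap g xs) ≡ total (total f ∘ g) xs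
total-concatMap f g []       = refl
total-concatMap f g (x ∷ xs) = trans (total-++ f (g x) (concatMap g xs)) (cong (total f (g x) +_) (total-concatMap f g xs))

total-mono : ∀ {f g : A → ℕ} xs → (∀ {x} → x ∈ xs → f x ≤ g x) → total f xs ≤ total g xs
total-mono []       le = z≤n
total-mono (x ∷ xs) le = +-mono-≤ (le (here refl)) (total-mono xs (le ∘ there))

total-cong : ∀ {f g : A → ℕ} xs → (∀ {x} → x ∈ xs → f x ≡ g x) → total f xs ≡ total g xs
total-cong xs e = ≤-antisym (total-mono xs (≤-reflexive ∘ e)) (total-mono xs (≤-reflexive ∘ sym ∘ e))

total-+ : ∀ (f g : A → ℕ) xs → total (λ x → f x + g x) xs ≡ total f xs + total g xs
total-+ f g []       = refl
total-+ f g (x ∷ xs) = trans (cong (f x + g x +_) (total-+ f g xs)) (interchange (f x) (g x) _ _)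
  where
  interchange : ∀ w x y z → w + x + (y + z) ≡ w + y + (x + z)
  interchange = solve-∀

total-*ʳ : ∀ (f : A → ℕ) c xs → total (λ x → f x * c) xs ≡ total f xs * c
total-*ʳ f c []       = refl
total-*ʳ f c (x ∷ xs) = trans (cong (f x * c +_) (total-*ʳ f c xs)) (sym (*-distribʳ-+ c (f x) _))

total-const : ∀ c (xs : List A) → total (const c) xs ≡ length xs * c
total-const c []       = refl
total-const c (x ∷ xs) = cong (c +_) (total-const c xs)

shuffles : List A → List A → List (List A)
shuffles []      v       = [ v ]
shuffles (x ∷ u) []      = [ x ∷ u ]
shuffles (x ∷ u) (y ∷ v) = map (x ∷_) (shuffles u (y ∷ v)) ++ map (y ∷_) (shuffles (x ∷ u) v)

data Shuffle {A : Set} : List A → List A → List A → Set where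
  []    : Shuffle [] [] []
  left  : ∀ {x u v p} → Shuffle u v p → Shuffle (x ∷ u) v (x ∷ p)
  right : ∀ {y u v p} → Shuffle u v p → Shuffle u (y ∷ v) (y ∷ p)

∈-shuffles⁻ : ∀ (u v : List A) {p} → p ∈ shuffles u v → Shuffle u v p
∈-shuffles⁻ [] v (here refl) = rights v
  where
  rights : ∀ (v : List A) → Shuffle [] v v
  rights []      = []
  rights (y ∷ v) = right (rights v)
∈-shuffles⁻ (x ∷ u) [] (here refl) = lefts (x ∷ u)
  where
  lefts : ∀ (u : List A) → Shuffle u [] u
  lefts []      = []
  lefts (x ∷ u) = left (lefts u)
∈-shuffles⁻ (x ∷ u) (y ∷ v) p∈ with ∈-++⁻ (map (x ∷_) (shuffles u (y ∷ v))) p∈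
... | inj₁ p∈ˡ with _ , q∈ , refl ← ∈-map⁻ (x ∷_) p∈ˡ = left (∈-shuffles⁻ u (y ∷ v) q∈)
... | inj₂ p∈ʳ with _ , q∈ , refl ← ∈-map⁻ (y ∷_) p∈ʳ = right (∈-shuffles⁻ (x ∷ u) v q∈)

#words : ℕ → ℕ → ℕ
#words l r = words l r (const 1)

#words-factorial : ∀ l r → #words l r * (l ! * r !) ≡ (l + r) !
#words-factorial l r = trans (cong (_* (l ! * r !)) (binomial l r)) (C-factorial l r)
  where
  binomial : ∀ l r → #words l r ≡ (l + r) C l
  binomial zero    r       = refl
  binomial (suc l) zero    = sym (trans (cong (_C suc l) (+-identityʳ (suc l))) (nCn≡1 (suc l)))
  binomial (suc l) (suc r) = trans (cong₂ _+_ (binomial l (suc r)) (binomial (suc l) r))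
    (trans (+-comm ((l + suc r) C l) _)
      (trans (cong (λ s → s C suc l + (l + suc r) C l) (sym (+-suc l r))) (sym (pascal (l + suc r) l))))

length-shuffles : ∀ (u v : List A) → length (shuffles u v) ≡ #words (length u) (length v)
length-shuffles []      v       = refl
length-shuffles (x ∷ u) []      = refl
length-shuffles (x ∷ u) (y ∷ v) = trans (length-++ (map (x ∷_) (shuffles u (y ∷ v))))
  (cong₂ _+_ (trans (length-map (x ∷_) (shuffles u (y ∷ v))) (length-shuffles u (y ∷ v)))
             (trans (length-map (y ∷_) (shuffles (x ∷ u) v)) (length-shuffles (x ∷ u) v)))

link : (A → A → ℕ) → A → List A → ℕ
link Q x []      = 0
link Q x (y ∷ p) = Q x y

adjacent : (A → A → ℕ) → List A → ℕ
adjacent Q []      = 0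
adjacent Q (x ∷ p) = link Q x p + adjacent Q p

adjacent-cong : ∀ {Q Q′ : A → A → ℕ} p → (∀ {x y} → x ∈ p → y ∈ p → Q x y ≡ Q′ x y) → adjacent Q p ≡ adjacent Q′ p
adjacent-cong []          e = refl
adjacent-cong (x ∷ [])    e = refl
adjacent-cong (x ∷ y ∷ p) e = cong₂ _+_ (e (here refl) (there (here refl)))
  (adjacent-cong (y ∷ p) (λ x∈ y∈ → e (there x∈) (there y∈)))

adjacent-+* : ∀ (Q R : A → A → ℕ) c p → adjacent (λ x y → Q x y + c * R x y) p ≡ adjacent Q p + c * adjacent R p
adjacent-+* Q R c []          = sym (*-zeroʳ c)
adjacent-+* Q R c (x ∷ [])    = sym (*-zeroʳ c)
adjacent-+* Q R c (x ∷ y ∷ p) = trans (cong (Q x y + c * R x y +_) (adjacent-+* Q R c (y ∷ p)))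
  (regroup (Q x y) c (R x y) (adjacent Q (y ∷ p)) (adjacent R (y ∷ p)))
  where
  regroup : ∀ q c r a b → q + c * r + (a + c * b) ≡ q + a + c * (r + b)
  regroup = solve-∀

-- A consecutive pair of u stays consecutive in #words (|u| - 1) |v| of the shuffles.
adjacent-shuffles : ∀ (Q : A → A → ℕ) u v → (∀ {x y} → x ∈ u → y ∈ v → Q x y ≡ 0 × Q y x ≡ 0) →
  total (adjacent Q) (shuffles u v) ≡
  adjacent Q u * #words (pred (length u)) (length v) + adjacent Q v * #words (length u) (pred (length v))
adjacent-shuffles Q [] v z = trans (+-identityʳ (adjacent Q v)) (sym (*-identityʳ (adjacent Q v)))
adjacent-shuffles Q (x ∷ u) [] z = cong (_+ 0) (sym (trans (cong (adjacent Q (x ∷ u) *_) (#words-0 (length u))) (*-identityʳ _)))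
  where
  #words-0 : ∀ l → #words l 0 ≡ 1
  #words-0 zero    = refl
  #words-0 (suc l) = refl
adjacent-shuffles Q (x ∷ u) (y ∷ v) z = begin
  total (adjacent Q) (map (x ∷_) (shuffles u (y ∷ v)) ++ map (y ∷_) (shuffles (x ∷ u) v))
    ≡⟨ total-++ (adjacent Q) (map (x ∷_) (shuffles u (y ∷ v))) _ ⟩
  total (adjacent Q) (map (x ∷_) (shuffles u (y ∷ v))) + total (adjacent Q) (map (y ∷_) (shuffles (x ∷ u) v))
    ≡⟨ cong₂ _+_ (prepend x u (y ∷ v) (linkˡ u (λ x′∈ y′∈ → z (there x′∈) y′∈) (proj₁ (z (here refl) (here refl))))
                               (adjacent-shuffles Q u (y ∷ v) (λ x′∈ → z (there x′∈))))
                 (prepend y (x ∷ u) v (linkʳ v (proj₂ (z (here refl) (here refl))))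
                               (adjacent-shuffles Q (x ∷ u) v (λ x′∈ y′∈ → z x′∈ (there y′∈)))) ⟩
  (link Q x u * #words (pred l) (suc r) + (adjacent Q u * #words (pred l) (suc r) + adjacent Q (y ∷ v) * #words l r)) +
  (link Q y v * #words (suc l) (pred r) + (adjacent Q (x ∷ u) * #words l r + adjacent Q v * #words (suc l) (pred r)))
    ≡⟨ regroup (link Q x u) (adjacent Q u) (link Q y v) (adjacent Q v) (#words (pred l) (suc r)) (#words l r) (#words (suc l) (pred r)) ⟩
  adjacent Q (x ∷ u) * (#words (pred l) (suc r) + #words l r) + adjacent Q (y ∷ v) * (#words l r + #words (suc l) (pred r))
    ≡⟨ cong₂ _+_ (pascalˡ u) (pascalʳ v) ⟩
  adjacent Q (x ∷ u) * #words l (suc r) + adjacent Q (y ∷ v) * #words (suc l) r ∎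
  where
  open ≡-Reasoning
  l = length u
  r = length v
  regroup : ∀ a b c d p q s → (a * p + (b * p + (c + d) * q)) + (c * s + ((a + b) * q + d * s)) ≡
                              (a + b) * (p + q) + (c + d) * (q + s)
  regroup = solve-∀
  prepend : ∀ w u′ v′ {k k′} → total (link Q w) (shuffles u′ v′) ≡ k → total (adjacent Q) (shuffles u′ v′) ≡ k′ →
            total (adjacent Q) (map (w ∷_) (shuffles u′ v′)) ≡ k + k′
  prepend w u′ v′ e e′ = trans (total-map (adjacent Q) (w ∷_) (shuffles u′ v′))
    (trans (total-+ (link Q w) (adjacent Q) (shuffles u′ v′)) (cong₂ _+_ e e′))
  head-total : ∀ w x′ (ps : List (List _)) → total (link Q w) (map (x′ ∷_) ps) ≡ length ps * Q w x′
  head-total w x′ ps = trans (total-map (link Q w) (x′ ∷_) ps) (total-const (Q w x′) ps)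
  linkˡ : ∀ u → (∀ {x′ y′} → x′ ∈ u → y′ ∈ y ∷ v → Q x′ y′ ≡ 0 × Q y′ x′ ≡ 0) → Q x y ≡ 0 →
          total (link Q x) (shuffles u (y ∷ v)) ≡ link Q x u * #words (pred (length u)) (suc r)
  linkˡ []       z′ e rewrite e = refl
  linkˡ (x′ ∷ u) z′ e
    rewrite total-++ (link Q x) (map (x′ ∷_) (shuffles u (y ∷ v))) (map (y ∷_) (shuffles (x′ ∷ u) v))
          | head-total x x′ (shuffles u (y ∷ v)) | head-total x y (shuffles (x′ ∷ u) v) | e
          | *-zeroʳ (length (shuffles (x′ ∷ u) v)) | length-shuffles u (y ∷ v) =
    trans (+-identityʳ _) (*-comm (#words (length u) (suc r)) (Q x x′))
  linkʳ : ∀ v → Q y x ≡ 0 → total (link Q y) (shuffles (x ∷ u) v) ≡ link Q y v * #words (suc l) (pred (length v))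
  linkʳ []       e rewrite e = refl
  linkʳ (y′ ∷ v) e
    rewrite total-++ (link Q y) (map (x ∷_) (shuffles u (y′ ∷ v))) (map (y′ ∷_) (shuffles (x ∷ u) v))
          | head-total y x (shuffles u (y′ ∷ v)) | head-total y y′ (shuffles (x ∷ u) v) | e
          | *-zeroʳ (length (shuffles u (y′ ∷ v))) | length-shuffles (x ∷ u) v =
    *-comm (#words (suc l) (length v)) (Q y y′)
  -- For empty `u` the value of `pred` is meaningless, but the factor in front is 0.
  pascalˡ : ∀ u → adjacent Q (x ∷ u) * (#words (pred (length u)) (suc r) + #words (length u) r) ≡
                  adjacent Q (x ∷ u) * #words (length u) (suc r)
  pascalˡ []      = refl
  pascalˡ (_ ∷ _) = refl
  pascalʳ : ∀ v → adjacent Q (y ∷ v) * (#words l (length v) + #words (suc l) (pred (length v))) ≡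
                  adjacent Q (y ∷ v) * #words (suc l) (length v)
  pascalʳ []      = refl
  pascalʳ (_ ∷ _) = refl

⟦_⟧ : Bool → ℕ
⟦ b ⟧ = if b then 1 else 0

count : (A → Bool) → List A → ℕ
count b = total (λ x → ⟦ b x ⟧)

-- Number of pairs in which an element outside b precedes an element of b.
inversions : (A → Bool) → List A → ℕ
inversions b []      = 0
inversions b (x ∷ p) = if b x then inversions b p else count b p + inversions b p

crossing : (A → Bool) → A → A → ℕ
crossing b x y = ⟦ b x xor b y ⟧

-- The sides are given by a Boolean function, so that they can be read off from any shuffle and
-- exchanged by negation.
record Separates {A : Set} (b : A → Bool) (u v : List A) : Set where
  constructor separates
  field
    inside  : ∀ {x} → x ∈ u → b x ≡ true
    outside : ∀ {x} → x ∈ v → b x ≡ false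

open Separates

tailˡ : ∀ {b : A → Bool} {x u v} → Separates b (x ∷ u) v → Separates b u v
tailˡ sep = separates (inside sep ∘ there) (outside sep)

tailʳ : ∀ {b : A → Bool} {y u v} → Separates b u (y ∷ v) → Separates b u v
tailʳ sep = separates (inside sep) (outside sep ∘ there)

swap-sides : ∀ {b : A → Bool} {u v} → Separates b u v → Separates (not ∘ b) v u
swap-sides sep = separates (cong not ∘ outside sep) (cong not ∘ inside sep)

shuffle-swap : ∀ {u v p : List A} → Shuffle u v p → Shuffle v u p
shuffle-swap []        = []
shuffle-swap (left s)  = right (shuffle-swap s)
shuffle-swap (right s) = left (shuffle-swap s)

count-shuffle : ∀ {b : A → Bool} {u v p} → Separates b u v → Shuffle u v p → count b p ≡ length u
count-shuffle sep [] = refl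
count-shuffle {b = b} sep (left {x} s) rewrite inside sep (here refl) = cong suc (count-shuffle (tailˡ sep) s)
count-shuffle {b = b} sep (right {y} s) rewrite outside sep (here refl) = count-shuffle (tailʳ sep) s

-- Restriction undoes shuffling. Hence a ranking determines its parts, and the badness of pairs on
-- one side does not see the shuffle.
filter-shuffle : ∀ {b : A → Bool} {u v p} → Separates b u v → Shuffle u v p → filterᵇ b p ≡ u
filter-shuffle sep [] = refl
filter-shuffle {b = b} sep (left {x} s) rewrite inside sep (here refl) = cong (x ∷_) (filter-shuffle (tailˡ sep) s)
filter-shuffle {b = b} sep (right {y} s) rewrite outside sep (here refl) = filter-shuffle (tailʳ sep) s

shuffle-↭ : ∀ {u v p : List A} → Shuffle u v p → p ↭ u ++ v
shuffle-↭ []                          = ↭.refl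
shuffle-↭ (left s)                    = ↭.prep _ (shuffle-↭ s)
shuffle-↭ {u = u} (right {v = v} s)   = ↭.↭-trans (↭.prep _ (shuffle-↭ s)) (↭.↭-sym (shift _ u v))

count-outside : ∀ {b : A → Bool} v → (∀ {x} → x ∈ v → b x ≡ false) → count b v ≡ 0
count-outside []      out = refl
count-outside (y ∷ v) out rewrite out (here refl) = count-outside v (out ∘ there)

inversions-outside : ∀ {b : A → Bool} v → (∀ {x} → x ∈ v → b x ≡ false) → inversions b v ≡ 0
inversions-outside []      out = refl
inversions-outside (y ∷ v) out rewrite out (here refl) =
  cong₂ _+_ (count-outside v (out ∘ there)) (inversions-outside v (out ∘ there))

inversions-inside : ∀ {b : A → Bool} u → (∀ {x} → x ∈ u → b x ≡ true) → inversions b u ≡ 0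
inversions-inside []      ins = refl
inversions-inside (x ∷ u) ins rewrite ins (here refl) = inversions-inside u (ins ∘ there)

-- With the elements of `u` as letters L and those of `v` as letters R, both sides follow one
-- recursion: a first element from `v` precedes all of `u`.
total-inversions : ∀ (b : A → Bool) u v f → Separates b u v →
  total (f ∘ inversions b) (shuffles u v) ≡ words (length u) (length v) f
total-inversions b [] v f sep rewrite inversions-outside v (outside sep) = +-identityʳ (f 0)
total-inversions b (x ∷ u) [] f sep rewrite inversions-inside (x ∷ u) (inside sep) = +-identityʳ (f 0)
total-inversions b (x ∷ u) (y ∷ v) f sep = begin
  total (f ∘ inversions b) (map (x ∷_) (shuffles u (y ∷ v)) ++ map (y ∷_) (shuffles (x ∷ u) v))
    ≡⟨ total-++ _ (map (x ∷_) (shuffles u (y ∷ v))) _ ⟩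
  total (f ∘ inversions b) (map (x ∷_) (shuffles u (y ∷ v))) + total (f ∘ inversions b) (map (y ∷_) (shuffles (x ∷ u) v))
    ≡⟨ cong₂ _+_ (total-map _ (x ∷_) (shuffles u (y ∷ v))) (total-map _ (y ∷_) (shuffles (x ∷ u) v)) ⟩
  total (λ p → f (inversions b (x ∷ p))) (shuffles u (y ∷ v)) + total (λ p → f (inversions b (y ∷ p))) (shuffles (x ∷ u) v)
    ≡⟨ cong₂ _+_ (total-cong (shuffles u (y ∷ v)) (λ {p} _ → cong f (first p)))
                 (total-cong (shuffles (x ∷ u) v) (λ {p} p∈ → cong f (second p p∈))) ⟩
  total (f ∘ inversions b) (shuffles u (y ∷ v)) + total (f ∘ (suc (length u) +_) ∘ inversions b) (shuffles (x ∷ u) v)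
    ≡⟨ cong₂ _+_ (total-inversions b u (y ∷ v) f (tailˡ sep)) (total-inversions b (x ∷ u) v _ (tailʳ sep)) ⟩
  words (suc (length u)) (suc (length v)) f ∎
  where
  open ≡-Reasoning
  first : ∀ p → inversions b (x ∷ p) ≡ inversions b p
  first p rewrite inside sep (here refl) = refl
  second : ∀ p → p ∈ shuffles (x ∷ u) v → inversions b (y ∷ p) ≡ suc (length u) + inversions b p
  second p p∈ rewrite outside sep (here refl) =
    cong (_+ inversions b p) (count-shuffle (tailʳ sep) (∈-shuffles⁻ (x ∷ u) v p∈))

-- Every change of side involves an element of `b`, and an element has at most two neighbours.
crossings≤ : ∀ (b : A → Bool) p → adjacent (crossing b) p ≤ 2 * count b p
crossings≤ b []      = z≤n
crossings≤ b (x ∷ p) = ≤-trans (m≤m+n _ ⟦ b x ⟧) (strong x p)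
  where
  open ≤-Reasoning
  xor≤ : ∀ c d → ⟦ c xor d ⟧ + ⟦ c ⟧ ≤ 2 * ⟦ c ⟧ + ⟦ d ⟧
  xor≤ false false = z≤n
  xor≤ false true  = ≤-refl
  xor≤ true  false = ≤-refl
  xor≤ true  true  = s≤s z≤n
  -- The first element has only one neighbour; the summand `⟦ b x ⟧` records this and carries the
  -- induction.
  strong : ∀ x p → adjacent (crossing b) (x ∷ p) + ⟦ b x ⟧ ≤ 2 * count b (x ∷ p)
  strong x [] rewrite +-identityʳ ⟦ b x ⟧ = m≤m+n _ _
  strong x (y ∷ p) = begin
    crossing b x y + a + ⟦ b x ⟧                ≡⟨ flip (crossing b x y) a ⟦ b x ⟧ ⟩
    (crossing b x y + ⟦ b x ⟧) + a              ≤⟨ +-monoˡ-≤ a (xor≤ (b x) (b y)) ⟩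
    2 * ⟦ b x ⟧ + ⟦ b y ⟧ + a                  ≡⟨ flip′ (2 * ⟦ b x ⟧) ⟦ b y ⟧ a ⟩
    2 * ⟦ b x ⟧ + (a + ⟦ b y ⟧)                ≤⟨ +-monoʳ-≤ (2 * ⟦ b x ⟧) (strong y p) ⟩
    2 * ⟦ b x ⟧ + 2 * count b (y ∷ p)           ≡⟨ sym (*-distribˡ-+ 2 ⟦ b x ⟧ _) ⟩
    2 * (⟦ b x ⟧ + count b (y ∷ p))             ∎
    where
    a = adjacent (crossing b) (y ∷ p)
    flip : ∀ a b c → a + b + c ≡ a + c + b
    flip = solve-∀
    flip′ : ∀ a b c → a + b + c ≡ a + (c + b)
    flip′ = solve-∀

crossings-shuffle : ∀ {b : A → Bool} {u v p} → Separates b u v → Shuffle u v p →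
  adjacent (crossing b) p ≤ 2 * (length u ⊓ length v)
crossings-shuffle {b = b} {u} {v} {p} sep s with ⊓-sel (length u) (length v)
... | inj₁ eq rewrite eq | sym (count-shuffle sep s) = crossings≤ b p
... | inj₂ eq rewrite eq | sym (count-shuffle (swap-sides sep) (shuffle-swap s)) =
  ≤-trans (≤-reflexive (adjacent-cong p (λ {x} {y} _ _ → cong ⟦_⟧ (not-xor (b x) (b y))))) (crossings≤ (not ∘ b) p)
  where
  not-xor : ∀ c d → c xor d ≡ not c xor not d
  not-xor false false = refl
  not-xor false true  = refl
  not-xor true  false = refl
  not-xor true  true  = refl

-- Badness and the rankings of a tree

size : BTree A → ℕ
size t = length (leaves t)

isLeafOf : BTree (Fin n) → Fin n → Bool
isLeafOf t x = does (x ∈? leaves t)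
  where open DecMembership _≟ᶠ_ using (_∈?_)

-- badness T p x y bounds, for x and y of consecutive ranks in the ranking p of the leaves,
-- the failure of MInv to change when their ranks are exchanged: only the cross-inversions at the
-- lowest common ancestor of x and y change, by one, so MInv fails to change only if they are
-- as close to half of all the pairs as possible.
badness : BTree (Fin n) → List (Fin n) → Fin n → Fin n → ℕ
badness (leaf a)  p x y = 0
badness (un t)    p x y = badness t p x y
badness (bin s t) p x y =
  if b x then (if b y then badness s (filterᵇ b p) x y else c)
         else (if b y then c else badness t (filterᵇ (not ∘ b) p) x y)
  where
  b = isLeafOf s
  c = central (size s * size t) (inversions b p)

-- For distinct leaves every ranking arises exactly once, from its restrictions to the two sides and
-- a shuffle. This product structure is the independence of the shuffles at different nodes.
rankings : BTree A → List (List A)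
rankings (leaf a)  = [ [ a ] ]
rankings (un t)    = rankings t
rankings (bin s t) = concatMap (λ u → concatMap (shuffles u) (rankings t)) (rankings s)

∈-rankings-bin : ∀ (s t : BTree A) {p} → p ∈ rankings (bin s t) →
  ∃[ u ] ∃[ v ] u ∈ rankings s × v ∈ rankings t × p ∈ shuffles u v
∈-rankings-bin s t p∈ with find (∈-concatMap⁻ _ {xs = rankings s} p∈)
... | u , u∈ , p∈u with find (∈-concatMap⁻ (shuffles u) {xs = rankings t} p∈u)
... | v , v∈ , p∈uv = u , v , u∈ , v∈ , p∈uv

rankings-↭ : ∀ (t : BTree A) {p} → p ∈ rankings t → p ↭ leaves t
rankings-↭ (leaf a) (here refl) = ↭.refl
rankings-↭ (un t) p∈ = rankings-↭ t p∈
rankings-↭ (bin s t) p∈ with u , v , u∈ , v∈ , p∈uv ← ∈-rankings-bin s t p∈ =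
  ↭.↭-trans (shuffle-↭ (∈-shuffles⁻ u v p∈uv)) (↭-++⁺ (rankings-↭ s u∈) (rankings-↭ t v∈))

Unique-++⁻ : ∀ (xs : List A) {ys} → Unique (xs ++ ys) → Unique xs × Unique ys × (∀ {x} → x ∈ xs → x ∉ ys)
Unique-++⁻ []       ys! = [] , ys! , λ ()
Unique-++⁻ (x ∷ xs) (x∉ ∷ xs!) with Unique-++⁻ xs xs!
... | xs!′ , ys! , dis = All.++⁻ˡ xs x∉ ∷ xs!′ , ys! ,
  λ { (here refl) x∈ → All.lookup (All.++⁻ʳ xs x∉) x∈ refl ; (there x∈) → dis x∈ }

leaves-separated : ∀ (s t : BTree (Fin n)) → Unique (leaves (bin s t)) → Separates (isLeafOf s) (leaves s) (leaves t)
leaves-separated s t uniq = separates in-s in-t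
  where
  open DecMembership _≟ᶠ_ using (_∈?_)
  in-s : ∀ {x} → x ∈ leaves s → isLeafOf s x ≡ true
  in-s {x} x∈ with x ∈? leaves s
  ... | yes _ = refl
  ... | no x∉ = ⊥-elim (x∉ x∈)
  in-t : ∀ {x} → x ∈ leaves t → isLeafOf s x ≡ false
  in-t {x} x∈ with x ∈? leaves s
  ... | yes x∈s = ⊥-elim (proj₂ (proj₂ (Unique-++⁻ (leaves s) uniq)) x∈s x∈)
  ... | no _ = refl

rankings-separated : ∀ (s t : BTree (Fin n)) → Unique (leaves (bin s t)) →
  ∀ {u v} → u ∈ rankings s → v ∈ rankings t → Separates (isLeafOf s) u v
rankings-separated s t uniq u∈ v∈ with separates i o ← leaves-separated s t uniq =
  separates (i ∘ ∈-resp-↭ (rankings-↭ s u∈)) (o ∘ ∈-resp-↭ (rankings-↭ t v∈))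

length-ranking : ∀ (t : BTree A) {p} → p ∈ rankings t → length p ≡ size t
length-ranking t p∈ = ↭-length (rankings-↭ t p∈)

length≡total : ∀ (xs : List A) → length xs ≡ total (const 1) xs
length≡total xs = sym (trans (total-const 1 xs) (*-identityʳ _))

length-rankings : ∀ (t : BTree A) → length (rankings t) ≡ size t !
length-rankings (leaf a) = refl
length-rankings (un t) = length-rankings t
length-rankings (bin s t) = begin
  length (rankings (bin s t))
    ≡⟨ length≡total (rankings (bin s t)) ⟩
  total (const 1) (rankings (bin s t))
    ≡⟨ total-concatMap (const 1) _ (rankings s) ⟩
  total (λ u → total (const 1) (concatMap (shuffles u) (rankings t))) (rankings s)
    ≡⟨ total-cong (rankings s) (λ {u} u∈ → trans (total-concatMap (const 1) (shuffles u) (rankings t))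
         (total-cong (rankings t) (λ {v} v∈ → trans (sym (length≡total (shuffles u v)))
           (trans (length-shuffles u v) (cong₂ #words (length-ranking s u∈) (length-ranking t v∈)))))) ⟩
  total (λ u → total (const w) (rankings t)) (rankings s)
    ≡⟨ trans (total-const _ (rankings s)) (cong (length (rankings s) *_) (total-const w (rankings t))) ⟩
  length (rankings s) * (length (rankings t) * w)
    ≡⟨ cong₂ (λ x y → x * (y * w)) (length-rankings s) (length-rankings t) ⟩
  size s ! * (size t ! * w)
    ≡⟨ arith (size s !) (size t !) w ⟩
  w * (size s ! * size t !)
    ≡⟨ #words-factorial (size s) (size t) ⟩
  (size s + size t) !
    ≡⟨ cong _! (sym (length-++ (leaves s))) ⟩
  size (bin s t) ! ∎
  where
  open ≡-Reasoning
  w = #words (size s) (size t)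
  arith : ∀ x y w → x * (y * w) ≡ w * (x * y)
  arith = solve-∀

Unique-concatMap : ∀ (g : A → List B) {xs} → Unique xs → (∀ {x} → x ∈ xs → Unique (g x)) →
  (∀ {x y z} → x ∈ xs → y ∈ xs → z ∈ g x → z ∈ g y → x ≡ y) → Unique (concatMap g xs)
Unique-concatMap g {[]} [] g! inj = []
Unique-concatMap g {x ∷ xs} (x∉ ∷ xs!) g! inj = Unique.++⁺ (g! (here refl))
  (Unique-concatMap g xs! (g! ∘ there) (λ x∈ y∈ → inj (there x∈) (there y∈)))
  λ (z∈gx , z∈) → let y , y∈ , z∈gy = find (∈-concatMap⁻ g {xs = xs} z∈) in
    All.lookup x∉ y∈ (inj (here refl) (there y∈) z∈gx z∈gy)

Unique-shuffles : ∀ (b : A → Bool) u v → Separates b u v → Unique (shuffles u v)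
Unique-shuffles b []      v       sep = [] ∷ []
Unique-shuffles b (x ∷ u) []      sep = [] ∷ []
Unique-shuffles {A = A} b (x ∷ u) (y ∷ v) sep = Unique.++⁺
  (Unique.map⁺ (λ { refl → refl }) (Unique-shuffles b u (y ∷ v) (tailˡ sep)))
  (Unique.map⁺ (λ { refl → refl }) (Unique-shuffles b (x ∷ u) v (tailʳ sep)))
  λ (z∈ˡ , z∈ʳ) → let _ , _ , eqˡ = ∈-map⁻ (x ∷_) z∈ˡ ; _ , _ , eqʳ = ∈-map⁻ (y ∷_) z∈ʳ in
    clash (trans (sym eqˡ) eqʳ)
  where
  clash : ∀ {p q : List A} → x List.∷ p ≢ y ∷ q
  clash refl with () ← trans (sym (inside sep (here refl))) (outside sep (here refl))

Unique-rankings : ∀ (t : BTree (Fin n)) → Unique (leaves t) → Unique (rankings t)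
Unique-rankings (leaf a) uniq = [] ∷ []
Unique-rankings (un t) uniq = Unique-rankings t uniq
Unique-rankings (bin s t) uniq with Unique-++⁻ (leaves s) uniq
... | s! , t! , _ = Unique-concatMap _ (Unique-rankings s s!)
  (λ {u} u∈ → Unique-concatMap (shuffles u) (Unique-rankings t t!)
    (λ {v} v∈ → Unique-shuffles (isLeafOf s) u v (sep u∈ v∈))
    (λ {v} {v′} v∈ v′∈ z∈ z∈′ → trans
      (sym (filter-shuffle (swap-sides (sep u∈ v∈)) (shuffle-swap (∈-shuffles⁻ u v z∈))))
      (filter-shuffle (swap-sides (sep u∈ v′∈)) (shuffle-swap (∈-shuffles⁻ u v′ z∈′)))))
  (λ {u} {u′} u∈ u′∈ z∈ z∈′ →
    let v  , v∈  , z∈uv = find (∈-concatMap⁻ (shuffles u) {xs = rankings t} z∈)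
        v′ , v′∈ , z∈uv′ = find (∈-concatMap⁻ (shuffles u′) {xs = rankings t} z∈′)
    in trans (sym (filter-shuffle (sep u∈ v∈) (∈-shuffles⁻ u v z∈uv)))
             (filter-shuffle (sep u′∈ v′∈) (∈-shuffles⁻ u′ v′ z∈uv′)))
  where
  sep : ∀ {u v} → u ∈ rankings s → v ∈ rankings t → Separates (isLeafOf s) u v
  sep = rankings-separated s t uniq

-- The average number of bad pairs

#bad : BTree (Fin n) → List (Fin n) → ℕ
#bad t p = adjacent (badness t p) p

total-bad : BTree (Fin n) → ℕ
total-bad t = total (#bad t) (rankings t)

leaves-∷ : ∀ (t : BTree A) → ∃[ k ] size t ≡ suc k
leaves-∷ (leaf a) = 0 , refl
leaves-∷ (un t) = leaves-∷ t
leaves-∷ (bin s t) with leaves-∷ s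
... | k , eq = k + size t , trans (length-++ (leaves s)) (cong (_+ size t) eq)

-- All pairs across the node have the same badness `c p`, so together they contribute at most `c p`
-- times the number of changes of side. Pairs within a side keep their badness, because filtering
-- gives back `u` and `v`, and are counted by `adjacent-shuffles`.
total-bad-shuffles : ∀ (s t : BTree (Fin n)) u v → Separates (isLeafOf s) u v →
  length u ≡ size s → length v ≡ size t →
  total (#bad (bin s t)) (shuffles u v) ≤
    #bad s u * #words (pred (size s)) (size t) + #bad t v * #words (size s) (pred (size t)) +
    2 * (size s ⊓ size t) * words (size s) (size t) (central (size s * size t))
total-bad-shuffles {n} s t u v sep lu lv = begin
  total (#bad (bin s t)) (shuffles u v)
    ≤⟨ total-mono (shuffles u v) (λ p∈ → pointwise (∈-shuffles⁻ u v p∈)) ⟩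
  total (λ p → adjacent Q p + c p * (2 * (size s ⊓ size t))) (shuffles u v)
    ≡⟨ trans (total-+ (adjacent Q) _ (shuffles u v)) (cong (total (adjacent Q) (shuffles u v) +_) (total-*ʳ c _ (shuffles u v))) ⟩
  total (adjacent Q) (shuffles u v) + total c (shuffles u v) * (2 * (size s ⊓ size t))
    ≡⟨ cong₂ _+_ same-side cross ⟩
  _ ∎
  where
  open ≤-Reasoning
  b = isLeafOf s
  c : List (Fin n) → ℕ
  c p = central (size s * size t) (inversions b p)
  Q : Fin n → Fin n → ℕ
  Q x y = if b x then (if b y then badness s u x y else 0) else (if b y then 0 else badness t v x y)
  pointwise : ∀ {p} → Shuffle u v p → #bad (bin s t) p ≤ adjacent Q p + c p * (2 * (size s ⊓ size t))
  pointwise {p} sh = begin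
    #bad (bin s t) p
      ≡⟨ adjacent-cong p (λ {x} {y} _ _ → split x y) ⟩
    adjacent (λ x y → Q x y + c p * crossing b x y) p
      ≡⟨ adjacent-+* Q (crossing b) (c p) p ⟩
    adjacent Q p + c p * adjacent (crossing b) p
      ≤⟨ +-monoʳ-≤ (adjacent Q p) (*-monoʳ-≤ (c p) (crossings-shuffle sep sh)) ⟩
    adjacent Q p + c p * (2 * (length u ⊓ length v))
      ≡⟨ cong₂ (λ x y → adjacent Q p + c p * (2 * (x ⊓ y))) lu lv ⟩
    adjacent Q p + c p * (2 * (size s ⊓ size t)) ∎
    where
    split : ∀ x y → badness (bin s t) p x y ≡ Q x y + c p * crossing b x y
    split x y rewrite filter-shuffle sep sh | filter-shuffle (swap-sides sep) (shuffle-swap sh) with b x | b y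
    ... | true  | true  = sym (trans (cong (badness s u x y +_) (*-zeroʳ (c p))) (+-identityʳ _))
    ... | true  | false = sym (*-identityʳ (c p))
    ... | false | true  = sym (*-identityʳ (c p))
    ... | false | false = sym (trans (cong (badness t v x y +_) (*-zeroʳ (c p))) (+-identityʳ _))
  same-side : total (adjacent Q) (shuffles u v) ≡
    #bad s u * #words (pred (size s)) (size t) + #bad t v * #words (size s) (pred (size t))
  same-side = trans (adjacent-shuffles Q u v (λ x∈ y∈ → zero₁ x∈ y∈ , zero₂ x∈ y∈))
    (cong₂ _+_ (cong₂ _*_ (adjacent-cong u onˡ) (cong₂ (λ x y → #words (pred x) y) lu lv))
               (cong₂ _*_ (adjacent-cong v onʳ) (cong₂ (λ x y → #words x (pred y)) lu lv)))
    where
    zero₁ : ∀ {x y} → x ∈ u → y ∈ v → Q x y ≡ 0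
    zero₁ x∈ y∈ rewrite inside sep x∈ | outside sep y∈ = refl
    zero₂ : ∀ {x y} → x ∈ u → y ∈ v → Q y x ≡ 0
    zero₂ x∈ y∈ rewrite inside sep x∈ | outside sep y∈ = refl
    onˡ : ∀ {x y} → x ∈ u → y ∈ u → Q x y ≡ badness s u x y
    onˡ x∈ y∈ rewrite inside sep x∈ | inside sep y∈ = refl
    onʳ : ∀ {x y} → x ∈ v → y ∈ v → Q x y ≡ badness t v x y
    onʳ x∈ y∈ rewrite outside sep x∈ | outside sep y∈ = refl
  cross : total c (shuffles u v) * (2 * (size s ⊓ size t)) ≡
    2 * (size s ⊓ size t) * words (size s) (size t) (central (size s * size t))
  cross = trans (*-comm _ (2 * (size s ⊓ size t)))
    (cong (2 * (size s ⊓ size t) *_) (trans (total-inversions b u v (central (size s * size t)) sep)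
      (cong₂ (λ x y → words x y (central (size s * size t))) lu lv)))

total-bad-bin : ∀ (s t : BTree (Fin n)) → Unique (leaves (bin s t)) →
  total-bad (bin s t) ≤
    total-bad s * (size t ! * #words (pred (size s)) (size t)) +
    total-bad t * (size s ! * #words (size s) (pred (size t))) +
    size s ! * size t ! * (2 * (size s ⊓ size t) * words (size s) (size t) (central (size s * size t)))
total-bad-bin s t uniq = begin
  total-bad (bin s t)
    ≡⟨ total-concatMap (#bad (bin s t)) _ (rankings s) ⟩
  total (λ u → total (#bad (bin s t)) (concatMap (shuffles u) (rankings t))) (rankings s)
    ≤⟨ total-mono (rankings s) (λ {u} u∈ → ≤-trans (≤-reflexive (total-concatMap (#bad (bin s t)) (shuffles u) (rankings t)))
         (total-mono (rankings t) (λ {v} v∈ → total-bad-shuffles s t u v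
           (rankings-separated s t uniq u∈ v∈) (length-ranking s u∈) (length-ranking t v∈)))) ⟩
  total (λ u → total (λ v → #bad s u * a + #bad t v * b + e) (rankings t)) (rankings s)
    ≡⟨ total-cong (rankings s) (λ {u} _ → inner u) ⟩
  total (λ u → #bad s u * (size t ! * a) + (total-bad t * b + size t ! * e)) (rankings s)
    ≡⟨ trans (total-+ (λ u → #bad s u * (size t ! * a)) _ (rankings s))
         (cong₂ _+_ (total-*ʳ (#bad s) (size t ! * a) (rankings s))
           (trans (total-const _ (rankings s)) (cong (_* (total-bad t * b + size t ! * e)) (length-rankings s)))) ⟩
  total-bad s * (size t ! * a) + size s ! * (total-bad t * b + size t ! * e)
    ≡⟨ regroup (total-bad s * (size t ! * a)) (size s !) (total-bad t) b (size t !) e ⟩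
  total-bad s * (size t ! * a) + total-bad t * (size s ! * b) + size s ! * size t ! * e ∎
  where
  open ≤-Reasoning
  a = #words (pred (size s)) (size t)
  b = #words (size s) (pred (size t))
  e = 2 * (size s ⊓ size t) * words (size s) (size t) (central (size s * size t))
  regroup : ∀ x p t b q e → x + p * (t * b + q * e) ≡ x + t * (p * b) + p * q * e
  regroup = solve-∀
  inner : ∀ u → total (λ v → #bad s u * a + #bad t v * b + e) (rankings t) ≡
                #bad s u * (size t ! * a) + (total-bad t * b + size t ! * e)
  inner u = trans (total-+ (λ v → #bad s u * a + #bad t v * b) (const e) (rankings t))
    (trans (cong₂ _+_ (trans (total-+ (const (#bad s u * a)) (λ v → #bad t v * b) (rankings t))
                        (cong₂ _+_ (total-const _ (rankings t)) (total-*ʳ (#bad t) b (rankings t))))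
                      (total-const e (rankings t)))
      (trans (cong (λ k → k * (#bad s u * a) + total-bad t * b + k * e) (length-rankings t))
        (arith (size t !) (#bad s u) a (total-bad t * b) e)))
    where
    arith : ∀ k x a y e → k * (x * a) + y + k * e ≡ x * (k * a) + (y + k * e)
    arith = solve-∀

-- S ≤ c l! (1 - (3/4)^j): the defect (3/4)^j absorbs the contributions of the ancestors.
Controlled : ℕ → ℕ → Set
Controlled l S = ∀ j → l ≤ 2 ^ j → 4 ^ j * S + 576 * l ! * 3 ^ j ≤ 576 * l ! * 4 ^ j

scale : ∀ m → ∃[ i ] suc m ≤ 2 ^ i × 2 ^ i < 2 * suc m
scale zero = 0 , ≤-refl , ≤-refl
scale (suc m) with scale m
... | i , le , lt with m≤n⇒m<n∨m≡n le
... | inj₁ le′ = i , le′ , ≤-trans lt (*-monoʳ-≤ 2 (n≤1+n (suc m)))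
... | inj₂ eq  = suc i ,
  subst (λ x → suc (suc m) ≤ 2 * x) eq (≤-trans (m≤m+n (suc (suc m)) m) (≤-reflexive (arith m))) ,
  subst (λ x → 2 * x < 2 * suc (suc m)) eq (*-monoʳ-< 2 (n<1+n (suc m)))
  where
  arith : ∀ m → suc (suc m) + m ≡ 2 * suc m
  arith = solve-∀

3^≤4^ : ∀ e → 3 ^ e ≤ 4 ^ e
3^≤4^ e = ^-monoˡ-≤ e (n≤1+n 3)

-- Only the smaller side changes its exponent, from i to some j > i. This frees 576 m K ((3/4)^i -
-- (3/4)^j), which is at least a quarter of 576 m K (3/4)^i and so covers `X`. Here `p`, `q`, `P`,
-- `R` are 4^i, 3^i, 4^e, 3^e with j = i + 1 + e, and 576 is four times the 144 of the cross term.
combine-bounds : ∀ m M K σ τ X p q P R → R ≤ P →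
  p * σ + 576 * (m * K) * q ≤ 576 * (m * K) * p →
  p * (4 * P) * τ + 576 * (M * K) * (q * (3 * R)) ≤ 576 * (M * K) * (p * (4 * P)) →
  p * X ≤ 144 * (m * K) * q →
  p * (4 * P) * (σ + τ + X) + 576 * ((m + M) * K) * (q * (3 * R)) ≤ 576 * ((m + M) * K) * (p * (4 * P))
combine-bounds m M K σ τ X p q P R R≤P hσ hτ hX = begin
  p * (4 * P) * (σ + τ + X) + 576 * ((m + M) * K) * (q * (3 * R))
    ≡⟨ regroup m M K σ τ X p q P R ⟩
  (4 * P * (p * σ) + 4 * P * (p * X) + 1728 * (m * K) * q * R) +
  (p * (4 * P) * τ + 576 * (M * K) * (q * (3 * R)))
    ≤⟨ +-mono-≤ (+-mono-≤ (+-monoʳ-≤ (4 * P * (p * σ)) (*-monoʳ-≤ (4 * P) hX)) (*-monoʳ-≤ (1728 * (m * K) * q) R≤P)) hτ ⟩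
  (4 * P * (p * σ) + 4 * P * (144 * (m * K) * q) + 1728 * (m * K) * q * P) + 576 * (M * K) * (p * (4 * P))
    ≡⟨ cong (_+ 576 * (M * K) * (p * (4 * P))) (collect P (p * σ) (m * K) q) ⟩
  4 * P * (p * σ + 576 * (m * K) * q) + 576 * (M * K) * (p * (4 * P))
    ≤⟨ +-monoˡ-≤ (576 * (M * K) * (p * (4 * P))) (*-monoʳ-≤ (4 * P) hσ) ⟩
  4 * P * (576 * (m * K) * p) + 576 * (M * K) * (p * (4 * P))
    ≡⟨ final m M K P p ⟩
  576 * ((m + M) * K) * (p * (4 * P)) ∎
  where
  open ≤-Reasoning
  regroup : ∀ m M K σ τ X p q P R →
    p * (4 * P) * (σ + τ + X) + 576 * ((m + M) * K) * (q * (3 * R)) ≡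
    (4 * P * (p * σ) + 4 * P * (p * X) + 1728 * (m * K) * q * R) +
    (p * (4 * P) * τ + 576 * (M * K) * (q * (3 * R)))
  regroup = solve-∀
  collect : ∀ P y k q → 4 * P * y + 4 * P * (144 * k * q) + 1728 * k * q * P ≡ 4 * P * (y + 576 * k * q)
  collect = solve-∀
  final : ∀ m M K P p → 4 * P * (576 * (m * K) * p) + 576 * (M * K) * (p * (4 * P)) ≡ 576 * ((m + M) * K) * (p * (4 * P))
  final = solve-∀

-- The inequality must be strict: at least one factor 3/4 has to separate the savings of the smaller
-- side and of the whole tree.
exponent-< : ∀ {m M i j} → m ≤ M → 2 ^ i < 2 * suc m → suc m + suc M ≤ 2 ^ j → i < j
exponent-< {m} {M} {i} {j} m≤M 2^i<2m n≤2^j with ≤-<-connex j i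
... | inj₂ i<j = i<j
... | inj₁ j≤i = ⊥-elim (<-irrefl refl (begin-strict
  2 ^ i         <⟨ 2^i<2m ⟩
  2 * suc m     ≡⟨ cong (suc m +_) (+-identityʳ (suc m)) ⟩
  suc m + suc m ≤⟨ +-monoʳ-≤ (suc m) (s≤s m≤M) ⟩
  suc m + suc M ≤⟨ n≤2^j ⟩
  2 ^ j         ≤⟨ ^-monoʳ-≤ 2 j≤i ⟩
  2 ^ i         ∎))
  where open ≤-Reasoning

-- After scaling by `F` and `G` the two sides get the weights `suc m * K` and `suc M * K`, which add
-- up to the factorial of `N`. So the bounds of the sides are averaged in proportion to their sizes,
-- and only the cross term remains to be paid for.
controlled-step : ∀ m M S₁ S₂ S → m ≤ M → Controlled (suc m) S₁ → Controlled (suc M) S₂ →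
  S ≤ S₁ * (suc M ! * #words m (suc M)) + S₂ * (suc m ! * #words (suc m) M) +
      suc m ! * suc M ! * (2 * suc m * words (suc M) (suc m) (central (suc m * suc M))) →
  Controlled (suc m + suc M) S
controlled-step m M S₁ S₂ S m≤M c₁ c₂ S≤ j n≤2^j with scale m
... | i , m≤2^i , 2^i<2m with m≤n⇒∃[o]m+o≡n (exponent-< {m} {M} {i} {j} m≤M 2^i<2m n≤2^j)
... | e , refl = subst₂ (λ x y → x * S + 576 * (N * K) * y ≤ 576 * (N * K) * x) (sym 4^j) (sym 3^j)
  (≤-trans (+-monoˡ-≤ (576 * (N * K) * (3 ^ i * (3 * 3 ^ e))) (*-monoʳ-≤ (4 ^ i * (4 * 4 ^ e)) S≤))
    (combine-bounds (suc m) (suc M) K (S₁ * F) (S₂ * G) _ (4 ^ i) (3 ^ i) (4 ^ e) (3 ^ e) (3^≤4^ e)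
      (rescale (4 ^ i) (3 ^ i) S₁ (suc m !) F (suc m * K) F≡ (c₁ i m≤2^i))
      (rescale (4 ^ i * (4 * 4 ^ e)) (3 ^ i * (3 * 3 ^ e)) S₂ (suc M !) G (suc M * K) G≡
        (subst₂ (λ x y → x * S₂ + 576 * suc M ! * y ≤ 576 * suc M ! * x) 4^j 3^j
          (c₂ (suc i + e) (≤-trans (m≤n+m (suc M) (suc m)) n≤2^j))))
      cross))
  where
  open ≤-Reasoning
  N = suc m + suc M
  K = (m + suc M) !
  F = suc M ! * #words m (suc M)
  G = suc m ! * #words (suc m) M
  W = words (suc M) (suc m) (central (suc m * suc M))
  power : ∀ a i e → a ^ (suc i + e) ≡ a ^ i * (a * a ^ e)
  power a i e = trans (cong (a ^_) (sym (+-suc i e))) (^-distribˡ-+-* a i (suc e))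
  4^j = power 4 i e
  3^j = power 3 i e
  -- A consecutive pair of the smaller side stays consecutive in the share (m + 1) / N of the
  -- shuffles.
  F≡ : suc m ! * F ≡ suc m * K
  F≡ = trans (arith (suc m) (m !) (suc M !) (#words m (suc M))) (cong (suc m *_) (#words-factorial m (suc M)))
    where
    arith : ∀ s x y w → s * x * (y * w) ≡ s * (w * (x * y))
    arith = solve-∀
  G≡ : suc M ! * G ≡ suc M * K
  G≡ = trans (arith (suc M) (M !) (suc m !) (#words (suc m) M))
    (cong (suc M *_) (trans (#words-factorial (suc m) M) (cong _! (sym (+-suc m M)))))
    where
    arith : ∀ s x y w → s * x * (y * w) ≡ s * (w * (y * x))
    arith = solve-∀
  rescale : ∀ p q S L F N → L * F ≡ N → p * S + 576 * L * q ≤ 576 * L * p → p * (S * F) + 576 * N * q ≤ 576 * N * p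
  rescale p q S L F N refl le = begin
    p * (S * F) + 576 * (L * F) * q ≡⟨ arith p q S L F ⟩
    (p * S + 576 * L * q) * F       ≤⟨ *-monoˡ-≤ F le ⟩
    576 * L * p * F                 ≡⟨ arith′ p L F ⟩
    576 * (L * F) * p               ∎
    where
    arith : ∀ p q S L F → p * (S * F) + 576 * (L * F) * q ≡ (p * S + 576 * L * q) * F
    arith = solve-∀
    arith′ : ∀ p L F → 576 * L * p * F ≡ 576 * (L * F) * p
    arith′ = solve-∀
  cross : 4 ^ i * (suc m ! * suc M ! * (2 * suc m * W)) ≤ 144 * (suc m * K) * 3 ^ i
  cross = begin
    4 ^ i * (suc m ! * suc M ! * (2 * suc m * W)) ≡⟨ arith (4 ^ i) (suc m ! * suc M !) (suc m) W ⟩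
    2 * suc m * (4 ^ i * W * (suc m ! * suc M !)) ≤⟨ *-monoʳ-≤ (2 * suc m) (words-central m (suc M) i (s≤s m≤M) (<⇒≤ 2^i<2m)) ⟩
    2 * suc m * (72 * 3 ^ i * K)                  ≡⟨ arith′ (suc m) (3 ^ i) K ⟩
    144 * (suc m * K) * 3 ^ i                     ∎
    where
    arith : ∀ p f m w → p * (f * (2 * m * w)) ≡ 2 * m * (p * w * f)
    arith = solve-∀
    arith′ : ∀ m q k → 2 * m * (72 * q * k) ≡ 144 * (m * k) * q
    arith′ = solve-∀

total-bad-controlled : ∀ (t : BTree (Fin n)) → Unique (leaves t) → Controlled (size t) (total-bad t)
total-bad-controlled (leaf a) uniq j _ = begin
  4 ^ j * 0 + 576 * 3 ^ j ≡⟨ cong (_+ 576 * 3 ^ j) (*-zeroʳ (4 ^ j)) ⟩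
  576 * 3 ^ j             ≤⟨ *-monoʳ-≤ 576 (3^≤4^ j) ⟩
  576 * 4 ^ j             ∎
  where open ≤-Reasoning
total-bad-controlled (un t) uniq = total-bad-controlled t uniq
total-bad-controlled (bin s t) uniq
  with Unique-++⁻ (leaves s) uniq | leaves-∷ s | leaves-∷ t | total-bad-bin s t uniq
... | s! , t! , _ | l , eqˡ | r , eqʳ | bound =
  subst (λ k → Controlled k (total-bad (bin s t))) (sym (trans (length-++ (leaves s)) (cong₂ _+_ eqˡ eqʳ)))
    (orient (≤-total l r))
  where
  open ≤-Reasoning
  S₁ = total-bad s
  S₂ = total-bad t
  cˡ : Controlled (suc l) S₁
  cˡ = subst (λ k → Controlled k S₁) eqˡ (total-bad-controlled s s!)
  cʳ : Controlled (suc r) S₂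
  cʳ = subst (λ k → Controlled k S₂) eqʳ (total-bad-controlled t t!)
  bound′ : total-bad (bin s t) ≤
    S₁ * (suc r ! * #words l (suc r)) + S₂ * (suc l ! * #words (suc l) r) +
    suc l ! * suc r ! * (2 * (suc l ⊓ suc r) * words (suc l) (suc r) (central (suc l * suc r)))
  bound′ = subst₂ (λ a b → total-bad (bin s t) ≤
    S₁ * (b ! * #words (pred a) b) + S₂ * (a ! * #words a (pred b)) +
    a ! * b ! * (2 * (a ⊓ b) * words a b (central (a * b)))) eqˡ eqʳ bound
  -- `controlled-step` expects the smaller side first; counts of words are symmetric in the two
  -- sides.
  orient : l ≤ r ⊎ r ≤ l → Controlled (suc l + suc r) (total-bad (bin s t))
  orient (inj₁ l≤r) = controlled-step l r S₁ S₂ _ l≤r cˡ cʳ (≤-trans bound′ (≤-reflexive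
    (cong (S₁ * (suc r ! * #words l (suc r)) + S₂ * (suc l ! * #words (suc l) r) +_)
      (cong (suc l ! * suc r ! *_) (cong₂ (λ x y → 2 * x * y) (m≤n⇒m⊓n≡m (s≤s l≤r)) (words-sym (suc l) (suc r) _))))))
  orient (inj₂ r≤l) = subst (λ k → Controlled k (total-bad (bin s t))) (+-comm (suc r) (suc l))
    (controlled-step r l S₂ S₁ _ r≤l cʳ cˡ (≤-trans bound′ (≤-reflexive (cong₂ _+_
      (trans (+-comm (S₁ * (suc r ! * #words l (suc r))) _)
        (cong₂ (λ x y → S₂ * (suc l ! * x) + S₁ * (suc r ! * y)) (words-sym (suc l) r _) (words-sym l (suc r) _)))
      (cong₂ _*_ (*-comm (suc l !) (suc r !)) (cong₂ (λ x y → 2 * x * words (suc l) (suc r) (central y))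
        (m≥n⇒m⊓n≡n (s≤s r≤l)) (*-comm (suc l) (suc r))))))))

total-bad≤ : ∀ (t : BTree (Fin n)) → Unique (leaves t) → total-bad t ≤ 576 * size t !
total-bad≤ t uniq = *-cancelˡ-≤ (4 ^ j) {{m^n≢0 4 j}} (begin
  4 ^ j * total-bad t                          ≤⟨ m≤m+n _ _ ⟩
  4 ^ j * total-bad t + 576 * size t ! * 3 ^ j ≤⟨ total-bad-controlled t uniq j (m≤2^m j) ⟩
  576 * size t ! * 4 ^ j                       ≡⟨ *-comm _ (4 ^ j) ⟩
  4 ^ j * (576 * size t !)                     ∎)
  where
  open ≤-Reasoning
  j = size t
  m≤2^m : ∀ m → m ≤ 2 ^ m
  m≤2^m zero    = z≤n
  m≤2^m (suc m) = ≤-trans (+-mono-≤ (m^n>0 2 m) (m≤2^m m)) (≤-reflexive (cong (2 ^ m +_) (sym (+-identityʳ (2 ^ m)))))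

-- Exchanges of consecutive ranks

total-↭ : ∀ (f : A → ℕ) {xs ys} → xs ↭ ys → total f xs ≡ total f ys
total-↭ f ↭.refl         = refl
total-↭ f (↭.prep x p)   = cong (f x +_) (total-↭ f p)
total-↭ f (↭.swap x y p) = trans (cong (λ k → f x + (f y + k)) (total-↭ f p)) (exchange (f x) (f y) _)
  where
  exchange : ∀ a b c → a + (b + c) ≡ b + (a + c)
  exchange = solve-∀
total-↭ f (↭.trans p q)  = trans (total-↭ f p) (total-↭ f q)

cross : (A → A → ℕ) → List A → List A → ℕ
cross g xs ys = total (λ x → total (g x) ys) xs

cross-↭ : ∀ (g : A → A → ℕ) {xs xs′ ys ys′} → xs ↭ xs′ → ys ↭ ys′ → cross g xs ys ≡ cross g xs′ ys′
cross-↭ g {xs} xs↭ ys↭ = trans (total-cong xs (λ {x} _ → total-↭ (g x) ys↭)) (total-↭ _ xs↭)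

cross-cong : ∀ {g h : A → A → ℕ} xs ys → (∀ {x y} → x ∈ xs → y ∈ ys → g x y ≡ h x y) → cross g xs ys ≡ cross h xs ys
cross-cong xs ys e = total-cong xs (λ x∈ → total-cong ys (e x∈))

cross-flip : ∀ (g : A → A → ℕ) xs ys → cross g xs ys ≡ cross (λ y x → g x y) ys xs
cross-flip g []       ys = sym (trans (total-const 0 ys) (*-zeroʳ (length ys)))
cross-flip g (x ∷ xs) ys = trans (cong (total (g x) ys +_) (cross-flip g xs ys)) (sym (total-+ (g x) _ ys))

cross-+ : ∀ (g h : A → A → ℕ) xs ys → cross (λ x y → g x y + h x y) xs ys ≡ cross g xs ys + cross h xs ys
cross-+ g h xs ys = trans (total-cong xs (λ {x} _ → total-+ (g x) (h x) ys)) (total-+ _ _ xs)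

cross-const : ∀ c (xs ys : List A) → cross (λ _ _ → c) xs ys ≡ length xs * (length ys * c)
cross-const c xs ys = trans (total-cong xs (λ _ → total-const c ys)) (total-const _ xs)

total-bump : ∀ {f g : A → ℕ} {x xs} → Unique xs → x ∈ xs → g x ≡ suc (f x) →
  (∀ {y} → y ∈ xs → y ≢ x → g y ≡ f y) → total g xs ≡ suc (total f xs)
total-bump {xs = _ ∷ xs} (x∉ ∷ xs!) (here refl) gx rest =
  cong₂ _+_ gx (total-cong xs (λ y∈ → rest (there y∈) (λ { refl → All.lookup x∉ y∈ refl })))
total-bump {f = f} {xs = z ∷ xs} (z∉ ∷ xs!) (there x∈) gx rest =
  trans (cong₂ _+_ (rest (here refl) (λ { refl → All.lookup z∉ x∈ refl })) (total-bump xs! x∈ gx (rest ∘ there)))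
        (+-suc (f z) _)

cross-bump : ∀ {g h : A → A → ℕ} {x y xs ys} → Unique xs → Unique ys → x ∈ xs → y ∈ ys → h x y ≡ suc (g x y) →
  (∀ {u v} → u ∈ xs → v ∈ ys → ¬ (u ≡ x × v ≡ y) → h u v ≡ g u v) → cross h xs ys ≡ suc (cross g xs ys)
cross-bump {ys = ys} xs! ys! x∈ y∈ hxy rest = total-bump xs! x∈
  (total-bump ys! y∈ hxy (λ v∈ v≢y → rest x∈ v∈ (v≢y ∘ proj₂)))
  (λ u∈ u≢x → total-cong ys (λ v∈ → rest u∈ v∈ (u≢x ∘ proj₁)))

-- Cross-inversions and the minimum over orderings

rank : Ranking n → Fin n → ℕ
rank ρ x = toℕ (ρ ⟨$⟩ʳ x)

rank-injective : ∀ (ρ : Ranking n) {x y} → rank ρ x ≡ rank ρ y → x ≡ y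
rank-injective ρ eq = trans (sym (inverseˡ ρ)) (trans (cong (ρ ⟨$⟩ˡ_) (toℕ-injective eq)) (inverseˡ ρ))

before : Ranking n → Fin n → Fin n → Bool
before ρ x y = does ((ρ ⟨$⟩ʳ x) <? (ρ ⟨$⟩ʳ y))

before-true : ∀ (ρ : Ranking n) {x y} → rank ρ x < rank ρ y → before ρ x y ≡ true
before-true ρ lt = dec-true (_ <? _) lt

before-false : ∀ (ρ : Ranking n) {x y} → ¬ (rank ρ x < rank ρ y) → before ρ x y ≡ false
before-false ρ ¬lt = dec-false (_ <? _) ¬lt

before-cong : ∀ (ρ σ : Ranking n) {x y x′ y′} → (rank ρ x < rank ρ y → rank σ x′ < rank σ y′) →
  (rank σ x′ < rank σ y′ → rank ρ x < rank ρ y) → before ρ x y ≡ before σ x′ y′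
before-cong ρ σ {x} {y} to from with (ρ ⟨$⟩ʳ x) <? (ρ ⟨$⟩ʳ y)
... | yes lt = trans (before-true ρ lt) (sym (before-true σ (to lt)))
... | no ¬lt = trans (before-false ρ ¬lt) (sym (before-false σ (¬lt ∘ from)))

-- The contribution of a pair to the inversions when `x` stands to the left of `y`.
after : Ranking n → Fin n → Fin n → ℕ
after ρ x y = ⟦ before ρ y x ⟧

XInv : Ranking n → List (Fin n) → List (Fin n) → ℕ
XInv ρ = cross (after ρ)

length-filter-after : ∀ (ρ : Ranking n) x ys →
  length (filter (λ y → (ρ ⟨$⟩ʳ y) <? (ρ ⟨$⟩ʳ x)) ys) ≡ total (after ρ x) ys
length-filter-after ρ x [] = refl
length-filter-after ρ x (y ∷ ys) with does ((ρ ⟨$⟩ʳ y) <? (ρ ⟨$⟩ʳ x))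
... | true  = cong suc (length-filter-after ρ x ys)
... | false = length-filter-after ρ x ys

Inv-++ : ∀ (ρ : Ranking n) xs ys → Inv ρ (xs ++ ys) ≡ Inv ρ xs + Inv ρ ys + XInv ρ xs ys
Inv-++ ρ [] ys = sym (+-identityʳ _)
Inv-++ ρ (x ∷ xs) ys
  rewrite length-filter-after ρ x (xs ++ ys) | length-filter-after ρ x xs
        | total-++ (after ρ x) xs ys | Inv-++ ρ xs ys =
  regroup (total (after ρ x) xs) (total (after ρ x) ys) (Inv ρ xs) (Inv ρ ys) (XInv ρ xs ys)
  where
  regroup : ∀ a b c d e → a + b + (c + d + e) ≡ a + c + d + (b + e)
  regroup = solve-∀

induced-↭ : ∀ {t : BTree A} (o : Ordering t) → induced o ↭ leaves t
induced-↭ (oleaf a) = ↭.refl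
induced-↭ (oun o) = induced-↭ o
induced-↭ (obin false ol or) = ↭-++⁺ (induced-↭ ol) (induced-↭ or)
induced-↭ (obin true  ol or) = ↭.↭-trans (++-comm (induced or) (induced ol)) (↭-++⁺ (induced-↭ ol) (induced-↭ or))

-- Whether two leaves are inverted depends only on the order chosen at their lowest common ancestor,
-- so every node can be optimised separately.
minInv : BTree (Fin n) → Ranking n → ℕ
minInv (leaf a)  ρ = 0
minInv (un t)    ρ = minInv t ρ
minInv (bin s t) ρ = minInv s ρ + minInv t ρ + (XInv ρ (leaves s) (leaves t) ⊓ XInv ρ (leaves t) (leaves s))

minInv-≤ : ∀ {t : BTree (Fin n)} ρ (o : Ordering t) → minInv t ρ ≤ Inv ρ (induced o)
minInv-≤ ρ (oleaf a) = z≤n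
minInv-≤ ρ (oun o) = minInv-≤ ρ o
minInv-≤ ρ (obin {s} {t} false ol or)
  rewrite Inv-++ ρ (induced ol) (induced or) | cross-↭ (after ρ) (induced-↭ ol) (induced-↭ or) =
  +-mono-≤ (+-mono-≤ (minInv-≤ ρ ol) (minInv-≤ ρ or)) (m⊓n≤m _ _)
minInv-≤ ρ (obin {s} {t} true ol or)
  rewrite Inv-++ ρ (induced or) (induced ol) | cross-↭ (after ρ) (induced-↭ or) (induced-↭ ol)
        | +-comm (Inv ρ (induced or)) (Inv ρ (induced ol)) =
  +-mono-≤ (+-mono-≤ (minInv-≤ ρ ol) (minInv-≤ ρ or)) (m⊓n≤n (XInv ρ (leaves s) (leaves t)) _)

minInv-attained : ∀ (t : BTree (Fin n)) ρ → Σ (Ordering t) λ o → Inv ρ (induced o) ≡ minInv t ρ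
minInv-attained (leaf a) ρ = oleaf a , refl
minInv-attained (un t) ρ with minInv-attained t ρ
... | o , eq = oun o , eq
minInv-attained (bin s t) ρ with minInv-attained s ρ | minInv-attained t ρ
... | os , eqs | ot , eqt with ⊓-sel (XInv ρ (leaves s) (leaves t)) (XInv ρ (leaves t) (leaves s))
... | inj₁ eq = obin false os ot , trans (Inv-++ ρ (induced os) (induced ot))
  (cong₂ _+_ (cong₂ _+_ eqs eqt) (trans (cross-↭ (after ρ) (induced-↭ os) (induced-↭ ot)) (sym eq)))
... | inj₂ eq = obin true os ot , trans (Inv-++ ρ (induced ot) (induced os))
  (cong₂ _+_ (trans (+-comm (Inv ρ (induced ot)) _) (cong₂ _+_ eqs eqt))
             (trans (cross-↭ (after ρ) (induced-↭ ot) (induced-↭ os)) (sym eq)))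

IsMInv⇒≡minInv : ∀ {t : BTree (Fin n)} {ρ m} → IsMInv t ρ m → m ≡ minInv t ρ
IsMInv⇒≡minInv {t = t} {ρ} ((o , refl) , least) with minInv-attained t ρ
... | o′ , eq = ≤-antisym (≤-trans (least o′) (≤-reflexive eq)) (minInv-≤ ρ o)

XInv-complement : ∀ (ρ : Ranking n) xs ys → (∀ {x} → x ∈ xs → x ∉ ys) →
  XInv ρ xs ys + XInv ρ ys xs ≡ length xs * length ys
XInv-complement ρ xs ys dis = begin
  XInv ρ xs ys + XInv ρ ys xs                     ≡⟨ cong (XInv ρ xs ys +_) (cross-flip (after ρ) ys xs) ⟩
  XInv ρ xs ys + cross (λ x y → after ρ y x) xs ys ≡⟨ sym (cross-+ (after ρ) _ xs ys) ⟩
  cross (λ x y → after ρ x y + after ρ y x) xs ys ≡⟨ cross-cong xs ys (λ x∈ y∈ → one (λ { refl → dis x∈ y∈ })) ⟩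
  cross (λ _ _ → 1) xs ys                         ≡⟨ trans (cross-const 1 xs ys) (cong (length xs *_) (*-identityʳ (length ys))) ⟩
  length xs * length ys                           ∎
  where
  open ≡-Reasoning
  one : ∀ {x y} → x ≢ y → after ρ x y + after ρ y x ≡ 1
  one {x} {y} x≢y with <-cmp (rank ρ x) (rank ρ y)
  ... | tri< lt _ ¬gt rewrite before-true ρ lt | before-false ρ ¬gt = refl
  ... | tri≈ _ eq _ = ⊥-elim (x≢y (rank-injective ρ eq))
  ... | tri> ¬lt _ gt rewrite before-true ρ gt | before-false ρ ¬lt = refl

Sorted : Ranking n → List (Fin n) → Set
Sorted ρ = AllPairs (λ x y → rank ρ x < rank ρ y)

-- In a sorted list earlier position means smaller rank. This links the counting over shuffles with
-- the inversions that define `minInv`.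
inversions-XInv : ∀ (ρ : Ranking n) b p → Sorted ρ p →
  inversions b p ≡ XInv ρ (filterᵇ b p) (filterᵇ (not ∘ b) p)
inversions-XInv ρ b [] [] = refl
inversions-XInv ρ b (x ∷ p) (x< ∷ srt) with b x
... | true  = trans (inversions-XInv ρ b p srt) (cong (_+ XInv ρ (filterᵇ b p) (filterᵇ (not ∘ b) p)) (sym none))
  where
  none : total (after ρ x) (filterᵇ (not ∘ b) p) ≡ 0
  none = trans (total-cong (filterᵇ (not ∘ b) p) (λ y∈ →
      cong ⟦_⟧ (before-false ρ (<-asym (All.lookup x< (proj₁ (∈-filter⁻ (T? ∘ not ∘ b) y∈)))))))
    (trans (total-const 0 (filterᵇ (not ∘ b) p)) (*-zeroʳ (length (filterᵇ (not ∘ b) p))))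
... | false = trans (cong₂ _+_ ones (inversions-XInv ρ b p srt)) (sym (total-+ (λ u → after ρ u x) _ (filterᵇ b p)))
  where
  count-filter : ∀ p → count b p ≡ length (filterᵇ b p)
  count-filter [] = refl
  count-filter (y ∷ p) with b y
  ... | true  = cong suc (count-filter p)
  ... | false = count-filter p
  ones : count b p ≡ total (λ u → after ρ u x) (filterᵇ b p)
  ones = trans (count-filter p) (trans (length≡total (filterᵇ b p)) (total-cong (filterᵇ b p) (λ y∈ →
    sym (cong ⟦_⟧ (before-true ρ (All.lookup x< (proj₁ (∈-filter⁻ (T? ∘ b) y∈))))))))

filter-separated : ∀ {b : A → Bool} {u v} → Separates b u v → filterᵇ b (u ++ v) ≡ u
filter-separated {u = []} {[]} sep = refl
filter-separated {u = []} {y ∷ v} sep rewrite outside sep (here refl) = filter-separated {u = []} (tailʳ sep)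
filter-separated {u = x ∷ u} sep rewrite inside sep (here refl) = cong (x ∷_) (filter-separated (tailˡ sep))

↭-inside : ∀ {b : A → Bool} {u v p} → Separates b u v → p ↭ u ++ v → filterᵇ b p ↭ u
↭-inside {b = b} {p = p} sep p↭ = subst (filterᵇ b p ↭_) (filter-separated sep) (filter-↭ (T? ∘ b) p↭)

↭-outside : ∀ {b : A → Bool} {u v p} → Separates b u v → p ↭ u ++ v → filterᵇ (not ∘ b) p ↭ v
↭-outside {u = u} {v} sep p↭ = ↭-inside (swap-sides sep) (↭.↭-trans p↭ (++-comm u v))

-- l is the image of k when the ranks a and a + 1 are exchanged.
data Moved (a : ℕ) : ℕ → ℕ → Set where
  up   : Moved a a (suc a)
  down : Moved a (suc a) a
  stay : ∀ {k} → k ≢ a → k ≢ suc a → Moved a k k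

moved-sym : ∀ {a k l} → Moved a k l → Moved a l k
moved-sym up           = down
moved-sym down         = up
moved-sym (stay p q)   = stay p q

-- No rank lies strictly between the exchanged ones, so only those two change their relative order.
moved-< : ∀ {a k l k′ l′} → Moved a k l → Moved a k′ l′ →
  ¬ (k ≡ a × k′ ≡ suc a) → ¬ (k ≡ suc a × k′ ≡ a) → k < k′ → l < l′
moved-< up         up            _ _  lt = ⊥-elim (<-irrefl refl lt)
moved-< up         down          ¬p _ lt = ⊥-elim (¬p (refl , refl))
moved-< up         (stay _ ≢1+a) _ _  lt = ≤∧≢⇒< lt (≢1+a ∘ sym)
moved-< down       up            _ ¬q lt = ⊥-elim (¬q (refl , refl))
moved-< down       down          _ _  lt = ⊥-elim (<-irrefl refl lt)
moved-< down       (stay _ _)    _ _  lt = <-trans (n<1+n _) lt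
moved-< (stay _ _) up            _ _  lt = <-trans lt (n<1+n _)
moved-< (stay ≢a _) down         _ _  (s≤s le) = ≤∧≢⇒< le ≢a
moved-< (stay _ _) (stay _ _)    _ _  lt = lt

exchange : Ranking n → Fin n → Fin n → Ranking n
exchange ρ x y = transpose x y ∘ₚ ρ

rank-exchange-x : ∀ (ρ : Ranking n) x y → rank (exchange ρ x y) x ≡ rank ρ y
rank-exchange-x ρ x y with x ≟ᶠ x
... | yes _ = refl
... | no x≢x = ⊥-elim (x≢x refl)

rank-exchange-y : ∀ (ρ : Ranking n) x y → rank (exchange ρ x y) y ≡ rank ρ x
rank-exchange-y ρ x y with y ≟ᶠ x
... | yes refl = refl
... | no _ with y ≟ᶠ y
... | yes _ = refl
... | no y≢y = ⊥-elim (y≢y refl)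

rank-exchange-other : ∀ (ρ : Ranking n) x y {u} → u ≢ x → u ≢ y → rank (exchange ρ x y) u ≡ rank ρ u
rank-exchange-other ρ x y {u} u≢x u≢y with u ≟ᶠ x
... | yes eq = ⊥-elim (u≢x eq)
... | no _ with u ≟ᶠ y
... | yes eq = ⊥-elim (u≢y eq)
... | no _ = refl

-- `σ` enters only through its ranks, so nothing below depends on how the transposition computes.
module Exchange (ρ σ : Ranking n) (x y : Fin n) (next : rank ρ y ≡ suc (rank ρ x))
  (rank-x : rank σ x ≡ suc (rank ρ x)) (rank-y : rank σ y ≡ rank ρ x)
  (rank-other : ∀ {u} → u ≢ x → u ≢ y → rank σ u ≡ rank ρ u) where

  moved : ∀ u → Moved (rank ρ x) (rank ρ u) (rank σ u)
  moved u with u ≟ᶠ x | u ≟ᶠ y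
  ... | yes refl | _        = subst (Moved (rank ρ x) (rank ρ x)) (sym rank-x) up
  ... | no _     | yes refl = subst₂ (Moved (rank ρ x)) (sym next) (sym rank-y) down
  ... | no u≢x   | no u≢y   = subst (Moved (rank ρ x) (rank ρ u)) (sym (rank-other u≢x u≢y))
    (stay (u≢x ∘ rank-injective ρ) (λ eq → u≢y (rank-injective ρ (trans eq (sym next)))))

  Is-xy : Fin n → Fin n → Set
  Is-xy u v = (u ≡ x × v ≡ y) ⊎ (u ≡ y × v ≡ x)

  agree : ∀ u v → ¬ Is-xy u v → before σ u v ≡ before ρ u v
  agree u v ¬xy = before-cong σ ρ {u} {v} {u} {v}
    (moved-< (moved-sym (moved u)) (moved-sym (moved v))
      (λ (p , q) → ¬xy (inj₂ (σ-y p , σ-x q))) (λ (p , q) → ¬xy (inj₁ (σ-x p , σ-y q))))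
    (moved-< (moved u) (moved v)
      (λ (p , q) → ¬xy (inj₁ (rank-injective ρ p , rank-injective ρ (trans q (sym next)))))
      (λ (p , q) → ¬xy (inj₂ (rank-injective ρ (trans p (sym next)) , rank-injective ρ q))))
    where
    σ-x : ∀ {w} → rank σ w ≡ suc (rank ρ x) → w ≡ x
    σ-x eq = rank-injective σ (trans eq (sym rank-x))
    σ-y : ∀ {w} → rank σ w ≡ rank ρ x → w ≡ y
    σ-y eq = rank-injective σ (trans eq (sym rank-y))

  ρ-xy : before ρ x y ≡ true
  ρ-xy = before-true ρ (≤-reflexive (sym next))

  ρ-yx : before ρ y x ≡ false
  ρ-yx = before-false ρ (<-asym (≤-reflexive (sym next)))

  σ-yx : before σ y x ≡ true
  σ-yx = before-true σ (subst₂ _<_ (sym rank-y) (sym rank-x) (n<1+n _))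

  σ-xy : before σ x y ≡ false
  σ-xy = before-false σ (subst₂ (λ k l → ¬ k < l) (sym rank-x) (sym rank-y) (<-asym (n<1+n _)))

  XInv-same : ∀ xs ys → (∀ {u v} → u ∈ xs → v ∈ ys → ¬ Is-xy u v) → XInv σ xs ys ≡ XInv ρ xs ys
  XInv-same xs ys ¬xy = cross-cong xs ys (λ {u} {v} u∈ v∈ →
    cong ⟦_⟧ (agree v u (λ { (inj₁ (p , q)) → ¬xy u∈ v∈ (inj₂ (q , p)) ; (inj₂ (p , q)) → ¬xy u∈ v∈ (inj₁ (q , p)) })))

  minInv-same : ∀ t → ¬ (x ∈ leaves t × y ∈ leaves t) → minInv t σ ≡ minInv t ρ
  minInv-same (leaf a) ¬xy = refl
  minInv-same (un t) ¬xy = minInv-same t ¬xy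
  minInv-same (bin s t) ¬xy = cong₂ _+_
    (cong₂ _+_ (minInv-same s (λ (x∈ , y∈) → ¬xy (∈-++⁺ˡ x∈ , ∈-++⁺ˡ y∈)))
               (minInv-same t (λ (x∈ , y∈) → ¬xy (∈-++⁺ʳ (leaves s) x∈ , ∈-++⁺ʳ (leaves s) y∈))))
    (cong₂ _⊓_ (XInv-same (leaves s) (leaves t)
                 (λ { u∈ v∈ (inj₁ (refl , refl)) → ¬xy (∈-++⁺ˡ u∈ , ∈-++⁺ʳ (leaves s) v∈)
                    ; u∈ v∈ (inj₂ (refl , refl)) → ¬xy (∈-++⁺ʳ (leaves s) v∈ , ∈-++⁺ˡ u∈) }))
               (XInv-same (leaves t) (leaves s)
                 (λ { u∈ v∈ (inj₁ (refl , refl)) → ¬xy (∈-++⁺ʳ (leaves s) u∈ , ∈-++⁺ˡ v∈)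
                    ; u∈ v∈ (inj₂ (refl , refl)) → ¬xy (∈-++⁺ˡ v∈ , ∈-++⁺ʳ (leaves s) u∈) })))

  XInv-up : ∀ {xs ys} → Unique xs → Unique ys → x ∈ xs → y ∈ ys → (∀ {u} → u ∈ xs → u ∉ ys) →
    XInv σ xs ys ≡ suc (XInv ρ xs ys)
  XInv-up xs! ys! x∈ y∈ dis = cross-bump xs! ys! x∈ y∈
    (trans (cong ⟦_⟧ σ-yx) (cong (suc ∘ ⟦_⟧) (sym ρ-yx)))
    (λ {u} {v} u∈ v∈ ¬xy → cong ⟦_⟧ (agree v u
      (λ { (inj₁ (refl , refl)) → dis x∈ v∈ ; (inj₂ (refl , refl)) → ¬xy (refl , refl) })))

  XInv-down : ∀ {xs ys} → Unique xs → Unique ys → y ∈ xs → x ∈ ys → (∀ {u} → u ∈ xs → u ∉ ys) →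
    XInv ρ xs ys ≡ suc (XInv σ xs ys)
  XInv-down xs! ys! y∈ x∈ dis = cross-bump xs! ys! y∈ x∈
    (trans (cong ⟦_⟧ ρ-xy) (cong (suc ∘ ⟦_⟧) (sym σ-xy)))
    (λ {u} {v} u∈ v∈ ¬yx → cong ⟦_⟧ (sym (agree v u
      (λ { (inj₁ (refl , refl)) → ¬yx (refl , refl) ; (inj₂ (refl , refl)) → dis u∈ x∈ }))))

  -- At the lowest common ancestor the two counts are a and b + 1 under `ρ`, a + 1 and b under `σ`.
  -- If a < b the minimum rises from a to a + 1, and if b < a it falls from b + 1 to b.
  balanced : ∀ {a b} → a ⊓ suc b ≡ suc a ⊓ b → a ≡ b
  balanced {a} {b} eq with <-cmp a b
  ... | tri≈ _ a≡b _ = a≡b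
  ... | tri< a<b _ _ = ⊥-elim (<-irrefl (trans (sym (m≤n⇒m⊓n≡m (≤-trans (<⇒≤ a<b) (n≤1+n b)))) (trans eq (m≤n⇒m⊓n≡m a<b))) (n<1+n a))
  ... | tri> _ _ b<a = ⊥-elim (<-irrefl (trans (sym (m≥n⇒m⊓n≡n (≤-trans (<⇒≤ b<a) (n≤1+n a)))) (trans (sym eq) (m≥n⇒m⊓n≡n b<a))) (n<1+n b))

  δ-refl : ∀ k → δ k k ≡ 1
  δ-refl zero    = refl
  δ-refl (suc k) = δ-refl k

  -- As long as `x` and `y` lie on one side, the terms of the other side and of the node cancel and
  -- the recursion follows that side. Once they are separated, only the minimum at this node can
  -- change, and `balanced` forces its two counts to differ by one.
  insensitive⇒bad : ∀ t {p} → Unique (leaves t) → Sorted ρ p → p ↭ leaves t → x ∈ leaves t → y ∈ leaves t →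
    minInv t σ ≡ minInv t ρ → 1 ≤ badness t p x y
  insensitive⇒bad (leaf a) uniq srt p↭ (here refl) (here refl) eq = ⊥-elim (<-irrefl next (n<1+n _))
  insensitive⇒bad (un t) uniq srt p↭ x∈ y∈ eq = insensitive⇒bad t uniq srt p↭ x∈ y∈ eq
  insensitive⇒bad (bin s t) {p} uniq srt p↭ x∈ y∈ eq
    with Unique-++⁻ (leaves s) uniq | leaves-separated s t uniq | ∈-++⁻ (leaves s) x∈ | ∈-++⁻ (leaves s) y∈
  ... | s! , t! , dis | sep | inj₁ x∈s | inj₁ y∈s rewrite inside sep x∈s | inside sep y∈s =
    insensitive⇒bad s s! (AllPairs.filter⁺ _ srt) (↭-inside sep p↭) x∈s y∈s
      (+-cancelʳ-≡ (minInv t ρ) _ _ (+-cancelʳ-≡ X _ _ (begin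
        minInv s σ + minInv t ρ + X  ≡⟨ sym (cong₂ (λ a b → minInv s σ + a + b) (minInv-same t (dis x∈s ∘ proj₁)) same-X) ⟩
        minInv (bin s t) σ           ≡⟨ eq ⟩
        minInv (bin s t) ρ           ∎)))
    where
    open ≡-Reasoning
    X = XInv ρ (leaves s) (leaves t) ⊓ XInv ρ (leaves t) (leaves s)
    same-X = cong₂ _⊓_
      (XInv-same (leaves s) (leaves t) (λ { _ v∈ (inj₁ (refl , refl)) → dis y∈s v∈ ; _ v∈ (inj₂ (refl , refl)) → dis x∈s v∈ }))
      (XInv-same (leaves t) (leaves s) (λ { u∈ _ (inj₁ (refl , refl)) → dis x∈s u∈ ; u∈ _ (inj₂ (refl , refl)) → dis y∈s u∈ }))
  ... | s! , t! , dis | sep | inj₂ x∈t | inj₂ y∈t rewrite outside sep x∈t | outside sep y∈t =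
    insensitive⇒bad t t! (AllPairs.filter⁺ _ srt) (↭-outside sep p↭) x∈t y∈t
      (+-cancelˡ-≡ (minInv s ρ) _ _ (+-cancelʳ-≡ X _ _ (begin
        minInv s ρ + minInv t σ + X  ≡⟨ sym (cong₂ (λ a b → a + minInv t σ + b) (minInv-same s (λ (x∈s , _) → dis x∈s x∈t)) same-X) ⟩
        minInv (bin s t) σ           ≡⟨ eq ⟩
        minInv (bin s t) ρ           ∎)))
    where
    open ≡-Reasoning
    X = XInv ρ (leaves s) (leaves t) ⊓ XInv ρ (leaves t) (leaves s)
    same-X = cong₂ _⊓_
      (XInv-same (leaves s) (leaves t) (λ { u∈ _ (inj₁ (refl , refl)) → dis u∈ x∈t ; u∈ _ (inj₂ (refl , refl)) → dis u∈ y∈t }))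
      (XInv-same (leaves t) (leaves s) (λ { _ v∈ (inj₁ (refl , refl)) → dis v∈ y∈t ; _ v∈ (inj₂ (refl , refl)) → dis v∈ x∈t }))
  ... | s! , t! , dis | sep | inj₁ x∈s | inj₂ y∈t rewrite inside sep x∈s | outside sep y∈t =
    -- With `x` on the left side the inversions are the smaller of the two counts, so the first
    -- summand of `central` is 1.
    ≤-trans (≤-reflexive (sym (trans (cong₂ δ lr (cong (λ k → suc (k + k)) inv)) (δ-refl (suc (a + a)))))) (m≤m+n _ _)
    where
    open ≡-Reasoning
    a = XInv ρ (leaves s) (leaves t)
    b = XInv σ (leaves t) (leaves s)
    up-X : XInv σ (leaves s) (leaves t) ≡ suc a
    up-X = XInv-up s! t! x∈s y∈t dis
    down-X : XInv ρ (leaves t) (leaves s) ≡ suc b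
    down-X = XInv-down t! s! y∈t x∈s (λ v∈ u∈ → dis u∈ v∈)
    a≡b : a ≡ b
    a≡b = balanced (+-cancelˡ-≡ (minInv s ρ + minInv t ρ) _ _ (begin
      minInv s ρ + minInv t ρ + (a ⊓ suc b) ≡⟨ cong (λ k → minInv s ρ + minInv t ρ + (a ⊓ k)) (sym down-X) ⟩
      minInv (bin s t) ρ                    ≡⟨ sym eq ⟩
      minInv (bin s t) σ                    ≡⟨ cong₂ (λ k l → k + l + (XInv σ (leaves s) (leaves t) ⊓ b))
                                                 (minInv-same s (λ (_ , y∈s) → dis y∈s y∈t)) (minInv-same t (dis x∈s ∘ proj₁)) ⟩
      minInv s ρ + minInv t ρ + (XInv σ (leaves s) (leaves t) ⊓ b) ≡⟨ cong (λ k → minInv s ρ + minInv t ρ + (k ⊓ b)) up-X ⟩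
      minInv s ρ + minInv t ρ + (suc a ⊓ b) ∎))
    lr : size s * size t ≡ suc (a + a)
    lr = begin
      size s * size t                     ≡⟨ sym (XInv-complement ρ (leaves s) (leaves t) dis) ⟩
      a + XInv ρ (leaves t) (leaves s)    ≡⟨ cong (a +_) (trans down-X (cong suc (sym a≡b))) ⟩
      a + suc a                           ≡⟨ +-suc a a ⟩
      suc (a + a)                         ∎
    inv : inversions (isLeafOf s) p ≡ a
    inv = trans (inversions-XInv ρ (isLeafOf s) p srt) (cross-↭ (after ρ) (↭-inside sep p↭) (↭-outside sep p↭))
  ... | s! , t! , dis | sep | inj₂ x∈t | inj₁ y∈s rewrite inside sep y∈s | outside sep x∈t =
    -- With `x` on the right side they are the larger count, so it is the second summand.
    ≤-trans (≤-reflexive (sym (trans (cong₂ δ lr (cong (λ k → k + k) inv)) (δ-refl (suc b + suc b))))) (m≤n+m _ _)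
    where
    open ≡-Reasoning
    a = XInv ρ (leaves t) (leaves s)
    b = XInv σ (leaves s) (leaves t)
    up-X : XInv σ (leaves t) (leaves s) ≡ suc a
    up-X = XInv-up t! s! x∈t y∈s (λ v∈ u∈ → dis u∈ v∈)
    down-X : XInv ρ (leaves s) (leaves t) ≡ suc b
    down-X = XInv-down s! t! y∈s x∈t dis
    a≡b : a ≡ b
    a≡b = balanced (+-cancelˡ-≡ (minInv s ρ + minInv t ρ) _ _ (begin
      minInv s ρ + minInv t ρ + (a ⊓ suc b) ≡⟨ cong (minInv s ρ + minInv t ρ +_) (trans (⊓-comm a (suc b)) (cong (_⊓ a) (sym down-X))) ⟩
      minInv (bin s t) ρ                    ≡⟨ sym eq ⟩
      minInv (bin s t) σ                    ≡⟨ cong₂ (λ k l → k + l + (b ⊓ XInv σ (leaves t) (leaves s)))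
                                                 (minInv-same s (λ (x∈s , _) → dis x∈s x∈t)) (minInv-same t (λ (_ , y∈t) → dis y∈s y∈t)) ⟩
      minInv s ρ + minInv t ρ + (b ⊓ XInv σ (leaves t) (leaves s)) ≡⟨ cong (minInv s ρ + minInv t ρ +_) (trans (cong (b ⊓_) up-X) (⊓-comm b (suc a))) ⟩
      minInv s ρ + minInv t ρ + (suc a ⊓ b) ∎))
    lr : suc (size s * size t) ≡ suc b + suc b
    lr = cong suc (begin
      size s * size t                     ≡⟨ sym (XInv-complement ρ (leaves s) (leaves t) dis) ⟩
      XInv ρ (leaves s) (leaves t) + a    ≡⟨ cong₂ _+_ down-X a≡b ⟩
      suc b + b                           ≡⟨ sym (+-suc b b) ⟩
      b + suc b                           ∎)
    inv : inversions (isLeafOf s) p ≡ suc b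
    inv = trans (inversions-XInv ρ (isLeafOf s) p srt)
      (trans (cross-↭ (after ρ) (↭-inside sep p↭) (↭-outside sep p↭)) down-X)

-- Comparison algorithms

path : DTree n → Ranking n → List (Fin n × Fin n)
path (answer k)    ρ = []
path (ask x y t f) ρ = (x , y) ∷ (if before ρ x y then path t ρ else path f ρ)

-- The answers as binary digits, the first being the least significant. No length is stored: the
-- parity reveals the first answer, and with it the subtree in which to go on.
transcript : DTree n → Ranking n → ℕ
transcript (answer k)    ρ = 0
transcript (ask x y t f) ρ =
  if before ρ x y then suc (transcript t ρ + transcript t ρ) else transcript f ρ + transcript f ρ

Agree : Ranking n → Ranking n → Fin n × Fin n → Set
Agree ρ σ (x , y) = before ρ x y ≡ before σ x y

eval-ask : ∀ x y t f (ρ : Ranking n) → eval (ask x y t f) ρ ≡ (if before ρ x y then eval t ρ else eval f ρ)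
eval-ask x y t f ρ with (ρ ⟨$⟩ʳ x) <? (ρ ⟨$⟩ʳ y)
... | yes lt rewrite before-true ρ {x} {y} lt = refl
... | no ¬lt rewrite before-false ρ {x} {y} ¬lt = refl

queries-ask : ∀ x y t f (ρ : Ranking n) → queries (ask x y t f) ρ ≡ suc (if before ρ x y then queries t ρ else queries f ρ)
queries-ask x y t f ρ with (ρ ⟨$⟩ʳ x) <? (ρ ⟨$⟩ʳ y)
... | yes lt rewrite before-true ρ {x} {y} lt = refl
... | no ¬lt rewrite before-false ρ {x} {y} ¬lt = refl

agree⇒eval≡ : ∀ (D : DTree n) ρ σ → All (Agree ρ σ) (path D ρ) → eval D ρ ≡ eval D σ
agree⇒eval≡ (answer k) ρ σ _ = refl
agree⇒eval≡ (ask x y t f) ρ σ (e ∷ es) rewrite eval-ask x y t f ρ | eval-ask x y t f σ | sym e with before ρ x y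
... | true  = agree⇒eval≡ t ρ σ es
... | false = agree⇒eval≡ f ρ σ es

transcript-injective : ∀ (D : DTree n) ρ σ → transcript D ρ ≡ transcript D σ →
  path D ρ ≡ path D σ × All (Agree ρ σ) (path D ρ)
transcript-injective (answer k) ρ σ _ = refl , []
transcript-injective (ask x y t f) ρ σ eq with before ρ x y in e | before σ x y in e′
... | true  | true  with p , a ← transcript-injective t ρ σ (double-injective _ _ (suc-injective eq)) =
  cong (_ ∷_) p , trans e (sym e′) ∷ a
... | true  | false = odd≢even (transcript t ρ) (transcript f σ) eq
... | false | true  = odd≢even (transcript t σ) (transcript f ρ) (sym eq)
... | false | false with p , a ← transcript-injective f ρ σ (double-injective _ _ eq) =
  cong (_ ∷_) p , trans e (sym e′) ∷ a

odd-< : ∀ {k m} → k < m → suc (k + k) < 2 * m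
odd-< {k} {m} lt = ≤-trans (≤-reflexive (cong suc (sym (+-suc k k))))
  (+-mono-≤ lt (≤-trans lt (≤-reflexive (sym (+-identityʳ m)))))

transcript-< : ∀ (D : DTree n) ρ → transcript D ρ < 2 ^ queries D ρ
transcript-< (answer k) ρ = s≤s z≤n
transcript-< (ask x y t f) ρ rewrite queries-ask x y t f ρ with before ρ x y
... | true  = odd-< (transcript-< t ρ)
... | false = <-trans (n<1+n _) (odd-< (transcript-< f ρ))

-- Taken symmetrically, since for distinct items the answer to one question settles the reversed
-- one.
compared : List (Fin n × Fin n) → Fin n → Fin n → Bool
compared ps x y = does ((x , y) ∈? ps) ∨ does ((y , x) ∈? ps)
  where open DecMembership (≡-dec _≟ᶠ_ _≟ᶠ_) using (_∈?_)

compared-true : ∀ (ps : List (Fin n × Fin n)) {x y} → compared ps x y ≡ true → (x , y) ∈ ps ⊎ (y , x) ∈ ps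
compared-true ps {x} {y} eq with DecMembership._∈?_ (≡-dec _≟ᶠ_ _≟ᶠ_) (x , y) ps
... | yes xy∈ = inj₁ xy∈
... | no _ with DecMembership._∈?_ (≡-dec _≟ᶠ_ _≟ᶠ_) (y , x) ps
... | yes yx∈ = inj₂ yx∈

compared-false : ∀ (ps : List (Fin n × Fin n)) {x y} → compared ps x y ≡ false → (x , y) ∉ ps × (y , x) ∉ ps
compared-false ps {x} {y} eq with DecMembership._∈?_ (≡-dec _≟ᶠ_ _≟ᶠ_) (x , y) ps
... | no xy∉ with DecMembership._∈?_ (≡-dec _≟ᶠ_ _≟ᶠ_) (y , x) ps
... | no yx∉ = xy∉ , yx∉

∈-tail : ∀ {w x : A} {xs} → w ∈ x ∷ xs → x ≢ w → w ∈ xs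
∈-tail (here refl) x≢w = ⊥-elim (x≢w refl)
∈-tail (there w∈)  _   = w∈

-- Rankings as lists

data Ranked (ρ : Ranking n) : ℕ → List (Fin n) → Set where
  []  : ∀ {k} → Ranked ρ k []
  _∷_ : ∀ {k x p} → rank ρ x ≡ k → Ranked ρ (suc k) p → Ranked ρ k (x ∷ p)

Ranked⇒Sorted : ∀ {ρ : Ranking n} {k p} → Ranked ρ k p → Sorted ρ p
Ranked⇒Sorted [] = []
Ranked⇒Sorted {ρ = ρ} (refl ∷ r) = from≥ r ∷ Ranked⇒Sorted r
  where
  from≥ : ∀ {k p} → Ranked ρ k p → All (λ y → k ≤ rank ρ y) p
  from≥ [] = []
  from≥ (refl ∷ r) = ≤-refl ∷ All.map <⇒≤ (from≥ r)

position : List (Fin n) → Fin n → ℕ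
position []      x = 0
position (y ∷ p) x = if does (x ≟ᶠ y) then 0 else suc (position p x)

position-< : ∀ {p : List (Fin n)} {x} → x ∈ p → position p x < length p
position-< {p = y ∷ p} {x} x∈ with x ≟ᶠ y
... | yes _ = s≤s z≤n
position-< {p = y ∷ p} {x} (here eq)  | no x≢y = ⊥-elim (x≢y eq)
position-< {p = y ∷ p} {x} (there x∈) | no x≢y = s≤s (position-< x∈)

lookup-position : ∀ {p : List (Fin n)} {x} → x ∈ p → (i : Fin (length p)) → toℕ i ≡ position p x → lookup p i ≡ x
lookup-position {p = y ∷ p} {x} x∈ i eq with x ≟ᶠ y
lookup-position {p = y ∷ p} {x} x∈ Fin.zero eq | yes refl = refl
lookup-position {p = y ∷ p} {x} (here x≡y) i eq | no x≢y = ⊥-elim (x≢y x≡y)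
lookup-position {p = y ∷ p} {x} (there x∈) (Fin.suc i) eq | no x≢y = lookup-position x∈ i (suc-injective eq)

position-lookup : ∀ {p : List (Fin n)} → Unique p → (i : Fin (length p)) → position p (lookup p i) ≡ toℕ i
position-lookup {p = y ∷ p} _ Fin.zero with y ≟ᶠ y
... | yes _ = refl
... | no y≢y = ⊥-elim (y≢y refl)
position-lookup {p = y ∷ p} (y∉ ∷ p!) (Fin.suc i) with lookup p i ≟ᶠ y
... | yes eq = ⊥-elim (All.lookup y∉ (∈-lookup i) (sym eq))
... | no _ = cong suc (position-lookup p! i)

Unique-resp-↭ : ∀ {xs ys : List A} → xs ↭ ys → Unique xs → Unique ys
Unique-resp-↭ p = Permutationₛ.Unique-resp-↭ (setoid _) (↭.↭⇒↭ₛ p)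

-- The rank of an item is its position in `p`, and the inverse is lookup.
ranking : ∀ (p : List (Fin n)) → p ↭ allFin n → Σ (Ranking n) λ ρ → Ranked ρ 0 p
ranking {n} p p↭ = ρ , ranked p 0 p! (λ {x} x∈ → toℕ-fromℕ< (pos< x))
  where
  p! : Unique p
  p! = Unique-resp-↭ (↭.↭-sym p↭) (Unique.allFin⁺ n)
  len : length p ≡ n
  len = trans (↭-length p↭) (length-tabulate (λ i → i))
  ∈p : ∀ x → x ∈ p
  ∈p x = ∈-resp-↭ (↭.↭-sym p↭) (∈-allFin x)
  pos< : ∀ x → position p x < n
  pos< x = subst (position p x <_) len (position-< (∈p x))
  to from : Fin n → Fin n
  to x = fromℕ< (pos< x)
  from i = lookup p (cast (sym len) i)
  ρ : Ranking n
  ρ = permutation to from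
    (λ i → toℕ-injective (trans (toℕ-fromℕ< (pos< (from i))) (trans (position-lookup p! (cast (sym len) i)) (toℕ-cast (sym len) i))))
    (λ x → lookup-position (∈p x) (cast (sym len) (to x)) (trans (toℕ-cast (sym len) (to x)) (toℕ-fromℕ< (pos< x))))
  ranked : ∀ q k → Unique q → (∀ {x} → x ∈ q → rank ρ x ≡ k + position q x) → Ranked ρ k q
  ranked [] k _ _ = []
  ranked (y ∷ q) k (y∉ ∷ q!) h = trans (h (here refl)) first ∷ ranked q (suc k) q! rest
    where
    first : k + position (y ∷ q) y ≡ k
    first with y ≟ᶠ y
    ... | yes _ = +-identityʳ k
    ... | no y≢y = ⊥-elim (y≢y refl)
    rest : ∀ {x} → x ∈ q → rank ρ x ≡ suc k + position q x
    rest {x} x∈ with h (there x∈)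
    ... | eq with x ≟ᶠ y
    ... | yes refl = ⊥-elim (All.lookup y∉ x∈ refl)
    ... | no _ = trans eq (+-suc k _)

-- The elements of p that are not related by q to their predecessor, z being that of the first.
starts : (A → A → Bool) → A → List A → List A
starts q z []      = []
starts q z (x ∷ p) = if q z x then starts q x p else x ∷ starts q x p

-- Each start is the second item of a consecutive pair that was not compared, and such a pair counts
-- at least 1 in `Q`.
starts-length : ∀ {ρ : Ranking n} (q : Fin n → Fin n → Bool) (Q : Fin n → Fin n → ℕ) {k z p} → Ranked ρ k (z ∷ p) →
  (∀ {x y} → rank ρ y ≡ suc (rank ρ x) → q x y ≡ false → 1 ≤ Q x y) → length (starts q z p) ≤ adjacent Q (z ∷ p)
starts-length q Q {p = []} r h = z≤n
starts-length q Q {z = z} {p = x ∷ p} (rz ∷ r@(rx ∷ _)) h with q z x in eq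
... | true  = ≤-trans (starts-length q Q r h) (m≤n+m _ (Q z x))
... | false = +-mono-≤ (h (trans rx (cong suc (sym rz))) eq) (starts-length q Q r h)

starts-⊆ : ∀ (q : A → A → Bool) {x} z p → x ∈ starts q z p → x ∈ p
starts-⊆ q z (y ∷ p) x∈ with q z y
... | true = there (starts-⊆ q y p x∈)
starts-⊆ q z (y ∷ p) (here eq)  | false = here eq
starts-⊆ q z (y ∷ p) (there x∈) | false = there (starts-⊆ q y p x∈)

starts-tail : ∀ (q : A → A → Bool) {x} z y p → x ∈ starts q y p → x ∈ starts q z (y ∷ p)
starts-tail q z y p x∈ with q z y
... | true  = x∈
... | false = there x∈

predecessor : ∀ (q : A → A → Bool) {R : A → A → Set} {x} z p → x ∈ p → x ∉ starts q z p → AllPairs R (z ∷ p) →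
  ∃[ w ] w ∈ z ∷ p × q w x ≡ true × R w x
predecessor q z (y ∷ p) (here refl) x∉ ((Rzy ∷ _) ∷ _) with q z y in eq
... | true  = z , here refl , eq , Rzy
... | false = ⊥-elim (x∉ (here refl))
predecessor q z (y ∷ p) (there x∈) x∉ (_ ∷ Rs) with predecessor q y p x∈ (x∉ ∘ starts-tail q z y p) Rs
... | w , w∈ , qwx , Rwx = w , there w∈ , qwx , Rwx

-- A ranking is determined by its answers and its starts

module Reconstruct {A : Set} (_≟_ : (x y : A) → Dec (x ≡ y)) (q : A → A → Bool) where

  Consistent : (A → A → Set) → (A → A → Set) → Set
  Consistent R S = ∀ {x y} → q x y ≡ true → R y x → S x y → ⊥

  not-start : ∀ {z x p} → q z x ≡ true → All (x ≢_) p → x ∉ starts q z (x ∷ p)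
  not-start {z} {x} {p} qzx x∉ x∈ rewrite qzx = All.lookup x∉ (starts-⊆ q x p x∈) refl

  both-start : ∀ {z x y p p′} → q z x ≡ false → q z y ≡ false → starts q z (x ∷ p) ≡ starts q z (y ∷ p′) → x ≡ y
  both-start qzx qzy eq rewrite qzx | qzy = ∷-injectiveˡ eq

  either : ∀ b → b ≡ true ⊎ b ≡ false
  either true  = inj₁ refl
  either false = inj₂ refl

  -- If x follows z and they are compared, the other list cannot continue z by y ≢ x: there x, not
  -- being a start, is compared with its predecessor, which the first list has after x.
  blocked : ∀ {R S : A → A → Set} → Consistent R S → (∀ {x} → ¬ S x x) →
    ∀ {z x y p p′} → q z x ≡ true → x ≢ y → Unique (x ∷ p) → AllPairs R (x ∷ p) → AllPairs S (y ∷ p′) →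
    x ∈ y ∷ p′ → (∀ {w} → w ∈ y ∷ p′ → w ∈ x ∷ p) → starts q z (x ∷ p) ≡ starts q z (y ∷ p′) → ⊥
  blocked con irr qzx x≢y _ _ _ (here x≡y) _ _ = x≢y x≡y
  blocked con irr {z} {x} {y} {p} {p′} qzx x≢y (x∉ ∷ _) (Rx ∷ _) Ss (there x∈) ⊆ eq
    with predecessor q y p′ x∈ (not-start qzx x∉ ∘ subst (x ∈_) (sym eq) ∘ starts-tail q z y p′) Ss
  ... | w , w∈ , qwx , Swx with ⊆ w∈
  ... | here refl = irr Swx
  ... | there w∈p = con qwx (All.lookup Rx w∈p) Swx

  -- Suppose the two lists continue `z` differently. If either continuation is compared with `z`,
  -- `blocked` refutes this, from one side or the other; this is why consistency is assumed in both
  -- directions. Otherwise both continuations are the first entry of the same list of starts.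
  reconstruct : ∀ {R S : A → A → Set} → Consistent R S → Consistent S R → (∀ {x} → ¬ R x x) → (∀ {x} → ¬ S x x) →
    ∀ z p p′ → Unique p → Unique p′ → AllPairs R p → AllPairs S p′ →
    (∀ {w} → w ∈ p → w ∈ p′) → (∀ {w} → w ∈ p′ → w ∈ p) → starts q z p ≡ starts q z p′ → p ≡ p′
  reconstruct c c′ i i′ z []      []       _ _ _ _ ⊆ ⊇ eq = refl
  reconstruct c c′ i i′ z []      (y ∷ p′) _ _ _ _ ⊆ ⊇ eq with () ← ⊇ (here refl)
  reconstruct c c′ i i′ z (x ∷ p) []       _ _ _ _ ⊆ ⊇ eq with () ← ⊆ (here refl)
  reconstruct c c′ i i′ z (x ∷ p) (y ∷ p′) p!@(x∉ ∷ p!′) p′!@(y∉ ∷ p′!′) Rs@(_ ∷ Rs′) Ss@(_ ∷ Ss′) ⊆ ⊇ eq with x ≟ y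
  ... | yes refl = cong (x ∷_) (reconstruct c c′ i i′ x p p′ p!′ p′!′ Rs′ Ss′
          (λ w∈ → ∈-tail (⊆ (there w∈)) (All.lookup x∉ w∈)) (λ w∈ → ∈-tail (⊇ (there w∈)) (All.lookup y∉ w∈)) (tails eq))
    where
    tails : starts q z (x ∷ p) ≡ starts q z (x ∷ p′) → starts q x p ≡ starts q x p′
    tails eq with q z x
    tails eq   | true  = eq
    tails eq   | false = ∷-injectiveʳ eq
  ... | no x≢y with either (q z x) | either (q z y)
  ... | inj₁ qzx | _        = ⊥-elim (blocked c i′ qzx x≢y p! Rs Ss (⊆ (here refl)) ⊇ eq)
  ... | inj₂ _   | inj₁ qzy = ⊥-elim (blocked c′ i qzy (x≢y ∘ sym) p′! Ss Rs (⊇ (here refl)) ⊆ (sym eq))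
  ... | inj₂ qzx | inj₂ qzy = ⊥-elim (x≢y (both-start {p = p} {p′} qzx qzy eq))

-- Counting rankings

markov : ∀ (f : A → ℕ) k xs → total f xs ≤ k * length xs → length xs ≤ 2 * length (filter (λ x → f x ≤? 2 * k) xs)
markov f k xs f≤ = *-cancelˡ-≤ (suc k) (+-cancelˡ-≤ (k * length xs) _ _ (begin
  k * length xs + suc k * length xs             ≡⟨ expand k (length xs) ⟩
  suc (2 * k) * length xs                       ≤⟨ split xs ⟩
  total f xs + suc (2 * k) * G                  ≤⟨ +-mono-≤ f≤ (*-monoˡ-≤ G (n≤1+n (suc (2 * k)))) ⟩
  k * length xs + suc (suc (2 * k)) * G         ≡⟨ cong (k * length xs +_) (double k G) ⟩
  k * length xs + suc k * (2 * G)               ∎))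
  where
  open ≤-Reasoning
  P? = λ x → f x ≤? 2 * k
  G = length (filter P? xs)
  expand : ∀ k l → k * l + suc k * l ≡ suc (2 * k) * l
  expand = solve-∀
  double : ∀ k g → suc (suc (2 * k)) * g ≡ suc k * (2 * g)
  double = solve-∀
  split : ∀ xs → suc (2 * k) * length xs ≤ total f xs + suc (2 * k) * length (filter P? xs)
  split [] = m≤n+m _ 0
  split (x ∷ xs) with f x ≤? 2 * k
  ... | yes f≤ = begin
    suc (2 * k) * suc (length xs)             ≡⟨ *-suc (suc (2 * k)) (length xs) ⟩
    suc (2 * k) + suc (2 * k) * length xs     ≤⟨ +-monoʳ-≤ (suc (2 * k)) (split xs) ⟩
    suc (2 * k) + (total f xs + suc (2 * k) * g) ≤⟨ m≤n+m _ (f x) ⟩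
    f x + (suc (2 * k) + (total f xs + suc (2 * k) * g)) ≡⟨ arith (f x) (suc (2 * k)) (total f xs) g ⟩
    f x + total f xs + suc (2 * k) * suc g    ≡⟨ cong (λ ys → f x + total f xs + suc (2 * k) * length ys) (sym (filter-accept P? f≤)) ⟩
    f x + total f xs + suc (2 * k) * length (filter P? (x ∷ xs)) ∎
    where
    g = length (filter P? xs)
    arith : ∀ a b t g → a + (b + (t + b * g)) ≡ a + t + b * suc g
    arith = solve-∀
  ... | no f≰ = begin
    suc (2 * k) * suc (length xs)             ≡⟨ *-suc (suc (2 * k)) (length xs) ⟩
    suc (2 * k) + suc (2 * k) * length xs     ≤⟨ +-mono-≤ (≰⇒> f≰) (split xs) ⟩
    f x + (total f xs + suc (2 * k) * g)      ≡⟨ sym (+-assoc (f x) _ _) ⟩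
    f x + total f xs + suc (2 * k) * g        ≡⟨ cong (λ ys → f x + total f xs + suc (2 * k) * length ys) (sym (filter-reject P? f≰)) ⟩
    f x + total f xs + suc (2 * k) * length (filter P? (x ∷ xs)) ∎
    where
    g = length (filter P? xs)

lookup-injective : ∀ {xs : List A} → Unique xs → ∀ i j → lookup xs i ≡ lookup xs j → i ≡ j
lookup-injective (x∉ ∷ xs!) Fin.zero    Fin.zero    eq = refl
lookup-injective (x∉ ∷ xs!) Fin.zero    (Fin.suc j) eq = ⊥-elim (All.lookup x∉ (∈-lookup j) eq)
lookup-injective (x∉ ∷ xs!) (Fin.suc i) Fin.zero    eq = ⊥-elim (All.lookup x∉ (∈-lookup i) (sym eq))
lookup-injective (x∉ ∷ xs!) (Fin.suc i) (Fin.suc j) eq = cong Fin.suc (lookup-injective xs! i j eq)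

-- The code may depend on the membership proof, from which the ranking behind a list is constructed.
injection⇒length≤ : ∀ {xs : List A} {N} → Unique xs → (f : ∀ {x} → x ∈ xs → Fin N) →
  (∀ {x y} (x∈ : x ∈ xs) (y∈ : y ∈ xs) → f x∈ ≡ f y∈ → x ≡ y) → length xs ≤ N
injection⇒length≤ {xs = xs} xs! f inj = injective⇒≤ {f = λ i → f (∈-lookup {xs = xs} i)}
  (λ {i} {j} eq → lookup-injective xs! i j (inj (∈-lookup i) (∈-lookup j) eq))

-- Digits 1, …, n in base n + 1: short lists need no padding.
encode : List (Fin n) → ℕ
encode []               = 0
encode {n} (x ∷ xs) = suc (toℕ x) + encode xs * suc n

encode-< : ∀ (xs : List (Fin n)) k → length xs ≤ k → encode xs < suc n ^ k
encode-< {n} []       k       _        = m^n>0 (suc n) k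
encode-< {n} (x ∷ xs) (suc k) (s≤s le) = begin
  suc (suc (toℕ x) + encode xs * suc n) ≤⟨ s≤s (+-monoˡ-≤ (encode xs * suc n) (toℕ<n x)) ⟩
  suc n + encode xs * suc n             ≤⟨ *-monoˡ-≤ (suc n) (encode-< xs k le) ⟩
  suc n ^ k * suc n                     ≡⟨ *-comm (suc n ^ k) (suc n) ⟩
  suc n ^ suc k                         ∎
  where open ≤-Reasoning

encode-injective : ∀ (xs ys : List (Fin n)) → encode xs ≡ encode ys → xs ≡ ys
encode-injective []       []       eq = refl
encode-injective {n} (x ∷ xs) (y ∷ ys) eq = cong₂ _∷_ (toℕ-injective (suc-injective digit))
  (encode-injective xs ys (*-cancelʳ-≡ _ _ (suc n) (+-cancelˡ-≡ (suc (toℕ x)) _ _ (trans eq (cong (_+ encode ys * suc n) (sym digit))))))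
  where
  open ≡-Reasoning
  digit : suc (toℕ x) ≡ suc (toℕ y)
  digit = begin
    suc (toℕ x)                               ≡⟨ sym (m<n⇒m%n≡m (s≤s (toℕ<n x))) ⟩
    suc (toℕ x) % suc n                       ≡⟨ sym ([m+kn]%n≡m%n (suc (toℕ x)) (encode xs) (suc n)) ⟩
    (suc (toℕ x) + encode xs * suc n) % suc n ≡⟨ cong (_% suc n) eq ⟩
    (suc (toℕ y) + encode ys * suc n) % suc n ≡⟨ [m+kn]%n≡m%n (suc (toℕ y)) (encode ys) (suc n) ⟩
    suc (toℕ y) % suc n                       ≡⟨ m<n⇒m%n≡m (s≤s (toℕ<n y)) ⟩
    suc (toℕ y)                               ∎

runs : (A → A → Bool) → List A → List A
runs q []      = []
runs q (x ∷ p) = x ∷ starts q x p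

module Algorithm {n : ℕ} (T : BTree (Fin n)) (T↭ : leaves T ↭ allFin n)
  (D : DTree n) (correct : (ρ : Ranking n) → IsMInv T ρ (eval D ρ))
  (d : ℕ) (depth : (ρ : Ranking n) → queries D ρ ≤ d) where

  T! : Unique (leaves T)
  T! = Unique-resp-↭ (↭.↭-sym T↭) (Unique.allFin⁺ n)

  size≡n : size T ≡ n
  size≡n = trans (↭-length T↭) (length-tabulate (λ i → i))

  -- Exchanging `x` and `y` changes no answer on the path of `ρ`, so the algorithm outputs the same
  -- number for both rankings; being correct, it shows that the minimum did not change.
  uncompared⇒bad : ∀ {ρ p} → Ranked ρ 0 p → p ↭ leaves T → ∀ {x y} → rank ρ y ≡ suc (rank ρ x) →
    compared (path D ρ) x y ≡ false → 1 ≤ badness T p x y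
  uncompared⇒bad {ρ} r p↭ {x} {y} next unc =
    insensitive⇒bad T T! (Ranked⇒Sorted r) p↭ (∈T x) (∈T y)
      (trans (sym (IsMInv⇒≡minInv {t = T} (correct σ))) (trans (sym same) (IsMInv⇒≡minInv {t = T} (correct ρ))))
    where
    σ = exchange ρ x y
    open Exchange ρ σ x y next (trans (rank-exchange-x ρ x y) next) (rank-exchange-y ρ x y) (rank-exchange-other ρ x y)
    ∈T : ∀ z → z ∈ leaves T
    ∈T z = ∈-resp-↭ (↭.↭-sym T↭) (∈-allFin z)
    same : eval D ρ ≡ eval D σ
    same = agree⇒eval≡ D ρ σ (All.tabulate λ { {u , v} uv∈ → sym (agree u v
      λ { (inj₁ (refl , refl)) → proj₁ (compared-false (path D ρ) unc) uv∈
        ; (inj₂ (refl , refl)) → proj₂ (compared-false (path D ρ) unc) uv∈ }) })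

  runs-length : ∀ {ρ p} → Ranked ρ 0 p → p ↭ leaves T → length (runs (compared (path D ρ)) p) ≤ suc (#bad T p)
  runs-length {p = []}    r p↭ = z≤n
  runs-length {p = z ∷ p} r p↭ = s≤s (starts-length _ (badness T (z ∷ p)) r (uncompared⇒bad r p↭))

  -- Equal transcripts mean equal paths with equal answers, so both rankings have the same relation
  -- `compared` and order every compared pair alike. The first items agree because `runs` records
  -- them.
  runs-determine : ∀ {ρ σ p p′} → Ranked ρ 0 p → Ranked σ 0 p′ → p ↭ leaves T → p′ ↭ leaves T →
    transcript D ρ ≡ transcript D σ → runs (compared (path D ρ)) p ≡ runs (compared (path D σ)) p′ → p ≡ p′
  runs-determine {ρ} {σ} {p} {p′} r s p↭ p′↭ same eq with transcript-injective D ρ σ same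
  ... | paths , agrees rewrite sym paths = go p p′ r s (All⊆ p↭ p′↭) (All⊆ p′↭ p↭)
      (Unique-resp-↭ (↭.↭-sym p↭) T!) (Unique-resp-↭ (↭.↭-sym p′↭) T!) eq
    where
    q = compared (path D ρ)
    open Reconstruct _≟ᶠ_ q
    All⊆ : ∀ {p p′} → p ↭ leaves T → p′ ↭ leaves T → ∀ {w} → w ∈ p → w ∈ p′
    All⊆ p↭ p′↭ = ∈-resp-↭ (↭.↭-trans p↭ (↭.↭-sym p′↭))
    clash : ∀ (ρ σ : Ranking n) {x y} → Agree ρ σ (x , y) → ¬ (rank ρ y < rank ρ x × rank σ x < rank σ y)
    clash ρ σ {x} {y} e (lt , lt′) with () ← trans (sym (before-true σ lt′)) (trans (sym e) (before-false ρ {x} {y} (<-asym lt)))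
    con : Consistent (λ x y → rank ρ x < rank ρ y) (λ x y → rank σ x < rank σ y)
    con qxy lt lt′ with compared-true (path D ρ) qxy
    ... | inj₁ xy∈ = clash ρ σ (All.lookup agrees xy∈) (lt , lt′)
    ... | inj₂ yx∈ = clash σ ρ (sym (All.lookup agrees yx∈)) (lt′ , lt)
    con′ : Consistent (λ x y → rank σ x < rank σ y) (λ x y → rank ρ x < rank ρ y)
    con′ qxy lt lt′ with compared-true (path D ρ) qxy
    ... | inj₁ xy∈ = clash σ ρ (sym (All.lookup agrees xy∈)) (lt , lt′)
    ... | inj₂ yx∈ = clash ρ σ (All.lookup agrees yx∈) (lt′ , lt)
    go : ∀ p p′ → Ranked ρ 0 p → Ranked σ 0 p′ → (∀ {w} → w ∈ p → w ∈ p′) → (∀ {w} → w ∈ p′ → w ∈ p) →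
      Unique p → Unique p′ → runs q p ≡ runs q p′ → p ≡ p′
    go []      []       _ _ _ _ _ _ _ = refl
    go (x ∷ p) (y ∷ p′) r s ⊆ ⊇ p!@(x∉ ∷ p!′) p′!@(y∉ ∷ p′!′) eq with refl , eq′ ← ∷-injective eq
      with Ranked⇒Sorted r | Ranked⇒Sorted s
    ... | _ ∷ Rs | _ ∷ Ss = cong (x ∷_) (reconstruct con con′ (<-irrefl refl) (<-irrefl refl) x p p′ p!′ p′!′ Rs Ss
          (λ w∈ → ∈-tail (⊆ (there w∈)) (All.lookup x∉ w∈)) (λ w∈ → ∈-tail (⊇ (there w∈)) (All.lookup y∉ w∈)) eq′)

  -- A ranking is coded by its transcript and its runs. The exponent is `suc k` because `runs` lists
  -- the first item besides at most `k` starts.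
  good-bound : ∀ k → length (filter (λ p → #bad T p ≤? k) (rankings T)) ≤ 2 ^ d * suc n ^ suc k
  good-bound k = injection⇒length≤ (Unique.filter⁺ (λ p → #bad T p ≤? k) (Unique-rankings T T!)) code code-injective
    where
    goods = filter (λ p → #bad T p ≤? k) (rankings T)
    ↭T : ∀ {p} → p ∈ goods → p ↭ leaves T
    ↭T p∈ = rankings-↭ T (proj₁ (∈-filter⁻ (λ p → #bad T p ≤? k) {xs = rankings T} p∈))
    rk : ∀ {p} → p ∈ goods → Σ (Ranking n) λ ρ → Ranked ρ 0 p
    rk {p} p∈ = ranking p (↭.↭-trans (↭T p∈) T↭)
    tr : ∀ {p} → p ∈ goods → ℕ
    tr p∈ = transcript D (proj₁ (rk p∈))
    rs : ∀ {p} → p ∈ goods → List (Fin n)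
    rs {p} p∈ = runs (compared (path D (proj₁ (rk p∈)))) p
    tr< : ∀ {p} (p∈ : p ∈ goods) → tr p∈ < 2 ^ d
    tr< p∈ = ≤-trans (transcript-< D (proj₁ (rk p∈))) (^-monoʳ-≤ 2 (depth (proj₁ (rk p∈))))
    rs< : ∀ {p} (p∈ : p ∈ goods) → encode (rs p∈) < suc n ^ suc k
    rs< p∈ = encode-< (rs p∈) (suc k) (≤-trans (runs-length (proj₂ (rk p∈)) (↭T p∈))
      (s≤s (proj₂ (∈-filter⁻ (λ p → #bad T p ≤? k) {xs = rankings T} p∈))))
    code : ∀ {p} → p ∈ goods → Fin (2 ^ d * suc n ^ suc k)
    code p∈ = combine (fromℕ< (tr< p∈)) (fromℕ< (rs< p∈))
    code-injective : ∀ {p p′} (p∈ : p ∈ goods) (p′∈ : p′ ∈ goods) → code p∈ ≡ code p′∈ → p ≡ p′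
    code-injective p∈ p′∈ eq with combine-injective (fromℕ< (tr< p∈)) (fromℕ< (rs< p∈)) (fromℕ< (tr< p′∈)) (fromℕ< (rs< p′∈)) eq
    ... | eq₁ , eq₂ = runs-determine (proj₂ (rk p∈)) (proj₂ (rk p′∈)) (↭T p∈) (↭T p′∈)
      (fromℕ<-injective _ _ (tr< p∈) (tr< p′∈) eq₁)
      (encode-injective (rs p∈) (rs p′∈) (fromℕ<-injective _ _ (rs< p∈) (rs< p′∈) eq₂))

  -- By Markov's inequality at least half of the rankings have at most 2 k bad pairs. Besides 2 k,
  -- the exponent counts 1 for the first item of the runs and 1 for the factor 2, which is at most n
  -- + 1.
  factorial-bound : ∀ k → total-bad T ≤ k * size T ! → n ! ≤ 2 ^ d * suc n ^ (2 + 2 * k)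
  factorial-bound k total≤ = begin
    n !                                   ≡⟨ sym (trans (length-rankings T) (cong _! size≡n)) ⟩
    length (rankings T)                   ≤⟨ markov (#bad T) k (rankings T) (subst (λ m → total-bad T ≤ k * m) (sym (length-rankings T)) total≤) ⟩
    2 * length (filter (λ p → #bad T p ≤? 2 * k) (rankings T))
                                          ≤⟨ *-mono-≤ 2≤1+n (good-bound (2 * k)) ⟩
    suc n * (2 ^ d * suc n ^ suc (2 * k)) ≡⟨ arith (suc n) (2 ^ d) (suc n ^ suc (2 * k)) ⟩
    2 ^ d * suc n ^ (2 + 2 * k)           ∎
    where
    open ≤-Reasoning
    -- A tree has at least one leaf.
    2≤1+n : 2 ≤ suc n
    2≤1+n with leaves-∷ T
    ... | _ , eq = s≤s (subst (1 ≤_) (trans (sym eq) size≡n) (s≤s z≤n))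
    arith : ∀ a b c → a * (b * c) ≡ b * (a * c)
    arith = solve-∀

mainTheorem2 : ∃[ C ] ((n : ℕ) (T : BTree (Fin n)) → leaves T ↭ allFin n →
    (D : DTree n) → ((ρ : Ranking n) → IsMInv T ρ (eval D ρ)) →
    (d : ℕ) → ((ρ : Ranking n) → queries D ρ ≤ d) →
    n ! ≤ 2 ^ d * (suc n) ^ C)
-- 576 bounds the average number of bad pairs: two values of 36 at a node, twice the smaller side
-- for the changes of side, and the factor 4 from `combine-bounds`.
mainTheorem2 = 2 + 2 * 576 , λ n T T↭ D correct d depth →
  Algorithm.factorial-bound T T↭ D correct d depth 576
    (total-bad≤ T (Algorithm.T! T T↭ D correct d depth))
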